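{- Let $\theta$ be a skew diagram, let $\mu,\nu$ be partitions with $\ell(\nu)\le n$, and let $c_{\theta\mu}^{\nu}\in\mathbb{F}(\beta)$ be the coefficients defined by $$G_\theta(x)\,G_\mu(x)=\sum_{\nu:\ \ell(\nu)\le n}c_{\theta\mu}^{\nu}\,G_\nu(x).$$ Then $c_{\theta\mu}^{\nu}$ is equal to $\beta^{|\nu|-|\mu|-|\theta|}$ times the number of set-valued $\theta$-tableaux $T$ whose column word $r_1r_2\cdots r_l$ (with $l=|T|$) is such that there is a sequence of partitions $$\mu=\rho^{(0)}\stackrel{r_1}{\longrightarrow}\rho^{(1)}\stackrel{r_2}{\longrightarrow}\cdots\stackrel{r_l}{\longrightarrow}\rho^{(l)}=\nu .$$
   Context: Fix a positive integer $n$, a field $\mathbb{F}$ and an indeterminate $\beta$ over $\mathbb{F}$; $[n]=\{1,\dots,n\}$, $x=(x_1,\dots,x_n)$. A partition is identified with its Young diagram (rows counted from the top; box $(i,j)$ lies in row $i$, column $j$); $\ell(\lambda)$ is the number of nonzero parts. A skew diagram is $\theta=\lambda/\mu$ with $\mu\subset\lambda$; every partition is also a skew diagram. $|\theta|$ is the number of boxes. A (semistandard) set-valued $\theta$-tableau $T$ assigns to each box $\alpha\in\theta$ a non-empty set $T(\alpha)\subset[n]$ such that if $\alpha$ is immediately to the left of $\alpha'$ then $\max T(\alpha)\le\min T(\alpha')$, and if $\alpha$ is immediately above $\alpha'$ then $\max T(\alpha)<\min T(\alpha')$. $|T|=\sum_\alpha|T(\alpha)|$ is the number of entries of $T$. The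 ordinary Grothendieck polynomial is $G_\theta(x)=\sum_T\beta^{|T|-|\theta|}\prod_{\alpha\in\theta,\ r\in T(\alpha)}x_r$, summed over all set-valued $\theta$-tableaux $T$. The polynomials $G_\lambda(x)$, $\ell(\lambda)\le n$, form a basis of the symmetric polynomials in $x_1,\dots,x_n$ over $\mathbb{F}(\beta)$, so the $c_{\theta\mu}^\nu$ are well defined. The column word of $T$ is the sequence obtained by reading the entries of $T$ column by column starting from the rightmost column and moving left, from top to bottom within each column, and in decreasing order within each box. $\lambda\stackrel{r}{\longrightarrow}\mu$ means that the partition $\mu$ is obtained from the partition $\lambda$ by adding one box in row $r$. -}

module Defs where

open import Algebra.Apartness.Bundles using (HeytingCommutativeRing; HeytingField)
import Algebra.Apartness.Properties.HeytingCommutativeRing as HeytingProperties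
open import Algebra.Bundles using (CommutativeRing; RawRing)
import Algebra.Definitions.RawSemiring as RawSemiringDefinitions
import Algebra.Properties.Group as GroupProperties
import Algebra.Properties.Ring as RingProperties
import Algebra.Solver.Ring.NaturalCoefficients.Default as Solver
open import Data.Fin.Base using (Fin; zero; suc; toℕ)
open import Data.Fin.Properties using (all?)
open import Data.Fin.Subset using (Subset; Nonempty; inside; outside)
import Data.Fin.Subset as Subset
open import Data.Fin.Subset.Properties using (nonempty?; _∈?_)
open import Data.Integer.Base using (ℤ; +_; -[1+_]; _⊖_)
open import Data.List.Base as List
  using (List; []; _∷_; length; map; concatMap; filter; foldr; reverse; allFin; upTo; downFrom; cartesianProductWith)
import Data.List.Extrema.Nat as Extrema
open import Data.List.Membership.Propositional using (_∉_)
open import Data.List.Properties using (≡-dec)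
open import Data.List.Relation.Unary.All using (All; []; _∷_)
open import Data.List.Relation.Unary.Linked using (Linked; []; linked?)
open import Data.List.Relation.Unary.Unique.Propositional using (Unique)
open import Data.Nat.Base using (ℕ; zero; suc; _≤_; _<_; _≥_; z≤n; s≤s)
open import Data.Nat.ListAction using (sum)
import Data.Nat.Properties as ℕ
open import Data.Product.Base using (∃; _×_; _,_; proj₁; proj₂)
open import Data.Sum.Base using (_⊎_; inj₁; inj₂)
open import Data.Vec.Base as Vec using (Vec; []; _∷_; lookup; toList)
open import Level using (Level; _⊔_)
open import Relation.Binary.PropositionalEquality as ≡ using (_≡_)
open import Relation.Nullary using (Dec; yes; no)
open import Relation.Nullary.Decidable using (map′; recompute; _×-dec_; _→-dec_)

private variable
  a : Level
  A : Set a

------------------------------------------------------------------------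
-- The polynomial ring R[X]

-- A polynomial is the list of its coefficients, constant term first.
-- Trailing zeros are allowed, so equality is coefficientwise.

module Polynomials {c ℓ} (R : CommutativeRing c ℓ) where
  open CommutativeRing R

  coeff : List Carrier → ℕ → Carrier
  coeff []      _       = 0#
  coeff (a ∷ p) zero    = a
  coeff (a ∷ p) (suc k) = coeff p k

  infix 4 _≈ₚ_
  record _≈ₚ_ (p q : List Carrier) : Set ℓ where
    constructor coeffwise
    field at : ∀ k → coeff p k ≈ coeff q k
  open _≈ₚ_ public

  infixl 6 _+ₚ_
  _+ₚ_ : List Carrier → List Carrier → List Carrier
  []      +ₚ q       = q
  (a ∷ p) +ₚ []      = a ∷ p
  (a ∷ p) +ₚ (b ∷ q) = a + b ∷ p +ₚ q

  -ₚ_ : List Carrier → List Carrier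
  -ₚ_ = map (-_)

  infixr 8 _·_
  _·_ : Carrier → List Carrier → List Carrier
  a · p = map (a *_) p

  infixl 7 _*ₚ_
  _*ₚ_ : List Carrier → List Carrier → List Carrier
  []      *ₚ q = []
  (a ∷ p) *ₚ q = a · q +ₚ (0# ∷ p *ₚ q)

  coeff-+ : ∀ p q k → coeff (p +ₚ q) k ≈ coeff p k + coeff q k
  coeff-+ []      q       k       = sym (+-identityˡ _)
  coeff-+ (a ∷ p) []      k       = sym (+-identityʳ _)
  coeff-+ (a ∷ p) (b ∷ q) zero    = refl
  coeff-+ (a ∷ p) (b ∷ q) (suc k) = coeff-+ p q k

  private
    open Solver commutativeSemiring using (solve)
      renaming (_:=_ to infix 4 _⊜_; _:+_ to infixl 6 _⊕_; _:*_ to infixl 7 _⊗_)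
    open RingProperties ring using (-0#≈0#)

    coeff-neg : ∀ p k → coeff (-ₚ p) k ≈ - coeff p k
    coeff-neg []      k       = sym -0#≈0#
    coeff-neg (a ∷ p) zero    = refl
    coeff-neg (a ∷ p) (suc k) = coeff-neg p k

  coeff-· : ∀ a p k → coeff (a · p) k ≈ a * coeff p k
  coeff-· a []      k       = sym (zeroʳ a)
  coeff-· a (b ∷ p) zero    = refl
  coeff-· a (b ∷ p) (suc k) = coeff-· a p k

  coeff-*-zero : ∀ a p q → coeff ((a ∷ p) *ₚ q) 0 ≈ a * coeff q 0
  coeff-*-zero a p q =
    trans (coeff-+ (a · q) _ 0) (trans (+-identityʳ _) (coeff-· a q 0))

  coeff-*-suc : ∀ a p q k →
                coeff ((a ∷ p) *ₚ q) (suc k) ≈ a * coeff q (suc k) + coeff (p *ₚ q) k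
  coeff-*-suc a p q k =
    trans (coeff-+ (a · q) _ (suc k)) (+-congʳ (coeff-· a q (suc k)))

  private
    reflₚ : ∀ {p} → p ≈ₚ p
    reflₚ = coeffwise λ _ → refl

    symₚ : ∀ {p q} → p ≈ₚ q → q ≈ₚ p
    symₚ e = coeffwise λ k → sym (at e k)

    transₚ : ∀ {p q r} → p ≈ₚ q → q ≈ₚ r → p ≈ₚ r
    transₚ e f = coeffwise λ k → trans (at e k) (at f k)

    +-congₚ : ∀ {p p₁ q q₁} → p ≈ₚ p₁ → q ≈ₚ q₁ → p +ₚ q ≈ₚ p₁ +ₚ q₁
    +-congₚ {p} {p₁} {q} {q₁} e f = coeffwise λ k →
      trans (coeff-+ p q k)
        (trans (+-cong (at e k) (at f k)) (sym (coeff-+ p₁ q₁ k)))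

    ∷-cong : ∀ {a b p q} → a ≈ b → p ≈ₚ q → (a ∷ p) ≈ₚ (b ∷ q)
    ∷-cong e f = coeffwise λ { zero → e ; (suc k) → at f k }

    *-zeroʳ : ∀ p → p *ₚ [] ≈ₚ []
    *-zeroʳ []      = reflₚ
    *-zeroʳ (a ∷ p) = coeffwise λ { zero → refl ; (suc k) → at (*-zeroʳ p) k }

    coeff-*ʳ-zero : ∀ p b q → coeff (p *ₚ (b ∷ q)) 0 ≈ coeff p 0 * b
    coeff-*ʳ-zero []      b q = sym (zeroˡ b)
    coeff-*ʳ-zero (a ∷ p) b q = coeff-*-zero a p (b ∷ q)

  coeff-*ʳ-suc : ∀ p b q k →
                 coeff (p *ₚ (b ∷ q)) (suc k) ≈ coeff p (suc k) * b + coeff (p *ₚ q) k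
  coeff-*ʳ-suc []      b q k    = sym (trans (+-identityʳ _) (zeroˡ b))
  coeff-*ʳ-suc (a ∷ p) b q zero =
    trans (coeff-*-suc a p (b ∷ q) 0)
      (trans (+-congˡ (coeff-*ʳ-zero p b q))
        (trans (+-comm _ _) (+-congˡ (sym (coeff-*-zero a p q)))))
  coeff-*ʳ-suc (a ∷ p) b q (suc k) =
    trans (coeff-*-suc a p (b ∷ q) (suc k))
      (trans (+-congˡ (coeff-*ʳ-suc p b q k))
        (trans
          (solve 3 (λ x y z → x ⊕ (y ⊕ z) ⊜ y ⊕ (x ⊕ z)) refl _ _ _)
          (+-congˡ (sym (coeff-*-suc a p q k)))))

  private
    *-commₚ : ∀ p q → p *ₚ q ≈ₚ q *ₚ p
    *-commₚ []      q = symₚ (*-zeroʳ q)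
    *-commₚ (a ∷ p) q = coeffwise λ
      { zero    → trans (coeff-*-zero a p q)
                    (trans (*-comm _ _) (sym (coeff-*ʳ-zero q a p)))
      ; (suc k) → trans (coeff-*-suc a p q k)
                    (trans (+-cong (*-comm _ _) (at (*-commₚ p q) k))
                      (sym (coeff-*ʳ-suc q a p k)))
      }

    ·-congʳ : ∀ a {p q} → p ≈ₚ q → a · p ≈ₚ a · q
    ·-congʳ a {p} {q} e = coeffwise λ k →
      trans (coeff-· a p k) (trans (*-congˡ (at e k)) (sym (coeff-· a q k)))

    *-congʳₚ : ∀ p {q r} → q ≈ₚ r → p *ₚ q ≈ₚ p *ₚ r
    *-congʳₚ []      e = reflₚ
    *-congʳₚ (a ∷ p) e = +-congₚ (·-congʳ a e) (∷-cong refl (*-congʳₚ p e))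

    *-congₚ : ∀ {p p₁ q q₁} → p ≈ₚ p₁ → q ≈ₚ q₁ → p *ₚ q ≈ₚ p₁ *ₚ q₁
    *-congₚ {p} {p₁} {q} {q₁} e f =
      transₚ (*-congʳₚ p f)
        (transₚ (*-commₚ p q₁) (transₚ (*-congʳₚ q₁ e) (*-commₚ q₁ p₁)))

    distribˡₚ : ∀ p q r → p *ₚ (q +ₚ r) ≈ₚ p *ₚ q +ₚ p *ₚ r
    distribˡₚ []      q r = reflₚ
    distribˡₚ (a ∷ p) q r = coeffwise λ
      { zero → trans (coeff-*-zero a p (q +ₚ r))
          (trans (*-congˡ (coeff-+ q r 0))
          (trans (distribˡ _ _ _)
          (trans (sym (+-cong (coeff-*-zero a p q) (coeff-*-zero a p r)))
                 (sym (coeff-+ ((a ∷ p) *ₚ q) ((a ∷ p) *ₚ r) 0)))))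
      ; (suc k) → trans (coeff-*-suc a p (q +ₚ r) k)
          (trans (+-cong (*-congˡ (coeff-+ q r (suc k)))
                         (trans (at (distribˡₚ p q r) k) (coeff-+ (p *ₚ q) _ k)))
          (trans (solve 5 (λ x y z u v → x ⊗ (y ⊕ z) ⊕ (u ⊕ v) ⊜ (x ⊗ y ⊕ u) ⊕ (x ⊗ z ⊕ v))
                   refl _ _ _ _ _)
          (trans (sym (+-cong (coeff-*-suc a p q k) (coeff-*-suc a p r k)))
                 (sym (coeff-+ ((a ∷ p) *ₚ q) ((a ∷ p) *ₚ r) (suc k))))))
      }

    distribʳₚ : ∀ r p q → (p +ₚ q) *ₚ r ≈ₚ p *ₚ r +ₚ q *ₚ r
    distribʳₚ r p q = transₚ (*-commₚ (p +ₚ q) r)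
      (transₚ (distribˡₚ r p q) (+-congₚ (*-commₚ r p) (*-commₚ r q)))

    ·-*-assoc : ∀ a p q → (a · p) *ₚ q ≈ₚ a · (p *ₚ q)
    ·-*-assoc a []      q = reflₚ
    ·-*-assoc a (b ∷ p) q = coeffwise λ
      { zero → trans (coeff-*-zero (a * b) (a · p) q)
          (trans (*-assoc _ _ _)
          (trans (*-congˡ (sym (coeff-*-zero b p q)))
                 (sym (coeff-· a ((b ∷ p) *ₚ q) 0))))
      ; (suc k) → trans (coeff-*-suc (a * b) (a · p) q k)
          (trans (+-cong (*-assoc _ _ _)
                         (trans (at (·-*-assoc a p q) k) (coeff-· a (p *ₚ q) k)))
          (trans (sym (distribˡ _ _ _))
          (trans (*-congˡ (sym (coeff-*-suc b p q k)))
                 (sym (coeff-· a ((b ∷ p) *ₚ q) (suc k))))))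
      }

    shift-* : ∀ p q → (0# ∷ p) *ₚ q ≈ₚ (0# ∷ p *ₚ q)
    shift-* p q = coeffwise λ
      { zero    → trans (coeff-*-zero 0# p q) (zeroˡ _)
      ; (suc k) → trans (coeff-*-suc 0# p q k)
                    (trans (+-congʳ (zeroˡ _)) (+-identityˡ _))
      }

    *-assocₚ : ∀ p q r → (p *ₚ q) *ₚ r ≈ₚ p *ₚ (q *ₚ r)
    *-assocₚ []      q r = reflₚ
    *-assocₚ (a ∷ p) q r = transₚ (distribʳₚ r (a · q) (0# ∷ p *ₚ q))
      (+-congₚ (·-*-assoc a q r)
               (transₚ (shift-* (p *ₚ q) r) (∷-cong refl (*-assocₚ p q r))))

    *-identityˡₚ : ∀ p → (1# ∷ []) *ₚ p ≈ₚ p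
    *-identityˡₚ p = coeffwise λ
      { zero    → trans (coeff-*-zero 1# [] p) (*-identityˡ _)
      ; (suc k) → trans (coeff-*-suc 1# [] p k) (trans (+-identityʳ _) (*-identityˡ _))
      }

    +-assocₚ : ∀ p q r → (p +ₚ q) +ₚ r ≈ₚ p +ₚ (q +ₚ r)
    +-assocₚ p q r = coeffwise λ k →
      trans (coeff-+ (p +ₚ q) r k)
        (trans (+-congʳ (coeff-+ p q k))
          (trans (+-assoc _ _ _)
            (trans (+-congˡ (sym (coeff-+ q r k))) (sym (coeff-+ p (q +ₚ r) k)))))

    +-commₚ : ∀ p q → p +ₚ q ≈ₚ q +ₚ p
    +-commₚ p q = coeffwise λ k →
      trans (coeff-+ p q k) (trans (+-comm _ _) (sym (coeff-+ q p k)))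

    -‿inverseʳₚ : ∀ p → p +ₚ (-ₚ p) ≈ₚ []
    -‿inverseʳₚ p = coeffwise λ k →
      trans (coeff-+ p (-ₚ p) k) (trans (+-congˡ (coeff-neg p k)) (-‿inverseʳ _))

    -‿congₚ : ∀ {p q} → p ≈ₚ q → -ₚ p ≈ₚ -ₚ q
    -‿congₚ {p} {q} e = coeffwise λ k →
      trans (coeff-neg p k) (trans (-‿cong (at e k)) (sym (coeff-neg q k)))

  polynomialRing : CommutativeRing c ℓ
  polynomialRing = record
    { Carrier = List Carrier
    ; _≈_ = _≈ₚ_
    ; _+_ = _+ₚ_
    ; _*_ = _*ₚ_
    ; -_ = -ₚ_
    ; 0# = []
    ; 1# = 1# ∷ []
    ; isCommutativeRing = record
      { isRing = record
        { +-isAbelianGroup = record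
          { isGroup = record
            { isMonoid = record
              { isSemigroup = record
                { isMagma = record
                  { isEquivalence = record { refl = reflₚ ; sym = symₚ ; trans = transₚ }
                  ; ∙-cong = +-congₚ
                  }
                ; assoc = +-assocₚ
                }
              ; identity = (λ _ → reflₚ) , λ p → +-commₚ p []
              }
            ; inverse = (λ p → transₚ (+-commₚ (-ₚ p) p) (-‿inverseʳₚ p)) , -‿inverseʳₚ
            ; ⁻¹-cong = -‿congₚ
            }
          ; comm = +-commₚ
          }
        ; *-cong = *-congₚ
        ; *-assoc = *-assocₚ
        ; *-identity = *-identityˡₚ
                     , λ p → transₚ (*-commₚ p (1# ∷ [])) (*-identityˡₚ p)
        ; distrib = distribˡₚ , distribʳₚ
        }
      ; *-comm = *-commₚ
      }
    }

  X : List Carrier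
  X = 0# ∷ 1# ∷ []

  constant : Carrier → List Carrier
  constant a = a ∷ []

open Polynomials using (polynomialRing)

_[X] : ∀ {c ℓ} → CommutativeRing c ℓ → CommutativeRing c ℓ
R [X] = polynomialRing R

-- R[x₁,…,xₙ] as the n-fold iterate of R ↦ R[X]; the outermost
-- indeterminate is x₁.

_[x_] : ∀ {c ℓ} → CommutativeRing c ℓ → ℕ → CommutativeRing c ℓ
R [x zero  ] = R
R [x suc n ] = (R [x n ]) [X]

module _ {c ℓ} (R : CommutativeRing c ℓ) where
  open CommutativeRing using (Carrier)

  scalar : ∀ n → Carrier R → Carrier (R [x n ])
  scalar zero    a = a
  scalar (suc n) a = Polynomials.constant (R [x n ]) (scalar n a)

  variable-x : ∀ n → Fin n → Carrier (R [x n ])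
  variable-x (suc n) zero    = Polynomials.X (R [x n ])
  variable-x (suc n) (suc i) = Polynomials.constant (R [x n ]) (variable-x n i)

------------------------------------------------------------------------
-- Rings of fractions p / q with q in a multiplicative set of cancellable
-- elements

record CancellableSet {c ℓ} (R : CommutativeRing c ℓ) p : Set (c ⊔ ℓ ⊔ Level.suc p) where
  open CommutativeRing R
  field
    D        : Carrier → Set p
    D-1      : D 1#
    D-*      : ∀ {x y} → D x → D y → D (x * y)
    D-cancel : ∀ {d} x y → D d → d * x ≈ d * y → x ≈ y

module Fractions {c ℓ p} (R : CommutativeRing c ℓ) (S : CancellableSet R p) where
  open CommutativeRing R
  open CancellableSet S

  infix 7 _/_⟨_⟩
  record Fraction : Set (c ⊔ p) where
    constructor _/_⟨_⟩
    field
      num : Carrier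
      den : Carrier
      D-den : D den
  open Fraction public

  infix 4 _≈ᶠ_
  record _≈ᶠ_ (x y : Fraction) : Set ℓ where
    constructor cross
    field uncross : num x * den y ≈ num y * den x
  open _≈ᶠ_ public

  infixl 6 _+ᶠ_
  _+ᶠ_ : Fraction → Fraction → Fraction
  (a / b ⟨ u ⟩) +ᶠ (c / d ⟨ v ⟩) = (a * d + c * b) / (b * d) ⟨ D-* u v ⟩

  infixl 7 _*ᶠ_
  _*ᶠ_ : Fraction → Fraction → Fraction
  (a / b ⟨ u ⟩) *ᶠ (c / d ⟨ v ⟩) = (a * c) / (b * d) ⟨ D-* u v ⟩

  -ᶠ_ : Fraction → Fraction
  -ᶠ (a / b ⟨ u ⟩) = (- a) / b ⟨ u ⟩

  0ᶠ 1ᶠ : Fraction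
  0ᶠ = 0# / 1# ⟨ D-1 ⟩
  1ᶠ = 1# / 1# ⟨ D-1 ⟩

  private
    open RingProperties ring using (-‿distribˡ-*)
    open Solver commutativeSemiring using (solve)
      renaming (_:=_ to infix 4 _⊜_; _:+_ to infixl 6 _⊕_; _:*_ to infixl 7 _⊗_)

    transᶠ : ∀ {x y z} → x ≈ᶠ y → y ≈ᶠ z → x ≈ᶠ z
    transᶠ {a / b ⟨ _ ⟩} {c / d ⟨ v ⟩} {e / f ⟨ _ ⟩} (cross p) (cross q) = cross (D-cancel _ _ v
      (trans (solve 3 (λ d a f → d ⊗ (a ⊗ f) ⊜ (a ⊗ d) ⊗ f) refl d a f)
      (trans (*-congʳ p)
      (trans (solve 3 (λ c b f → (c ⊗ b) ⊗ f ⊜ (c ⊗ f) ⊗ b) refl c b f)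
      (trans (*-congʳ q)
             (solve 3 (λ e d b → (e ⊗ d) ⊗ b ⊜ d ⊗ (e ⊗ b)) refl e d b))))))

    +-congᶠ : ∀ {x x₁ y y₁} → x ≈ᶠ x₁ → y ≈ᶠ y₁ → x +ᶠ y ≈ᶠ x₁ +ᶠ y₁
    +-congᶠ {a / b ⟨ _ ⟩} {a₁ / b₁ ⟨ _ ⟩} {c / d ⟨ _ ⟩} {c₁ / d₁ ⟨ _ ⟩} (cross p) (cross q) = cross
      (trans (solve 6 (λ a b c d b₁ d₁ → (a ⊗ d ⊕ c ⊗ b) ⊗ (b₁ ⊗ d₁)
                         ⊜ (a ⊗ b₁) ⊗ (d ⊗ d₁) ⊕ (c ⊗ d₁) ⊗ (b ⊗ b₁)) refl a b c d b₁ d₁)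
      (trans (+-cong (*-congʳ p) (*-congʳ q))
             (solve 6 (λ a₁ b c₁ d b₁ d₁ → (a₁ ⊗ b) ⊗ (d ⊗ d₁) ⊕ (c₁ ⊗ d) ⊗ (b ⊗ b₁)
                         ⊜ (a₁ ⊗ d₁ ⊕ c₁ ⊗ b₁) ⊗ (b ⊗ d)) refl a₁ b c₁ d b₁ d₁)))

    *-congᶠ : ∀ {x x₁ y y₁} → x ≈ᶠ x₁ → y ≈ᶠ y₁ → x *ᶠ y ≈ᶠ x₁ *ᶠ y₁
    *-congᶠ {a / b ⟨ _ ⟩} {a₁ / b₁ ⟨ _ ⟩} {c / d ⟨ _ ⟩} {c₁ / d₁ ⟨ _ ⟩} (cross p) (cross q) = cross
      (trans (solve 4 (λ a c b₁ d₁ → (a ⊗ c) ⊗ (b₁ ⊗ d₁) ⊜ (a ⊗ b₁) ⊗ (c ⊗ d₁)) refl a c b₁ d₁)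
      (trans (*-cong p q)
             (solve 4 (λ a₁ c₁ b d → (a₁ ⊗ b) ⊗ (c₁ ⊗ d) ⊜ (a₁ ⊗ c₁) ⊗ (b ⊗ d)) refl a₁ c₁ b d)))

    -‿congᶠ : ∀ {x y} → x ≈ᶠ y → -ᶠ x ≈ᶠ -ᶠ y
    -‿congᶠ {a / b ⟨ _ ⟩} {c / d ⟨ _ ⟩} (cross p) = cross
      (trans (sym (-‿distribˡ-* a d)) (trans (-‿cong p) (-‿distribˡ-* c b)))

    +-assocᶠ : ∀ x y z → (x +ᶠ y) +ᶠ z ≈ᶠ x +ᶠ (y +ᶠ z)
    +-assocᶠ (a / b ⟨ _ ⟩) (c / d ⟨ _ ⟩) (e / f ⟨ _ ⟩) = cross
      (solve 6 (λ a b c d e f →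
          ((a ⊗ d ⊕ c ⊗ b) ⊗ f ⊕ e ⊗ (b ⊗ d)) ⊗ (b ⊗ (d ⊗ f))
        ⊜ (a ⊗ (d ⊗ f) ⊕ (c ⊗ f ⊕ e ⊗ d) ⊗ b) ⊗ ((b ⊗ d) ⊗ f)) refl a b c d e f)

    +-commᶠ : ∀ x y → x +ᶠ y ≈ᶠ y +ᶠ x
    +-commᶠ (a / b ⟨ _ ⟩) (c / d ⟨ _ ⟩) = cross
      (solve 4 (λ a b c d →
        (a ⊗ d ⊕ c ⊗ b) ⊗ (d ⊗ b) ⊜ (c ⊗ b ⊕ a ⊗ d) ⊗ (b ⊗ d)) refl a b c d)

    *-assocᶠ : ∀ x y z → (x *ᶠ y) *ᶠ z ≈ᶠ x *ᶠ (y *ᶠ z)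
    *-assocᶠ (a / b ⟨ _ ⟩) (c / d ⟨ _ ⟩) (e / f ⟨ _ ⟩) = cross
      (solve 6 (λ a b c d e f →
          ((a ⊗ c) ⊗ e) ⊗ (b ⊗ (d ⊗ f)) ⊜ (a ⊗ (c ⊗ e)) ⊗ ((b ⊗ d) ⊗ f)) refl a b c d e f)

    *-commᶠ : ∀ x y → x *ᶠ y ≈ᶠ y *ᶠ x
    *-commᶠ (a / b ⟨ _ ⟩) (c / d ⟨ _ ⟩) = cross
      (solve 4 (λ a b c d → (a ⊗ c) ⊗ (d ⊗ b) ⊜ (c ⊗ a) ⊗ (b ⊗ d)) refl a b c d)

    distribˡᶠ : ∀ x y z → x *ᶠ (y +ᶠ z) ≈ᶠ x *ᶠ y +ᶠ x *ᶠ z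
    distribˡᶠ (a / b ⟨ _ ⟩) (c / d ⟨ _ ⟩) (e / f ⟨ _ ⟩) = cross
      (solve 6 (λ a b c d e f →
          (a ⊗ (c ⊗ f ⊕ e ⊗ d)) ⊗ ((b ⊗ d) ⊗ (b ⊗ f))
        ⊜ ((a ⊗ c) ⊗ (b ⊗ f) ⊕ (a ⊗ e) ⊗ (b ⊗ d)) ⊗ (b ⊗ (d ⊗ f))) refl a b c d e f)

    +-identityˡᶠ : ∀ x → 0ᶠ +ᶠ x ≈ᶠ x
    +-identityˡᶠ (a / b ⟨ _ ⟩) = cross
      (trans (*-congʳ (trans (+-cong (zeroˡ b) (*-identityʳ a)) (+-identityˡ a)))
             (*-congˡ (sym (*-identityˡ b))))

    *-identityˡᶠ : ∀ x → 1ᶠ *ᶠ x ≈ᶠ x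
    *-identityˡᶠ (a / b ⟨ _ ⟩) = cross
      (trans (*-congʳ (*-identityˡ a)) (*-congˡ (sym (*-identityˡ b))))

    -‿inverseˡᶠ : ∀ x → (-ᶠ x) +ᶠ x ≈ᶠ 0ᶠ
    -‿inverseˡᶠ (a / b ⟨ _ ⟩) = cross
      (trans (*-congʳ (trans (sym (distribʳ b (- a) a))
                             (trans (*-congʳ (-‿inverseˡ a)) (zeroˡ b))))
             (trans (zeroˡ _) (sym (zeroˡ _))))

  fractionRing : CommutativeRing (c ⊔ p) ℓ
  fractionRing = record
    { Carrier = Fraction
    ; _≈_ = _≈ᶠ_
    ; _+_ = _+ᶠ_
    ; _*_ = _*ᶠ_
    ; -_ = -ᶠ_
    ; 0# = 0ᶠ
    ; 1# = 1ᶠ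
    ; isCommutativeRing = record
      { isRing = record
        { +-isAbelianGroup = record
          { isGroup = record
            { isMonoid = record
              { isSemigroup = record
                { isMagma = record
                  { isEquivalence = record
                    { refl = cross refl
                    ; sym = λ e → cross (sym (uncross e))
                    ; trans = transᶠ
                    }
                  ; ∙-cong = +-congᶠ
                  }
                ; assoc = +-assocᶠ
                }
              ; identity = +-identityˡᶠ , λ x → transᶠ (+-commᶠ x 0ᶠ) (+-identityˡᶠ x)
              }
            ; inverse = -‿inverseˡᶠ , λ x → transᶠ (+-commᶠ x (-ᶠ x)) (-‿inverseˡᶠ x)
            ; ⁻¹-cong = -‿congᶠ
            }
          ; comm = +-commᶠ
          }
        ; *-cong = *-congᶠ
        ; *-assoc = *-assocᶠ
        ; *-identity = *-identityˡᶠ , λ x → transᶠ (*-commᶠ x 1ᶠ) (*-identityˡᶠ x)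
        ; distrib = distribˡᶠ
                  , λ x y z → transᶠ (*-commᶠ (y +ᶠ z) x)
                      (transᶠ (distribˡᶠ x y z) (+-congᶠ (*-commᶠ x y) (*-commᶠ x z)))
        }
      ; *-comm = *-commᶠ
      }
    }

------------------------------------------------------------------------
-- The field F(β)

-- F is a field in the usual constructive sense: x is invertible if and
-- only if x # 0, and # is tight.  When equality on F is decidable, x # y
-- may be taken to be ¬ (x ≈ y).

module RationalFunctions {c ℓ₁ ℓ₂} (F : HeytingField c ℓ₁ ℓ₂) where
  open HeytingField F hiding (zero)
  open HeytingProperties heytingCommutativeRing using (1#0; x#0y#0→xy#0; #-congʳ; invertibleˡ⇒#)

  baseRing : CommutativeRing c ℓ₁
  baseRing = HeytingCommutativeRing.commutativeRing heytingCommutativeRing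

  private
    module F = CommutativeRing baseRing
    open Solver F.commutativeSemiring using (solve)
      renaming (_:=_ to infix 4 _⊜_; _:+_ to infixl 6 _⊕_; _:*_ to infixl 7 _⊗_)

  open Polynomials baseRing
    using (coeff; _+ₚ_; -ₚ_; _*ₚ_; at; coeffwise; coeff-+; coeff-*-zero; coeff-*-suc; coeff-*ʳ-suc)

  F[β] : CommutativeRing c ℓ₁
  F[β] = baseRing [X]

  -- p ≠ 0 in the positive form given by the apartness relation of F.
  Nonzero : List Carrier → Set ℓ₂
  Nonzero p = ∃ λ k → coeff p k # 0#

  private
    open RingProperties F.ring using (-‿distribˡ-*; -‿distribʳ-*)
    open GroupProperties F.+-group using (⁻¹-anti-homo-∙)
    open HeytingProperties heytingCommutativeRing using (x-0≈x)

    factorˡ-#0 : ∀ x y → x * y # 0# → x # 0#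
    factorˡ-#0 x y xy#0 with #⇒invertible xy#0
    ... | i , i*xy≈1 , _ = invertibleˡ⇒# (i * y , F.trans
      (F.trans (F.*-congˡ (x-0≈x x))
        (F.trans (solve 3 (λ i y x → (i ⊗ y) ⊗ x ⊜ i ⊗ (x ⊗ y)) F.refl i y x)
                 (F.*-congˡ (F.sym (x-0≈x (x * y))))))
      i*xy≈1)

    summand-#0 : ∀ x y → x # y + x → y # 0#
    summand-#0 x y x#y+x with #⇒invertible x#y+x
    ... | i , i*d≈1 , _ = invertibleˡ⇒# (- i , F.trans
      (F.trans (F.*-congˡ (x-0≈x y))
        (F.trans (F.sym (-‿distribˡ-* i y))
          (F.trans (-‿distribʳ-* i y) (F.*-congˡ (F.sym x-[y+x]≈-y)))))
      i*d≈1)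
      where
      x-[y+x]≈-y : x + - (y + x) F.≈ - y
      x-[y+x]≈-y = F.trans (F.+-congˡ (⁻¹-anti-homo-∙ y x))
        (F.trans (F.sym (F.+-assoc x (- x) (- y)))
          (F.trans (F.+-congʳ (F.-‿inverseʳ x)) (F.+-identityˡ (- y))))

    -- If s # 0 and r ≈ x y + s, then r # 0 or x # 0.
    split-#0 : ∀ r x y s → s # 0# → r F.≈ x * y + s → r # 0# ⊎ x # 0#
    split-#0 r x y s s#0 r≈ with #-cotrans s#0 r
    ... | inj₁ s#r = inj₂ (factorˡ-#0 x y (summand-#0 s (x * y)
                       (#-sym (#-congʳ r≈ (#-sym s#r)))))
    ... | inj₂ r#0 = inj₁ r#0

    heads : ∀ a p b q → a # 0# → b # 0# → Nonzero ((a ∷ p) *ₚ (b ∷ q))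
    heads a p b q a#0 b#0 =
      0 , #-congʳ (F.sym (coeff-*-zero a p (b ∷ q))) (x#0y#0→xy#0 a#0 b#0)

  Nonzero-* : ∀ {p q} → Nonzero p → Nonzero q → Nonzero (p *ₚ q)
  Nonzero-* {p} {q} (j , u) (k , v) = go p q j k u v
    where
    go : ∀ p q j k → coeff p j # 0# → coeff q k # 0# → Nonzero (p *ₚ q)
    go []      q       j       k       u v with () ← #-irrefl F.refl u
    go (a ∷ p) []      j       k       u v with () ← #-irrefl F.refl v
    go (a ∷ p) (b ∷ q) zero    zero    u v = heads a p b q u v
    go (a ∷ p) (b ∷ q) zero    (suc k) u v
      with go (a ∷ p) q zero k u v
    ... | m , w
      with split-#0 _ _ _ _ w (F.trans (coeff-*ʳ-suc (a ∷ p) b q m) (F.+-congʳ (F.*-comm _ b)))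
    ...   | inj₁ r#0 = suc m , r#0
    ...   | inj₂ b#0 = heads a p b q u b#0
    go (a ∷ p) (b ∷ q) (suc j) k       u v
      with go p (b ∷ q) j k u v
    ... | m , w
      with split-#0 _ _ _ _ w (coeff-*-suc a p (b ∷ q) m)
    ...   | inj₁ r#0 = suc m , r#0
    ...   | inj₂ a#0 = with-head k v
      where
      with-head : ∀ k → coeff (b ∷ q) k # 0# → Nonzero ((a ∷ p) *ₚ (b ∷ q))
      with-head zero    v = heads a p b q a#0 v
      with-head (suc k) v with go (a ∷ p) q zero k a#0 v
      ... | m , w
        with split-#0 _ _ _ _ w (F.trans (coeff-*ʳ-suc (a ∷ p) b q m) (F.+-congʳ (F.*-comm _ b)))
      ...   | inj₁ r#0 = suc m , r#0
      ...   | inj₂ b#0 = heads a p b q a#0 b#0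

  private module P = CommutativeRing F[β]

  Nonzero-cancel : ∀ {p} x y → Nonzero p → p P.* x P.≈ p P.* y → x P.≈ y
  Nonzero-cancel {p} x y p#0 px≈py = x∙y⁻¹≈ε⇒x≈y _ _ (coeffwise λ k →
      proj₁ (tight _ _) λ d#0 →
        let (m , w) = Nonzero-* {p} {x P.- y} p#0 (k , d#0) in
        #-irrefl (at p[x-y]≈0 m) w)
    where
    open RingProperties P.ring using (x[y-z]≈xy-xz)
    open GroupProperties P.+-group using (x∙y⁻¹≈ε⇒x≈y; x≈y⇒x∙y⁻¹≈ε)
    p[x-y]≈0 : p P.* (x P.- y) P.≈ P.0#
    p[x-y]≈0 = P.trans (x[y-z]≈xy-xz p x y) (x≈y⇒x∙y⁻¹≈ε px≈py)

  1-Nonzero : Nonzero P.1#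
  1-Nonzero = 0 , 1#0

  nonzeroPolynomials : CancellableSet F[β] ℓ₂
  nonzeroPolynomials = record
    { D        = Nonzero
    ; D-1      = 1-Nonzero
    ; D-*      = λ {p} {q} → Nonzero-* {p} {q}
    ; D-cancel = λ {p} → Nonzero-cancel {p}
    }

  open Fractions F[β] nonzeroPolynomials public
    using (Fraction; _/_⟨_⟩; num; den; _≈ᶠ_; cross; uncross; fractionRing)

  F⟨β⟩ : CommutativeRing (c ⊔ ℓ₂) ℓ₁
  F⟨β⟩ = fractionRing

  β-Nonzero : Nonzero (Polynomials.X baseRing)
  β-Nonzero = 1 , 1#0

  open RawSemiringDefinitions (RawRing.rawSemiring (CommutativeRing.rawRing F⟨β⟩)) using (_^_)

  β β⁻¹ : Fraction
  β   = Polynomials.X baseRing / P.1# ⟨ 1-Nonzero ⟩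
  β⁻¹ = P.1# / Polynomials.X baseRing ⟨ β-Nonzero ⟩

  infixr 8 β^_
  β^_ : ℤ → Fraction
  β^ (+ k)    = β ^ k
  β^ -[1+ k ] = β⁻¹ ^ suc k

------------------------------------------------------------------------
-- Partitions and skew diagrams

-- Rows, columns and the elements of [n] are numbered from 0 throughout:
-- the index i stands for row (column, entry) i + 1.

record Partition : Set where
  constructor mkPartition
  field
    parts       : List ℕ
    .decreasing : Linked _≥_ parts
    .positive   : All (0 <_) parts
open Partition public using (parts)

ℓ : Partition → ℕ
ℓ ρ = length (parts ρ)

∣_∣ₚ : Partition → ℕ
∣ ρ ∣ₚ = sum (parts ρ)

∅ : Partition
∅ = mkPartition [] [] []

rowLength : Partition → ℕ → ℕ
rowLength ρ = go (parts ρ)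
  where
  go : List ℕ → ℕ → ℕ
  go []      _       = 0
  go (m ∷ p) zero    = m
  go (m ∷ p) (suc i) = go p i

Box : Set
Box = ℕ × ℕ

record SkewDiagram : Set where
  constructor _∖_⟨_⟩
  field
    outer inner : Partition
    contained   : ∀ i → rowLength inner i ≤ rowLength outer i
open SkewDiagram public

straight : Partition → SkewDiagram
straight ρ = ρ ∖ ∅ ⟨ (λ _ → z≤n) ⟩

_∈ₛ_ : Box → SkewDiagram → Set
(i , j) ∈ₛ θ = rowLength (inner θ) i ≤ j × j < rowLength (outer θ) i

_∈ₛ?_ : ∀ b θ → Dec (b ∈ₛ θ)
(i , j) ∈ₛ? θ = (rowLength (inner θ) i ℕ.≤? j) ×-dec (j ℕ.<? rowLength (outer θ) i)

-- Listed in the order of the column word: columns from right to left,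
-- each from top to bottom.
boxes : SkewDiagram → List Box
boxes θ = concatMap column (downFrom (rowLength (outer θ) 0))
  where
  column : ℕ → List Box
  column j = filter (_∈ₛ? θ) (map (λ i → i , j) (upTo (ℓ (outer θ))))

∣_∣ₛ : SkewDiagram → ℕ
∣ θ ∣ₛ = length (boxes θ)

_ImmediatelyLeftOf_ _ImmediatelyAbove_ : Box → Box → Set
(i , j) ImmediatelyLeftOf (i₁ , j₁) = i ≡ i₁ × suc j ≡ j₁
(i , j) ImmediatelyAbove  (i₁ , j₁) = suc i ≡ i₁ × j ≡ j₁

------------------------------------------------------------------------
-- Adding boxes one at a time

-- Adding a box in row r to a list of row lengths.  The result need not be
-- weakly decreasing; in _⟶[_]_ both ends are required to be partitions.

data _+□[_]_ : List ℕ → ℕ → List ℕ → Set where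
  new   : [] +□[ 0 ] (1 ∷ [])
  here  : ∀ {m p} → (m ∷ p) +□[ 0 ] (suc m ∷ p)
  there : ∀ {m p q r} → p +□[ r ] q → (m ∷ p) +□[ suc r ] (m ∷ q)

infix 4 _⟶[_]_
_⟶[_]_ : Partition → ℕ → Partition → Set
ρ ⟶[ r ] σ = parts ρ +□[ r ] parts σ

infixr 5 _∷_
data Path : Partition → List ℕ → Partition → Set where
  []  : ∀ {ρ} → Path ρ [] ρ
  _∷_ : ∀ {ρ σ ν r w} → ρ ⟶[ r ] σ → Path σ w ν → Path ρ (r ∷ w) ν

+□-functional : ∀ {p r q q₁} → p +□[ r ] q → p +□[ r ] q₁ → q ≡ q₁
+□-functional new       new       = ≡.refl
+□-functional here      here      = ≡.refl
+□-functional (there s) (there t) = ≡.cong (_ ∷_) (+□-functional s t)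

+□? : ∀ p r → Dec (∃ λ q → p +□[ r ] q)
+□? []      zero    = yes (_ , new)
+□? []      (suc r) = no λ ()
+□? (m ∷ p) zero    = yes (_ , here)
+□? (m ∷ p) (suc r) =
  map′ (λ (_ , s) → _ , there s) (λ { (_ , there s) → _ , s }) (+□? p r)

+□-positive : ∀ {p r q} → p +□[ r ] q → All (0 <_) p → All (0 <_) q
+□-positive new       []       = s≤s z≤n ∷ []
+□-positive here      (_ ∷ ps) = s≤s z≤n ∷ ps
+□-positive (there s) (x ∷ ps) = x ∷ +□-positive s ps

parts-injective : ∀ {ρ σ} → parts ρ ≡ parts σ → ρ ≡ σ
parts-injective ≡.refl = ≡.refl

step? : ∀ ρ r → Dec (∃ λ σ → ρ ⟶[ r ] σ)
step? ρ@(mkPartition p _ pos) r with +□? p r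
... | no  ¬s      = no λ (σ , s) → ¬s (parts σ , s)
... | yes (q , s) with linked? ℕ._≥?_ q
...   | yes d = yes (mkPartition q d (+□-positive s pos) , s)
...   | no ¬d = no λ (mkPartition q₁ d₁ _ , s₁) →
          ¬d (≡.subst (Linked _≥_) (+□-functional s₁ s) (recompute (linked? ℕ._≥?_ q₁) d₁))

path? : ∀ μ w ν → Dec (Path μ w ν)
path? μ []      ν with ≡-dec ℕ._≟_ (parts μ) (parts ν)
... | yes e = yes (≡.subst (Path μ []) (parts-injective {μ} {ν} e) [])
... | no ¬e = no λ { [] → ¬e ≡.refl }
path? μ (r ∷ w) ν with step? μ r
... | no ¬s       = no λ { (_∷_ {σ = σ} s _) → ¬s (σ , s) }
... | yes (σ , s) = map′ (_∷_ {σ = σ} s)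
        (λ { (_∷_ {σ = τ} t p) → ≡.subst (λ ρ → Path ρ w ν) (parts-injective {τ} {σ} (+□-functional t s)) p })
        (path? σ w ν)

------------------------------------------------------------------------
-- Set-valued tableaux with entries in [n]

vectors : List A → ∀ m → List (Vec A m)
vectors xs zero    = [] ∷ []
vectors xs (suc m) = cartesianProductWith _∷_ xs (vectors xs m)

subsets : ∀ n → List (Subset n)
subsets = vectors (inside ∷ outside ∷ [])

module _ {n : ℕ} where

  -- In increasing order.
  elements : Subset n → List (Fin n)
  elements S = filter (_∈? S) (allFin n)

  -- The first arguments of Extrema.max and Extrema.min are the values at
  -- the empty list; they do not affect the result for non-empty S.
  max min : Subset n → ℕ
  max S = Extrema.max 0 (map toℕ (elements S))
  min S = Extrema.min n (map toℕ (elements S))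

-- The k-th component is the set assigned to the k-th element of boxes θ.
Filling : ℕ → SkewDiagram → Set
Filling n θ = Vec (Subset n) ∣ θ ∣ₛ

module _ {n : ℕ} (θ : SkewDiagram) where

  box : Fin ∣ θ ∣ₛ → Box
  box = List.lookup (boxes θ)

  record IsTableau (T : Filling n θ) : Set where
    field
      nonempty      : ∀ α → Nonempty (lookup T α)
      rowsWeak      : ∀ α α₁ → box α ImmediatelyLeftOf box α₁ →
                      max (lookup T α) ≤ min (lookup T α₁)
      columnsStrict : ∀ α α₁ → box α ImmediatelyAbove box α₁ →
                      max (lookup T α) < min (lookup T α₁)

  isTableau? : ∀ T → Dec (IsTableau T)
  isTableau? T =
    map′ (λ (e , r , c) → record { nonempty = e ; rowsWeak = r ; columnsStrict = c })
         (λ t → let open IsTableau t in nonempty , rowsWeak , columnsStrict)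
         (all? (λ α → nonempty? (lookup T α))
           ×-dec all? (λ α → all? λ α₁ →
                   ((proj₁ (box α) ℕ.≟ proj₁ (box α₁)) ×-dec (suc (proj₂ (box α)) ℕ.≟ proj₂ (box α₁)))
                   →-dec (max (lookup T α) ℕ.≤? min (lookup T α₁)))
           ×-dec all? (λ α → all? λ α₁ →
                   ((suc (proj₁ (box α)) ℕ.≟ proj₁ (box α₁)) ×-dec (proj₂ (box α) ℕ.≟ proj₂ (box α₁)))
                   →-dec (max (lookup T α) ℕ.<? min (lookup T α₁))))

  entries : Filling n θ → List (Fin n)
  entries T = concatMap elements (toList T)

  size : Filling n θ → ℕ
  size T = sum (map Subset.∣_∣ (toList T))

  columnWord : Filling n θ → List (Fin n)
  columnWord T = concatMap (λ S → reverse (elements S)) (toList T)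

tableaux : ∀ n θ → List (Filling n θ)
tableaux n θ = filter (isTableau? θ) (vectors (subsets n) ∣ θ ∣ₛ)

numberOfTableaux : ∀ n → SkewDiagram → Partition → Partition → ℕ
numberOfTableaux n θ μ ν =
  length (filter (λ T → path? μ (map toℕ (columnWord θ T)) ν) (tableaux n θ))

------------------------------------------------------------------------
-- Grothendieck polynomials and their structure coefficients

module Grothendieck {c ℓ₁ ℓ₂} (F : HeytingField c ℓ₁ ℓ₂) (n : ℕ) where

  open RationalFunctions F public using (F⟨β⟩; β; β⁻¹; β^_)

  F⟨β⟩[x] : CommutativeRing (c ⊔ ℓ₂) ℓ₁
  F⟨β⟩[x] = F⟨β⟩ [x n ]

  module K  = CommutativeRing F⟨β⟩
  module Kx = CommutativeRing F⟨β⟩[x]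

  fromℕ : ℕ → K.Carrier
  fromℕ m = m ×ₖ K.1#
    where open RawSemiringDefinitions (RawRing.rawSemiring K.rawRing) using () renaming (_×_ to _×ₖ_)

  infixr 7 _•_
  _•_ : K.Carrier → Kx.Carrier → Kx.Carrier
  a • f = scalar F⟨β⟩ n a Kx.* f

  x : Fin n → Kx.Carrier
  x = variable-x F⟨β⟩ n

  ∑ : List A → (A → Kx.Carrier) → Kx.Carrier
  ∑ is f = foldr (λ i s → f i Kx.+ s) Kx.0# is

  ∏ : List A → (A → Kx.Carrier) → Kx.Carrier
  ∏ is f = foldr (λ i s → f i Kx.* s) Kx.1# is

  G : SkewDiagram → Kx.Carrier
  G θ = ∑ (tableaux n θ) λ T → β^ (size θ T ⊖ ∣ θ ∣ₛ) • ∏ (entries θ T) x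

  -- f = Σ_{ν : ℓ(ν) ≤ n} coef(ν) G_ν as a finite sum: the coefficients
  -- vanish outside the finite set `support`.  The values of coef at
  -- partitions with more than n parts are irrelevant.
  record IsExpansion (f : Kx.Carrier) (coef : Partition → K.Carrier) : Set (c ⊔ ℓ₁ ⊔ ℓ₂) where
    field
      support  : List Partition
      unique   : Unique support
      bounded  : All (λ ν → ℓ ν ≤ n) support
      vanishes : ∀ ν → ℓ ν ≤ n → ν ∉ support → coef ν K.≈ K.0#
      expands  : f Kx.≈ ∑ support λ ν → coef ν • G (straight ν)

{-# OPTIONS --safe #-}
-- Put y_r = β x_r, so that β^|θ| G_θ = Σ_T y^T, and let A_γ be the alternating
-- sum of ∏_r y_r^(γ_r + n − r) (1 + y_r)^(r − 1) over the permutations of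
-- y_1, …, y_n.  As Σ_T y^T is symmetric, its product with A_μ is the sum of the
-- A_(μ + content of T), T running over all set-valued tableaux.  Following
-- Stembridge, cancel the T whose column word leaves the partitions: if its first
-- letter to do so is k + 1, the tableaux that agree with T up to that letter
-- contribute 0 together, because their sum is symmetric in y_k and y_(k+1) up to
-- the factor needed.  What remains is the sum of A_ν over the tableaux and
-- partitions ν in the theorem.  For θ = λ and μ = ∅ this reads
-- β^|λ| G_λ A_∅ = A_λ; since A_∅ is cancellable and the A_ν are linearly
-- independent, dividing by A_∅ gives the expansion of G_θ G_μ.
--
-- Both the symmetry, which replaces the Bender–Knuth involution, and the
-- cancellation are inductions along the column word, letter by letter.
module Submission where

open import Defs
open import Algebra.Apartness.Bundles using (HeytingField)
open import Algebra.Bundles using (CommutativeRing; RawRing)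
import Algebra.Definitions.RawSemiring as RawSemiringDefinitions
import Algebra.Properties.CommutativeSemiring.Exp as Exp
import Algebra.Properties.Group as GroupProperties
import Algebra.Properties.Ring as RingProperties
import Algebra.Solver.Ring.NaturalCoefficients.Default as Solver
open import Data.Empty using (⊥; ⊥-elim)
open import Data.Fin.Base using (Fin; zero; suc; toℕ)
import Data.Fin.Properties as Fin
import Data.Fin.Subset as Subset
open import Data.Fin.Subset using (Subset; Nonempty; inside; outside)
open import Data.Fin.Subset.Properties using (nonempty?; _∈?_)
open import Data.Integer.Base as ℤ using (ℤ; +_; -[1+_]; _⊖_)
import Data.Integer.Properties as ℤ
open import Data.List.Base as List using (List; []; _∷_; _++_; length; map; filter; reverse; foldr; foldl; concatMap; allFin; upTo; downFrom; cartesianProductWith; deduplicate)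
import Data.List.Extrema.Nat as Extrema
open import Data.List.Membership.Propositional using (_∈_; _∉_; lose)
open import Data.List.Membership.Propositional.Properties using (∈-deduplicate⁺; ∈-deduplicate⁻; ∈-filter⁺; ∈-filter⁻; ∈-allFin)
import Data.List.Properties as List
open import Data.List.Relation.Binary.Permutation.Propositional using (_↭_; ↭-refl; ↭-trans; prep; swap)
open import Data.List.Relation.Binary.Permutation.Propositional.Properties using (↭-length; ↭-reverse)
open import Data.List.Relation.Binary.Pointwise using (Pointwise; []; _∷_)
open import Data.List.Relation.Unary.All as All using (All; []; _∷_)
import Data.List.Relation.Unary.All.Properties as All
open import Data.List.Relation.Unary.AllPairs as AllPairs using (AllPairs; []; _∷_)
import Data.List.Relation.Unary.AllPairs.Properties as AllPairs
open import Data.List.Relation.Unary.Any using (Any; here; there; any?)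
open import Data.List.Relation.Unary.Linked as Linked using (Linked; []; [-]; _∷_; linked?)
import Data.List.Relation.Unary.Unique.DecPropositional.Properties as Unique
open import Data.List.Relation.Unary.Unique.Propositional using (Unique)
open import Data.Maybe.Base using (Maybe; just; nothing; maybe′)
open import Data.Nat.Base as ℕ using (ℕ; zero; suc; _≤_; _<_; _≥_; _∸_; _⊔_; _⊓_; z≤n; s≤s; NonZero)
open import Data.Nat.ListAction using (sum)
import Data.Nat.Properties as ℕ
open import Data.Nat.Properties using (≤-refl; ≤-trans; ≤-reflexive; n≤1+n; n<1+n; <⇒≤; <⇒≢; >⇒≢; <⇒≱; ≮⇒≥; ≰⇒>; <-≤-trans; <-trans; <-irrefl; <-asym; m<n⇒m<1+n; m≤n+m; ≤∧≢⇒<; m∸n+n≡m; m≤n⇒m∸n≡0)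
open import Data.Product.Base using (∃; ∃₂; _×_; _,_; proj₁; proj₂)
open import Data.Sum.Base using (_⊎_; inj₁; inj₂)
open import Data.Unit.Base using (⊤; tt)
open import Data.Vec.Base as Vec using (Vec; []; _∷_; lookup; toList)
import Data.Vec.Properties as Vec
open import Function.Base using (_∘_; id; flip)
open import Level using (Level; Lift; lift)
open import Relation.Binary.Definitions using (tri<; tri≈; tri>)
open import Relation.Binary.PropositionalEquality as ≡ using (_≡_; _≢_)
open import Relation.Nullary using (Dec; yes; no; ¬_)
open import Relation.Nullary.Decidable using (_×-dec_; recompute)

-- A sum over the boxes still to be read can fail to be symmetric in the letters k and k + 1 only if
-- a box already read has left a bound that separates them: a row bound k, or a lower bound k + 1
-- for the box below. Such bounds do arise, since {k} and {k, k + 1} leave other bounds than {k +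
-- 1}. So symmetry alone is not inductive, and it is strengthened by two claims that compare the
-- sums which differ in one separating bound.
--
-- The exponents of 1 + y come from the failing letter. Once k + 1 has been read, k may still follow
-- in the same box, but not the other way round. The remaining sum is therefore not symmetric, but
-- its product with 1 + y is, where y is the variable of the letter k + 1. An alternant with two
-- equal parts supplies exactly this one extra factor.
--
-- Putting y = βx makes the weight of a tableau depend on its word alone, so that a box may be taken
-- apart letter by letter and β returns only at the end. Equality in a Heyting field cannot be
-- tested; cancellability therefore takes the place of being nonzero, and linear independence is
-- stated for formal combinations whose index vectors of natural numbers can be compared.

private variable
  lev lev′ : Level
  P : Set lev
  Q : Set lev′
  Ix Iy : Set lev

-- Sums over fillings, letter by letter

infixl 9 _[_≔_]
_[_≔_] : (ℕ → ℕ) → ℕ → ℕ → ℕ → ℕ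
(u [ i ≔ v ]) r with r ℕ.≟ i
... | yes _ = v
... | no  _ = u r

≔-here : ∀ u i v → (u [ i ≔ v ]) i ≡ v
≔-here u i v with i ℕ.≟ i
... | yes _ = ≡.refl
... | no ¬e = ⊥-elim (¬e ≡.refl)

≔-there : ∀ u i v {r} → r ≢ i → (u [ i ≔ v ]) r ≡ u r
≔-there u i v {r} r≢i with r ℕ.≟ i
... | yes e = ⊥-elim (r≢i e)
... | no  _ = ≡.refl

≔-≢ : ∀ u i r {v w} → v ≢ w → (r ≢ i → u r ≢ w) → (u [ i ≔ v ]) r ≢ w
≔-≢ u i r v≢w u≢w with r ℕ.≟ i
... | yes _  = v≢w
... | no r≢i = u≢w r≢i

-- A box being filled: nothing, or its largest and its smallest entry so far.
Cur : Set
Cur = Maybe (ℕ × ℕ)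

add : Cur → ℕ → Cur
add nothing         r = just (r , r)
add (just (mx , _)) r = just (mx , r)

Allowed : ℕ → ℕ → ℕ → Set
Allowed l v r = l ≤ r × r ≤ v

abstract
  allowed? : ∀ l v r → Dec (Allowed l v r)
  allowed? l v r = (l ℕ.≤? r) ×-dec (r ℕ.≤? v)

-- The invariant of a box whose letters from `r` upwards have been decided. Letters come in
-- decreasing order, so the last one taken is the minimum so far.
Valid : ℕ → ℕ → Cur → Set
Valid l r nothing           = ⊤
Valid l r (just (mx , mn)) = r ≤ mn × mn ≤ mx × l ≤ mn

Valid-add : ∀ {l r} c → Valid l (suc r) c → l ≤ r → Valid l r (add c r)
Valid-add nothing           _               l≤r = ≤-refl , ≤-refl , l≤r
Valid-add (just (mx , mn)) (r<mn , mn≤mx , _) l≤r =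
  ≤-refl , ≤-trans (<⇒≤ r<mn) mn≤mx , l≤r

Valid-skip : ∀ {l r} c → Valid l (suc r) c → Valid l r c
Valid-skip nothing  _           = tt
Valid-skip (just _) (r<mn , v) = <⇒≤ r<mn , v

shift : ∀ i h {m} → i ℕ.+ suc h ≡ m → suc i ℕ.+ h ≡ m
shift i h e = ≡.trans (≡.sym (ℕ.+-suc i h)) e

module Words {c ℓ₁} (R : CommutativeRing c ℓ₁) (n : ℕ) (a b : ℕ → ℕ) where
  open CommutativeRing R hiding (zero)

  ⟦_⟧ : Dec P → Carrier → Carrier
  ⟦ yes _ ⟧ x = x
  ⟦ no  _ ⟧ x = 0#

  ⟦⟧-yes : (d : Dec P) → P → ∀ {x} → ⟦ d ⟧ x ≈ x
  ⟦⟧-yes (yes _) _ = refl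
  ⟦⟧-yes (no ¬p) p = ⊥-elim (¬p p)

  ⟦⟧-no : (d : Dec P) → ¬ P → ∀ {x} → ⟦ d ⟧ x ≈ 0#
  ⟦⟧-no (yes p) ¬p = ⊥-elim (¬p p)
  ⟦⟧-no (no  _) _  = refl

  ⟦⟧-cong : (d : Dec P) → ∀ {x y} → (P → x ≈ y) → ⟦ d ⟧ x ≈ ⟦ d ⟧ y
  ⟦⟧-cong (yes p) e = e p
  ⟦⟧-cong (no  _) e = refl

  ⟦⟧-cong₂ : (d : Dec P) (d′ : Dec Q) → (P → Q) → (Q → P) →
             ∀ {x y} → (P → x ≈ y) → ⟦ d ⟧ x ≈ ⟦ d′ ⟧ y
  ⟦⟧-cong₂ (yes p) d′ f g e = trans (e p) (sym (⟦⟧-yes d′ (f p)))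
  ⟦⟧-cong₂ (no ¬p) d′ f g e = sym (⟦⟧-no d′ (λ q → ¬p (g q)))

  -- Column j occupies the rows i with a j ≤ i < b j.  The sum of f over the
  -- column words of the fillings of the last h boxes of column j, from row i
  -- downwards, and of all columns to the left of it.  The next box of row r
  -- must have its maximum ≤ u r, and the box in row i its minimum ≥ l.
  Col  : (j h i : ℕ) (u : ℕ → ℕ) (l : ℕ) (f : List ℕ → Carrier) → Carrier
  Next : (j : ℕ) (u : ℕ → ℕ) (f : List ℕ → Carrier) → Carrier
  Cell  : (r : ℕ) (c : Cur) (j h i : ℕ) (u : ℕ → ℕ) (l : ℕ) (f : List ℕ → Carrier) → Carrier
  Col j zero    i u l f = Next j u f
  Col j (suc h) i u l f = Cell n nothing j h i u l f
  Next zero    u f = f []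
  Next (suc j) u f = Col j (b j ∸ a j) (a j) u 0 f
  Cell zero    nothing           j h i u l f = 0#
  Cell zero    (just (mx , mn))  j h i u l f = Col j h (suc i) (u [ i ≔ mn ]) (suc mx) f
  Cell (suc r) c                 j h i u l f =
    Cell r c j h i u l f + ⟦ allowed? l (u i) r ⟧ (Cell r (add c r) j h i u l (λ w → f (r ∷ w)))

  mon : (ℕ → Carrier) → List ℕ → Carrier
  mon z []      = 1#
  mon z (r ∷ w) = z r * mon z w

  -- Rows that can have a box to the left of column j.  There is no upper limit
  -- on r: the bound u is vacuous in the rows below the shape.
  Left : ℕ → ℕ → Set
  Left zero    r = ⊥
  Left (suc j) r = a j ≤ r

  Left? : ∀ j r → Dec (Left j r)
  Left? zero    r = no λ ()
  Left? (suc j) r = a j ℕ.≤? r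

  Active : ℕ → ℕ → ℕ → Set
  Active j i r = i ≤ r ⊎ Left j r

  RowsAbove : ℕ → ℕ → ℕ → (ℕ → ℕ) → Set
  RowsAbove l j i u = ∀ r → r < i → Left j r → u r < l

  -- Columns increase strictly: each bound left higher up in the column is at most the maximum just
  -- read, hence below the lower bound `suc mx` of the next box.
  RowsAbove-suc : ∀ {l mx mn j i u} → RowsAbove l j i u → mn ≤ mx → l ≤ mn →
                  RowsAbove (suc mx) j (suc i) (u [ i ≔ mn ])
  RowsAbove-suc {i = i} above mn≤mx l≤mn r (s≤s r≤i) left with r ℕ.≟ i
  ... | yes _  = s≤s mn≤mx
  ... | no r≢i = <-≤-trans (above r (≤∧≢⇒< r≤i r≢i) left) (≤-trans l≤mn (≤-trans mn≤mx (n≤1+n _)))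

  module _ {I : Set c} (Λ : (I → Carrier) → Carrier)
    (Λ-cong : ∀ {f g} → (∀ y → f y ≈ g y) → Λ f ≈ Λ g)
    (Λ-0 : Λ (λ _ → 0#) ≈ 0#)
    (Λ-+ : ∀ f g → Λ (λ y → f y + g y) ≈ Λ f + Λ g) where

    -- These sums are finite sums of values of `f`, so every additive operation passes through them.
    -- It is used for the alternation `Alt` and, with a one-point index set, for multiplication by a
    -- fixed element.
    Col-Λ  : ∀ j h i u l (f : List ℕ → I → Carrier) →
             Λ (λ y → Col j h i u l (λ w → f w y)) ≈ Col j h i u l (λ w → Λ (f w))
    Next-Λ : ∀ j u (f : List ℕ → I → Carrier) →
             Λ (λ y → Next j u (λ w → f w y)) ≈ Next j u (λ w → Λ (f w))
    Cell-Λ  : ∀ r c j h i u l (f : List ℕ → I → Carrier) →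
             Λ (λ y → Cell r c j h i u l (λ w → f w y)) ≈ Cell r c j h i u l (λ w → Λ (f w))
    Col-Λ j zero    i u l f = Next-Λ j u f
    Col-Λ j (suc h) i u l f = Cell-Λ n nothing j h i u l f
    Next-Λ zero    u f = Λ-cong (λ _ → refl)
    Next-Λ (suc j) u f = Col-Λ j (b j ∸ a j) (a j) u 0 f
    Cell-Λ zero    nothing          j h i u l f = Λ-0
    Cell-Λ zero    (just (mx , mn)) j h i u l f = Col-Λ j h (suc i) _ _ f
    Cell-Λ (suc r) c                j h i u l f = trans (Λ-+ _ _)
      (+-cong (Cell-Λ r c j h i u l f) (aux (allowed? l (u i) r)))
      where
      aux : (d : Dec P) → Λ (λ y → ⟦ d ⟧ (Cell r (add c r) j h i u l (λ w → f (r ∷ w) y)))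
            ≈ ⟦ d ⟧ (Cell r (add c r) j h i u l (λ w → Λ (f (r ∷ w))))
      aux (yes _) = Cell-Λ r (add c r) j h i u l (λ w → f (r ∷ w))
      aux (no  _) = Λ-0

  Col-cong  : ∀ j h i u l {f g : List ℕ → Carrier} → (∀ w → f w ≈ g w) → Col j h i u l f ≈ Col j h i u l g
  Next-cong : ∀ j u {f g : List ℕ → Carrier} → (∀ w → f w ≈ g w) → Next j u f ≈ Next j u g
  Cell-cong  : ∀ r c j h i u l {f g : List ℕ → Carrier} → (∀ w → f w ≈ g w) →
              Cell r c j h i u l f ≈ Cell r c j h i u l g
  Col-cong j zero    i u l e = Next-cong j u e
  Col-cong j (suc h) i u l e = Cell-cong n nothing j h i u l e
  Next-cong zero    u e = e []
  Next-cong (suc j) u e = Col-cong j (b j ∸ a j) (a j) u 0 e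
  Cell-cong zero    nothing          j h i u l e = refl
  Cell-cong zero    (just (mx , mn)) j h i u l e = Col-cong j h (suc i) _ _ e
  Cell-cong (suc r) c j h i u l e = +-cong (Cell-cong r c j h i u l e)
    (⟦⟧-cong (allowed? l (u i) r) λ _ → Cell-cong r (add c r) j h i u l (λ w → e (r ∷ w)))

  Cell-* : ∀ r c j h i u l x f → Cell r c j h i u l (λ w → x * f w) ≈ x * Cell r c j h i u l f
  Cell-* r c j h i u l x f = sym (Cell-Λ {I = Lift _ ⊤} (λ g → x * g (lift tt))
    (λ e → *-congˡ (e _)) (zeroʳ x) (λ _ _ → distribˡ x _ _) r c j h i u l (λ w _ → f w))

  Cell-skip : ∀ r c j h i u l f → ¬ Allowed l (u i) r → Cell (suc r) c j h i u l f ≈ Cell r c j h i u l f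
  Cell-skip r c j h i u l f ¬al = trans (+-congˡ (⟦⟧-no (allowed? l (u i) r) ¬al)) (+-identityʳ _)

  Cell-take : ∀ r c j h i u l f → Allowed l (u i) r → Cell (suc r) c j h i u l f ≈
             Cell r c j h i u l f + Cell r (add c r) j h i u l (λ w → f (r ∷ w))
  Cell-take r c j h i u l f al = +-congˡ (⟦⟧-yes (allowed? l (u i) r) al)

  Cell-skips : ∀ d r c j h i u l f → (∀ s → r ≤ s → ¬ Allowed l (u i) s) →
              Cell (d ℕ.+ r) c j h i u l f ≈ Cell r c j h i u l f
  Cell-skips zero    r c j h i u l f ¬al = refl
  Cell-skips (suc d) r c j h i u l f ¬al =
    trans (Cell-skip (d ℕ.+ r) c j h i u l f (¬al _ (m≤n+m r d))) (Cell-skips d r c j h i u l f ¬al)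

  Cell-empty : ∀ r j h i u l f → (∀ s → ¬ Allowed l (u i) s) → Cell r nothing j h i u l f ≈ 0#
  Cell-empty zero    j h i u l f ¬al = refl
  Cell-empty (suc r) j h i u l f ¬al = trans (Cell-skip r nothing j h i u l f (¬al r)) (Cell-empty r j h i u l f ¬al)

  module Geometry (a-anti : ∀ j → a (suc j) ≤ a j) (b-anti : ∀ j → b (suc j) ≤ b j) (a≤b : ∀ j → a j ≤ b j) where

    Left-pred : ∀ j {r} → Left j r → Left (suc j) r
    Left-pred (suc j) le = ≤-trans (a-anti j) le

    Active-next : ∀ j {r i} → Active j (a j) r → Active (suc j) i r
    Active-next j (inj₁ le) = inj₂ le
    Active-next j (inj₂ le) = inj₂ (Left-pred j le)

    Active-suc : ∀ j i {r} → Active j (suc i) r → Active j i r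
    Active-suc j i (inj₁ lt) = inj₁ (<⇒≤ lt)
    Active-suc j i (inj₂ le) = inj₂ le

    ¬above : ∀ j {r} → r < a j → ¬ Left j r
    ¬above (suc j) r<a le = <-irrefl ≡.refl (<-≤-trans r<a (≤-trans (a-anti j) le))

    height : ∀ j → a j ℕ.+ (b j ∸ a j) ≡ b j
    height j = ℕ.m+[n∸m]≡n (a≤b j)

    -- Bounds of rows that are not active are never read again. In row `i` of `Cell-ext` only the
    -- letters still on offer have to agree, so the bounds k and k + 1 become interchangeable once
    -- these letters are decided.
    Col-ext  : ∀ j h i u u′ l f → (∀ r → Active j i r → u r ≡ u′ r) → Col j h i u l f ≈ Col j h i u′ l f
    Next-ext : ∀ j u u′ f → (∀ r → Left j r → u r ≡ u′ r) → Next j u f ≈ Next j u′ f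
    Cell-ext  : ∀ r c j h i u u′ l f →
               (∀ s → s < r → Allowed l (u i) s → Allowed l (u′ i) s) →
               (∀ s → s < r → Allowed l (u′ i) s → Allowed l (u i) s) →
               (∀ s → Active j (suc i) s → s ≢ i → u s ≡ u′ s) →
               Cell r c j h i u l f ≈ Cell r c j h i u′ l f
    Col-ext j zero    i u u′ l f e = Next-ext j u u′ f (λ r le → e r (inj₂ le))
    Col-ext j (suc h) i u u′ l f e = Cell-ext n nothing j h i u u′ l f
      (λ s _ → ≡.subst (λ v → Allowed l v s) (e i (inj₁ ≤-refl)))
      (λ s _ → ≡.subst (λ v → Allowed l v s) (≡.sym (e i (inj₁ ≤-refl))))
      (λ s act _ → e s (Active-suc j i act))
    Next-ext zero    u u′ f e = refl
    Next-ext (suc j) u u′ f e = Col-ext j (b j ∸ a j) (a j) u u′ 0 f (λ { r (inj₁ le) → e r le ; r (inj₂ le) → e r (Left-pred j le) })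
    Cell-ext zero    nothing          j h i u u′ l f p q e = refl
    Cell-ext zero    (just (mx , mn)) j h i u u′ l f p q e = Col-ext j h (suc i) _ _ _ f go
      where
      go : ∀ r → Active j (suc i) r → (u [ i ≔ mn ]) r ≡ (u′ [ i ≔ mn ]) r
      go r act with r ℕ.≟ i
      ... | yes _  = ≡.refl
      ... | no r≢i = e r act r≢i
    Cell-ext (suc r) c j h i u u′ l f p q e = +-cong
      (Cell-ext r c j h i u u′ l f p′ q′ e)
      (⟦⟧-cong₂ (allowed? l (u i) r) (allowed? l (u′ i) r) (p r ≤-refl) (q r ≤-refl)
        λ _ → Cell-ext r (add c r) j h i u u′ l _ p′ q′ e)
      where
      p′ = λ s s<r → p s (m<n⇒m<1+n s<r)
      q′ = λ s s<r → q s (m<n⇒m<1+n s<r)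

  Cell-none : ∀ r c j h i u l f → (∀ s → s < r → ¬ Allowed l (u i) s) →
             Cell r c j h i u l f ≈ Cell zero c j h i u l f
  Cell-none zero    c j h i u l f ¬al = refl
  Cell-none (suc r) c j h i u l f ¬al = trans (Cell-skip r c j h i u l f (¬al r ≤-refl))
    (Cell-none r c j h i u l f (λ s s<r → ¬al s (m<n⇒m<1+n s<r)))

  Cell-take-mon : ∀ r c j h i u l z → Allowed l (u i) r → Cell (suc r) c j h i u l (mon z) ≈
                 Cell r c j h i u l (mon z) + z r * Cell r (add c r) j h i u l (mon z)
  Cell-take-mon r c j h i u l z al =
    trans (Cell-take r c j h i u l (mon z) al) (+-congˡ (Cell-* r (add c r) j h i u l (z r) (mon z)))

-- Symmetry in two adjacent letters

module Symmetry {c ℓ₁} (R : CommutativeRing c ℓ₁) (n : ℕ) (a b : ℕ → ℕ)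
  (a-anti : ∀ j → a (suc j) ≤ a j) (b-anti : ∀ j → b (suc j) ≤ b j) (a≤b : ∀ j → a j ≤ b j)
  (k : ℕ) (k+1<n : suc k < n) where

  open CommutativeRing R hiding (zero)
  open import Relation.Binary.Reasoning.Setoid setoid
  open Solver commutativeSemiring using (solve)
    renaming (_:=_ to infix 4 _⊜_; _:+_ to infixl 6 _⊕_; _:*_ to infixl 7 _⊗_)
  open GroupProperties +-group using () renaming (∙-cancelʳ to +-cancelʳ)
  open Words R n a b
  open Geometry a-anti b-anti a≤b

  private
    n-split : ∃ λ d → d ℕ.+ suc (suc k) ≡ n
    n-split = n ∸ suc (suc k) , m∸n+n≡m k+1<n

  -- A bound u p ∈ {k, k + 1} is irrelevant once the box below that of row p
  -- has to start with a letter ≤ k + 1.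
  module PairCell (j h i : ℕ) (l p : ℕ) (u u′ : ℕ → ℕ) (i+h : i ℕ.+ suc h ≡ b j) (p<b : suc p < b j)
    (up : u p ≡ k) (u′p : u′ p ≡ suc k) (u≗ : ∀ r → r ≢ p → u r ≡ u′ r) (below : u (suc p) ≤ suc k) where

    module _ (i≢p : i ≢ p)
      (ih : ∀ f i u u′ l → i ℕ.+ h ≡ b j → u p ≡ k → u′ p ≡ suc k → (∀ r → r ≢ p → u r ≡ u′ r) →
            u (suc p) ≤ suc k → Col j h i u l f ≈ Col j h i u′ l f) where

      Fits : Cur → Set
      Fits nothing         = ⊤
      Fits (just (_ , mn)) = mn ≤ u i

      Fits-add : ∀ c {r} → r ≤ u i → Fits (add c r)
      Fits-add nothing  le = le
      Fits-add (just _) le = le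

      other : ∀ r c f → Fits c → Cell r c j h i u l f ≈ Cell r c j h i u′ l f
      other zero nothing f _ = refl
      other zero (just (mx , mn)) f mn≤u = ih f (suc i) _ _ (suc mx) (shift i h i+h)
        (≡.trans (≔-there u i mn (i≢p ∘ ≡.sym)) up)
        (≡.trans (≔-there u′ i mn (i≢p ∘ ≡.sym)) u′p)
        agree below′
        where
        agree : ∀ r → r ≢ p → (u [ i ≔ mn ]) r ≡ (u′ [ i ≔ mn ]) r
        agree r r≢p with r ℕ.≟ i
        ... | yes _ = ≡.refl
        ... | no  _ = u≗ r r≢p
        below′ : (u [ i ≔ mn ]) (suc p) ≤ suc k
        below′ with suc p ℕ.≟ i
        ... | yes ≡.refl = ≤-trans mn≤u below
        ... | no  _ = below
      other (suc r) c f fits = +-cong (other r c f fits)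
        (⟦⟧-cong₂ (allowed? l (u i) r) (allowed? l (u′ i) r)
          (≡.subst (λ v → Allowed l v r) (u≗ i i≢p)) (≡.subst (λ v → Allowed l v r) (≡.sym (u≗ i i≢p)))
          λ (_ , r≤u) → other r (add c r) _ (Fits-add c r≤u))

    module _ (i≡p : i ≡ p) where
      private
        u-i : u i ≡ k
        u-i = ≡.trans (≡.cong u i≡p) up
        u′-i : u′ i ≡ suc k
        u′-i = ≡.trans (≡.cong u′ i≡p) u′p
        below′ : ∀ mn → (u′ [ i ≔ mn ]) (suc i) ≤ suc k
        below′ mn = ≡.subst (_≤ suc k)
          (≡.trans (u≗ (suc p) (λ e → <-irrefl (≡.sym e) ≤-refl))
            (≡.trans (≡.cong (u′ ∘ suc) (≡.sym i≡p)) (≡.sym (≔-there u′ i mn λ e → <-irrefl (≡.sym e) ≤-refl))))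
          below
        h≢0 : h ≢ 0
        h≢0 ≡.refl = <-irrefl ≡.refl (≡.subst₂ _<_ (≡.cong suc (≡.sym i≡p)) (≡.trans (≡.sym i+h) (ℕ.+-comm i 1)) p<b)

      -- With maximum k + 1 in row `p`, the box below, which exists, would need a letter of at least
      -- k + 2, above its bound.
      blocked : ∀ r mn f → Cell r (just (suc k , mn)) j h i u′ l f ≈ 0#
      blocked zero mn f = go h h≢0
        where
        go : ∀ h → h ≢ 0 → Col j h (suc i) (u′ [ i ≔ mn ]) (suc (suc k)) f ≈ 0#
        go zero    h≢0 = ⊥-elim (h≢0 ≡.refl)
        go (suc h) _   = Cell-empty n j h (suc i) _ _ f
          λ s (k+2≤s , s≤u) → <-irrefl ≡.refl (≤-trans k+2≤s (≤-trans s≤u (below′ mn)))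
      blocked (suc r) mn f = trans (+-cong (blocked r mn f)
        (trans (⟦⟧-cong (allowed? l (u′ i) r) λ _ → blocked r r _) (lem (allowed? l (u′ i) r)))) (+-identityʳ 0#)
        where
        lem : ∀ {lev} {P : Set lev} (d : Dec P) → ⟦ d ⟧ 0# ≈ 0#
        lem (yes _) = refl
        lem (no  _) = refl

      -- Only the letter k + 1 distinguishes the two bounds, and by `blocked` it contributes
      -- nothing. Closing the box overwrites the bound of row `p`.
      same : ∀ f → Cell n nothing j h i u l f ≈ Cell n nothing j h i u′ l f
      same f = let (d , e) = n-split in ≡.subst (λ m → Cell m nothing j h i u l f ≈ Cell m nothing j h i u′ l f) e (begin
        Cell (d ℕ.+ suc (suc k)) nothing j h i u l f
          ≈⟨ Cell-skips d _ nothing j h i u l f (λ s le (_ , s≤u) →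
               <-irrefl ≡.refl (<-≤-trans (≤-trans (n<1+n (suc k)) le) (≤-trans s≤u (≤-trans (≤-reflexive u-i) (n≤1+n k))))) ⟩
        Cell (suc (suc k)) nothing j h i u l f
          ≈⟨ Cell-skip (suc k) nothing j h i u l f (λ (_ , le) → <-irrefl ≡.refl (≤-trans le (≤-reflexive u-i))) ⟩
        Cell (suc k) nothing j h i u l f
          ≈⟨ Cell-ext (suc k) nothing j h i u u′ l f
               (λ { s (s≤s s≤k) (l≤s , _) → l≤s , ≤-trans (≤-trans s≤k (n≤1+n k)) (≤-reflexive (≡.sym u′-i)) })
               (λ { s (s≤s s≤k) (l≤s , _) → l≤s , ≤-trans s≤k (≤-reflexive (≡.sym u-i)) })
               (λ s _ s≢i → u≗ s (λ e → s≢i (≡.trans e (≡.sym i≡p)))) ⟩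
        Cell (suc k) nothing j h i u′ l f
          ≈⟨ sym (take (allowed? l (u′ i) (suc k))) ⟩
        Cell (suc (suc k)) nothing j h i u′ l f
          ≈⟨ sym (Cell-skips d _ nothing j h i u′ l f (λ s le (_ , s≤u) →
               <-irrefl ≡.refl (<-≤-trans le (≤-trans s≤u (≤-reflexive u′-i))))) ⟩
        Cell (d ℕ.+ suc (suc k)) nothing j h i u′ l f ∎)
        where
        take : ∀ {lev} {P : Set lev} (d : Dec P) → Cell (suc k) nothing j h i u′ l f
               + ⟦ d ⟧ (Cell (suc k) (just (suc k , suc k)) j h i u′ l (λ w → f (suc k ∷ w)))
               ≈ Cell (suc k) nothing j h i u′ l f
        take (yes _) = trans (+-congˡ (blocked (suc k) (suc k) _)) (+-identityʳ _)
        take (no  _) = +-identityʳ _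

  pair : ∀ j h p f i u u′ l → i ℕ.+ h ≡ b j → suc p < b j → u p ≡ k → u′ p ≡ suc k →
         (∀ r → r ≢ p → u r ≡ u′ r) → u (suc p) ≤ suc k → Col j h i u l f ≈ Col j h i u′ l f
  pair zero    zero p f i u u′ l i+h p<b up u′p u≗ below = refl
  pair (suc j) zero p f i u u′ l i+h p<b up u′p u≗ below =
    pair j (b j ∸ a j) p f (a j) u u′ 0 (height j) (≤-trans p<b (b-anti j)) up u′p u≗ below
  pair j (suc h) p f i u u′ l i+h p<b up u′p u≗ below with i ℕ.≟ p
  ... | yes i≡p = PairCell.same j h i l p u u′ i+h p<b up u′p u≗ below i≡p f
  ... | no  i≢p = PairCell.other j h i l p u u′ i+h p<b up u′p u≗ below i≢p
                    (λ f i u u′ l e → pair j h p f i u u′ l e p<b) n nothing f tt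

  module _ (z z′ : ℕ → Carrier) (z-k : z k ≈ z′ (suc k)) (z-k+1 : z (suc k) ≈ z′ k)
    (z-else : ∀ r → r ≢ k → r ≢ suc k → z r ≈ z′ r) where

    C : (ℕ → Carrier) → ℕ → ℕ → ℕ → (ℕ → ℕ) → ℕ → Carrier
    C ζ j h i u l = Col j h i u l (mon ζ)

    Run : (ℕ → Carrier) → Carrier → Carrier → Carrier
    Run ζ x y = ζ (suc k) * x + (ζ k + ζ k * ζ (suc k)) * y

    -- With x = z k and y = z (k + 1), the three claims are proved together, by
    -- induction on the remaining boxes.
    -- SymC: sums with no bound separating k from k + 1 are symmetric in x and y.
    -- RunC: the sum over the entries of one more box, to the right of row p and
    -- with entries k and k + 1 only, is symmetric.  The weights are y for
    -- {k + 1}, leaving the bound k + 1, and x, x y for {k}, {k , k + 1}, leaving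
    -- the bound k.
    -- ΔC: the sets {k} and {k , k + 1} in row p differ for the box below only
    -- in that it may have k + 1 below k, and what this adds is y times a
    -- symmetric sum.
    SymC RunC : ℕ → ℕ → Set ℓ₁
    ΔC : ℕ → ℕ → Set (c Level.⊔ ℓ₁)
    SymC j h = ∀ i u l → i ℕ.+ h ≡ b j → RowsAbove l j i u →
      (∀ r → Active j i r → u r ≢ k) → l ≢ suc k → C z j h i u l ≈ C z′ j h i u l
    RunC j h = ∀ i u₁ u₀ l p → i ℕ.+ h ≡ b j → RowsAbove l j i u₁ →
      (∀ r → Active j i r → r ≢ p → u₁ r ≢ k) → l ≢ suc k →
      u₁ p ≡ suc k → u₀ p ≡ k → (∀ r → r ≢ p → u₁ r ≡ u₀ r) →
      (∀ r → Active j i r → r < p → u₁ r < k) →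
      Run z (C z j h i u₁ l) (C z j h i u₀ l) ≈ Run z′ (C z′ j h i u₁ l) (C z′ j h i u₀ l)
    ΔC j h = ∀ p u → suc p ℕ.+ h ≡ b j → RowsAbove (suc k) j (suc p) u →
      (∀ r → Active j (suc p) r → r ≢ p → u r ≢ k) → u p ≤ k →
      ∃₂ λ D D′ → D ≈ D′
        × C z  j h (suc p) u (suc k) ≈ C z  j h (suc p) u (suc (suc k)) + z  (suc k) * D
        × C z′ j h (suc p) u (suc k) ≈ C z′ j h (suc p) u (suc (suc k)) + z′ (suc k) * D′

    Avoids-k : Cur → Set
    Avoids-k nothing           = ⊤
    Avoids-k (just (mx , mn)) = mx ≢ k × mn ≢ k

    Avoids-k-add : ∀ c {r} → Avoids-k c → r ≢ k → Avoids-k (add c r)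
    Avoids-k-add nothing  _         r≢k = r≢k , r≢k
    Avoids-k-add (just _) (mx≢k , _) r≢k = mx≢k , r≢k

    z-low : ∀ {r} → r < k → z r ≈ z′ r
    z-low r<k = z-else _ (<⇒≢ r<k) (<⇒≢ (m<n⇒m<1+n r<k))

    z-high : ∀ {r} → suc k < r → z r ≈ z′ r
    z-high k<r = z-else _ (>⇒≢ (<-trans (n<1+n k) k<r)) (>⇒≢ k<r)

    -- Equal to (1 + ζ k)(1 + ζ (k + 1)) - 1, the total weight of the non-empty subsets of {k, k +
    -- 1}.
    e : (ℕ → Carrier) → Carrier
    e ζ = ζ (suc k) + (ζ k + ζ k * ζ (suc k))

    Run-factor : ∀ ζ x → Run ζ x x ≈ e ζ * x
    Run-factor ζ x = sym (distribʳ x _ _)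

    e-sym : e z ≈ e z′
    e-sym = trans (+-cong z-k+1 (+-cong z-k (*-cong z-k z-k+1)))
      (solve 2 (λ x y → y ⊕ (x ⊕ x ⊗ y) ⊜ x ⊕ (y ⊕ y ⊗ x)) refl (z′ (suc k)) (z′ k))

    xy : (ℕ → Carrier) → Carrier
    xy ζ = ζ k * ζ (suc k)

    xy-sym : xy z ≈ xy z′
    xy-sym = trans (*-cong z-k z-k+1) (*-comm _ _)

    x+y-sym : z k + z (suc k) ≈ z′ k + z′ (suc k)
    x+y-sym = trans (+-cong z-k z-k+1) (+-comm _ _)

    module CellPhase (j h i : ℕ) (u : ℕ → ℕ) (l : ℕ) (i+h : i ℕ.+ suc h ≡ b j)
      (S : SymC j h) (R′ : RunC j h) (Δ : ΔC j h)
      (above : RowsAbove l j i u) (neutral : ∀ r → Active j (suc i) r → r ≢ i → u r ≢ k) where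

      B : (ℕ → Carrier) → ℕ → Cur → Carrier
      B ζ r c = Cell r c j h i u l (mon ζ)

      -- Letters below `k` weigh the same under `z` and `z′`. When the box closes, its minimum
      -- becomes a row bound and its maximum plus one the lower bound below; `Avoids-k` is just what
      -- `SymC` requires of these two.
      symLow : ∀ r c → r ≤ k → Valid l r c → Avoids-k c → B z r c ≈ B z′ r c
      symLow zero nothing _ _ _ = refl
      symLow zero (just (mx , mn)) _ (_ , mn≤mx , l≤mn) (mx≢k , mn≢k) =
        S (suc i) (u [ i ≔ mn ]) (suc mx) (shift i h i+h) (RowsAbove-suc above mn≤mx l≤mn)
          (λ r act → ≔-≢ u i r mn≢k (neutral r act)) (mx≢k ∘ ℕ.suc-injective)
      symLow (suc r) c r<k v av = +-cong (symLow r c (<⇒≤ r<k) (Valid-skip c v) av)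
        (⟦⟧-cong (allowed? l (u i) r) λ (l≤r , _) → trans (Cell-* r (add c r) j h i u l (z r) (mon z))
          (trans (*-cong (z-low r<k) (symLow r (add c r) (<⇒≤ r<k) (Valid-add c v l≤r) (Avoids-k-add c av (<⇒≢ r<k))))
            (sym (Cell-* r (add c r) j h i u l (z′ r) (mon z′)))))

      -- If no smaller letter follows, row `i` keeps the bound k + 1 or k, and `RunC` with `p = i`
      -- applies. Once a smaller letter is taken, both boxes have the same minimum and the weights
      -- add up to the symmetric factor `e`.
      runLow : l ≤ k → ∀ r mx → r ≤ k → suc k ≤ mx →
               Run z  (B z  r (just (mx , suc k))) (B z  r (just (mx , k))) ≈
               Run z′ (B z′ r (just (mx , suc k))) (B z′ r (just (mx , k)))
      runLow l≤k zero mx _ k<mx = R′ (suc i) (u [ i ≔ suc k ]) (u [ i ≔ k ]) (suc mx) i (shift i h i+h)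
        (RowsAbove-suc above k<mx (≤-trans l≤k (n≤1+n k)))
        (λ r act r≢i e → neutral r act r≢i (≡.trans (≡.sym (≔-there u i (suc k) r≢i)) e))
        (λ e → <⇒≢ k<mx (≡.sym (ℕ.suc-injective e)))
        (≔-here u i (suc k)) (≔-here u i k)
        (λ r r≢i → ≡.trans (≔-there u i (suc k) r≢i) (≡.sym (≔-there u i k r≢i)))
        λ { r (inj₁ i<r) r<i → ⊥-elim (<-asym i<r r<i)
          ; r (inj₂ left) r<i → ≡.subst (_< k) (≡.sym (≔-there u i (suc k) (<⇒≢ r<i))) (<-≤-trans (above r r<i left) l≤k) }
      runLow l≤k (suc r) mx r<k k<mx = by (allowed? l (u i) r)
        where
        c₁ = just (mx , suc k)
        c₀ = just (mx , k)
        ih = runLow l≤k r mx (<⇒≤ r<k) k<mx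
        expand : ∀ ζ → Allowed l (u i) r → Run ζ (B ζ (suc r) c₁) (B ζ (suc r) c₀) ≈
                 Run ζ (B ζ r c₁) (B ζ r c₀) + e ζ * (ζ r * B ζ r (just (mx , r)))
        expand ζ al = trans (+-cong (*-congˡ (Cell-take-mon r c₁ j h i u l ζ al)) (*-congˡ (Cell-take-mon r c₀ j h i u l ζ al)))
          (solve 5 (λ s t p q w → s ⊗ (p ⊕ w) ⊕ t ⊗ (q ⊕ w) ⊜ (s ⊗ p ⊕ t ⊗ q) ⊕ (s ⊕ t) ⊗ w) refl _ _ _ _ _)
        by : Dec (Allowed l (u i) r) → Run z (B z (suc r) c₁) (B z (suc r) c₀) ≈ Run z′ (B z′ (suc r) c₁) (B z′ (suc r) c₀)
        by (no ¬al) = trans (+-cong (*-congˡ (Cell-skip r c₁ j h i u l _ ¬al)) (*-congˡ (Cell-skip r c₀ j h i u l _ ¬al)))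
          (trans ih (sym (+-cong (*-congˡ (Cell-skip r c₁ j h i u l _ ¬al)) (*-congˡ (Cell-skip r c₀ j h i u l _ ¬al)))))
        by (yes al) = trans (expand z al) (trans (+-cong ih (*-cong e-sym (*-cong (z-low r<k)
          (symLow r (just (mx , r)) (<⇒≤ r<k) (≤-refl , ≤-trans (<⇒≤ r<k) (<⇒≤ k<mx) , proj₁ al)
            (>⇒≢ k<mx , <⇒≢ r<k))))) (sym (expand z′ al)))

      -- Both boxes leave the same row bound; they differ in the lower bound k + 1 or k + 2 for the
      -- box below, which is the situation of `ΔC`. Smaller letters carry equal weights and merely
      -- add to `D`.
      ΔLow : ∀ r m → r ≤ m → m ≤ k → l ≤ m →
             ∃₂ λ D D′ → D ≈ D′
               × B z  r (just (k , m)) ≈ B z  r (just (suc k , m)) + z  (suc k) * D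
               × B z′ r (just (k , m)) ≈ B z′ r (just (suc k , m)) + z′ (suc k) * D′
      ΔLow zero m _ m≤k l≤m = Δ i (u [ i ≔ m ]) (shift i h i+h) (RowsAbove-suc above m≤k l≤m)
        (λ r act r≢i e → neutral r act r≢i (≡.trans (≡.sym (≔-there u i m r≢i)) e))
        (≡.subst (_≤ k) (≡.sym (≔-here u i m)) m≤k)
      ΔLow (suc r) m r<m m≤k l≤m with allowed? l (u i) r | ΔLow r m (<⇒≤ r<m) m≤k l≤m
      ... | no  _ | D , D′ , D≈D′ , p , p′ = D , D′ , D≈D′ ,
              trans (+-identityʳ _) (trans p (+-congʳ (sym (+-identityʳ _)))) ,
              trans (+-identityʳ _) (trans p′ (+-congʳ (sym (+-identityʳ _))))
      ... | yes (l≤r , _) | D , D′ , D≈D′ , p , p′ with ΔLow r r ≤-refl (≤-trans (<⇒≤ r<m) m≤k) l≤r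
      ...   | E , E′ , E≈E′ , q , q′ = D + z r * E , D′ + z′ r * E′ ,
              +-cong D≈D′ (*-cong (z-low (<-≤-trans r<m m≤k)) E≈E′) , combine z p q , combine z′ p′ q′
              where
              combine : ∀ ζ {D E} → B ζ r (just (k , m)) ≈ B ζ r (just (suc k , m)) + ζ (suc k) * D →
                B ζ r (just (k , r)) ≈ B ζ r (just (suc k , r)) + ζ (suc k) * E →
                B ζ r (just (k , m)) + Cell r (just (k , r)) j h i u l (λ w → ζ r * mon ζ w) ≈
                (B ζ r (just (suc k , m)) + Cell r (just (suc k , r)) j h i u l (λ w → ζ r * mon ζ w)) + ζ (suc k) * (D + ζ r * E)
              combine ζ p q = trans (+-cong p (trans (Cell-* r _ j h i u l (ζ r) (mon ζ)) (*-congˡ q)))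
                (trans (solve 6 (λ x s d v y e → (x ⊕ s ⊗ d) ⊕ v ⊗ (y ⊕ s ⊗ e) ⊜ (x ⊕ v ⊗ y) ⊕ s ⊗ (d ⊕ v ⊗ e)) refl _ _ _ _ _ _)
                  (+-congʳ (+-congˡ (sym (Cell-* r _ j h i u l (ζ r) (mon ζ))))))

      expand₂ : ∀ ζ c → Allowed l (u i) k → Allowed l (u i) (suc k) → B ζ (suc (suc k)) c ≈
        (B ζ k c + ζ k * B ζ k (add c k)) + ζ (suc k) * (B ζ k (add c (suc k)) + ζ k * B ζ k (add (add c (suc k)) k))
      expand₂ ζ c al al′ = trans (Cell-take-mon (suc k) c j h i u l ζ al′)
        (+-cong (Cell-take-mon k c j h i u l ζ al) (*-congˡ (Cell-take-mon k (add c (suc k)) j h i u l ζ al)))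

      neither : ∀ c → Valid l (suc (suc k)) c → ¬ Allowed l (u i) k → ¬ Allowed l (u i) (suc k) →
                B z (suc (suc k)) c ≈ B z′ (suc (suc k)) c
      neither c v ¬al ¬al′ = trans (skips (mon z)) (trans (symLow k c ≤-refl (Valid-skip c (Valid-skip c v)) (avoids c v)) (sym (skips (mon z′))))
        where
        skips : ∀ f → Cell (suc (suc k)) c j h i u l f ≈ Cell k c j h i u l f
        skips f = trans (Cell-skip (suc k) c j h i u l f ¬al′) (Cell-skip k c j h i u l f ¬al)
        avoids : ∀ c → Valid l (suc (suc k)) c → Avoids-k c
        avoids nothing _ = tt
        avoids (just _) (k<mn , mn≤mx , _) = >⇒≢ (<⇒≤ (≤-trans k<mn mn≤mx)) , >⇒≢ (<⇒≤ k<mn)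

      symHigh : u i ≢ k → l ≢ suc k → ∀ d c → Valid l (d ℕ.+ suc (suc k)) c →
                B z (d ℕ.+ suc (suc k)) c ≈ B z′ (d ℕ.+ suc (suc k)) c
      symHigh ui≢k l≢k+1 (suc d) c v = +-cong (symHigh ui≢k l≢k+1 d c (Valid-skip c v))
        (⟦⟧-cong (allowed? l (u i) (d ℕ.+ suc (suc k))) λ (l≤r , _) → trans (Cell-* (d ℕ.+ suc (suc k)) (add c (d ℕ.+ suc (suc k))) j h i u l _ (mon z))
          (trans (*-cong (z-high (m≤n+m _ d)) (symHigh ui≢k l≢k+1 d (add c _) (Valid-add c v l≤r)))
            (sym (Cell-* (d ℕ.+ suc (suc k)) (add c (d ℕ.+ suc (suc k))) j h i u l _ (mon z′)))))
      symHigh ui≢k l≢k+1 zero c v with l ℕ.≤? k | suc k ℕ.≤? u i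
      ... | yes l≤k | yes k<ui = go c v
            where
            al : Allowed l (u i) k
            al = l≤k , <⇒≤ k<ui
            al′ : Allowed l (u i) (suc k)
            al′ = ≤-trans l≤k (n≤1+n k) , k<ui
            go : ∀ c → Valid l (suc (suc k)) c → B z (suc (suc k)) c ≈ B z′ (suc (suc k)) c
            -- A larger letter is present, so the maximum does not depend on the choice among k and
            -- k + 1. Apart from choosing neither, the three choices have the weights of `Run`.
            go (just (mx , mn)) v@(k<mn , mn≤mx , _) = trans (form z) (trans
              (+-cong (symLow k (just (mx , mn)) ≤-refl (Valid-skip _ (Valid-skip _ v))
                        (>⇒≢ (<⇒≤ (≤-trans k<mn mn≤mx)) , >⇒≢ (<⇒≤ k<mn)))
                      (runLow l≤k k mx ≤-refl (<⇒≤ (≤-trans k<mn mn≤mx))))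
              (sym (form z′)))
              where
              form : ∀ ζ → B ζ (suc (suc k)) (just (mx , mn)) ≈
                     B ζ k (just (mx , mn)) + Run ζ (B ζ k (just (mx , suc k))) (B ζ k (just (mx , k)))
              form ζ = trans (expand₂ ζ (just (mx , mn)) al al′)
                (solve 5 (λ w x y q₀ q₁ → (w ⊕ x ⊗ q₀) ⊕ y ⊗ (q₁ ⊕ x ⊗ q₀) ⊜ w ⊕ (y ⊗ q₁ ⊕ (x ⊕ x ⊗ y) ⊗ q₀)) refl _ _ _ _ _)
            -- Of the sets {k}, {k + 1} and {k, k + 1}, only the first has maximum k. `ΔLow` gives
            -- it the maximum k + 1 at the cost of x · y · D, which is symmetric.
            go nothing _ with ΔLow k k ≤-refl ≤-refl l≤k
            ... | D , D′ , D≈D′ , p , p′ = trans (form z p) (trans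
              (+-cong (+-cong (symLow k nothing ≤-refl tt tt) (runLow l≤k k (suc k) ≤-refl ≤-refl)) (*-cong xy-sym D≈D′))
              (sym (form z′ p′)))
              where
              form : ∀ ζ {D} → B ζ k (just (k , k)) ≈ B ζ k (just (suc k , k)) + ζ (suc k) * D → B ζ (suc (suc k)) nothing ≈
                     (B ζ k nothing + Run ζ (B ζ k (just (suc k , suc k))) (B ζ k (just (suc k , k)))) + xy ζ * D
              form ζ p = trans (expand₂ ζ nothing al al′) (trans (+-congʳ (+-congˡ (*-congˡ p)))
                (solve 6 (λ w x y q₀ q₁ d → (w ⊕ x ⊗ (q₀ ⊕ y ⊗ d)) ⊕ y ⊗ (q₁ ⊕ x ⊗ q₀)
                   ⊜ (w ⊕ (y ⊗ q₁ ⊕ (x ⊕ x ⊗ y) ⊗ q₀)) ⊕ (x ⊗ y) ⊗ d) refl _ _ _ _ _ _))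
      -- If exactly one of k and k + 1 were allowed, then u i = k or l = k + 1, and both are
      -- excluded.
      ... | yes l≤k | no k≮ui = neither c v
              (λ (_ , le) → ui≢k (ℕ.≤-antisym (ℕ.≤-pred (≰⇒> k≮ui)) le)) (λ (_ , le) → k≮ui le)
      ... | no l≰k | _ = neither c v
              (λ (le , _) → l≰k le) (λ (le , _) → l≢k+1 (ℕ.≤-antisym le (≰⇒> l≰k)))

    -- Lowering the bound from k + 2 to k + 1 admits exactly the further sets with minimum k + 1.
    -- Nothing smaller can follow, so `D` is made of closed boxes that leave the harmless row bound
    -- k + 1.
    Δ-suc : ∀ j h → SymC j h → ΔC j (suc h)
    Δ-suc j h S p u i+h above neutral up≤k = let (d , n≡) = n-split in ≡.subst Claim n≡ (high d nothing tt)
      where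
      i = suc p
      B : (ℕ → Carrier) → ℕ → ℕ → Cur → Carrier
      B ζ l r c = Cell r c j h i u l (mon ζ)

      Statement : ℕ → Cur → Set (c Level.⊔ ℓ₁)
      Statement r c = ∃₂ λ D D′ → D ≈ D′
        × B z  (suc k) r c ≈ B z  (suc (suc k)) r c + z  (suc k) * D
        × B z′ (suc k) r c ≈ B z′ (suc (suc k)) r c + z′ (suc k) * D′
      Claim : ℕ → Set (c Level.⊔ ℓ₁)
      Claim r = Statement r nothing

      High : Cur → Set
      High nothing         = ⊤
      High (just (mx , _)) = suc k ≤ mx

      High-add : ∀ c {r} → suc k ≤ r → High c → High (add c r)
      High-add nothing  le _ = le
      High-add (just _) _ hi = hi

      one : ∀ mx → suc k ≤ mx → B z (suc k) zero (just (mx , suc k)) ≈ B z′ (suc k) zero (just (mx , suc k))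
      one mx k<mx with u p ℕ.≟ k
      ... | no up≢k = S (suc i) (u [ i ≔ suc k ]) (suc mx) (shift i h i+h) (RowsAbove-suc above k<mx ≤-refl) avoid
              (λ e → <⇒≢ k<mx (≡.sym (ℕ.suc-injective e)))
              where
              avoid : ∀ r → Active j (suc i) r → (u [ i ≔ suc k ]) r ≢ k
              avoid r act = ≔-≢ u i r (>⇒≢ ≤-refl) λ _ → off (r ℕ.≟ p)
                where
                off : Dec (r ≡ p) → u r ≢ k
                off (yes ≡.refl) = up≢k
                off (no r≢p)     = neutral r (Active-suc j i act) r≢p
      -- The bound k of row `p` would be an obstacle to `SymC`. As the row below now has bound k +
      -- 1, `pair` allows it to be raised to k + 1.
      ... | yes up≡k = trans (to (mon z)) (trans
              (S (suc i) v (suc mx) (shift i h i+h) above′ avoid (λ e → <⇒≢ k<mx (≡.sym (ℕ.suc-injective e))))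
              (sym (to (mon z′))))
              where
              v : ℕ → ℕ
              v = u [ i ≔ suc k ] [ p ≔ suc k ]
              p≢i : p ≢ i
              p≢i = <⇒≢ ≤-refl
              to : ∀ f → Col j h (suc i) (u [ i ≔ suc k ]) (suc mx) f ≈ Col j h (suc i) v (suc mx) f
              to f = pair j h p f (suc i) (u [ i ≔ suc k ]) v (suc mx) (shift i h i+h)
                (≡.subst (i <_) i+h (ℕ.m<m+n i (s≤s z≤n)))
                (≡.trans (≔-there u i (suc k) p≢i) up≡k)
                (≔-here (u [ i ≔ suc k ]) p (suc k))
                (λ r r≢p → ≡.sym (≔-there (u [ i ≔ suc k ]) p (suc k) r≢p))
                (≤-reflexive (≔-here u i (suc k)))
              above′ : RowsAbove (suc mx) j (suc i) v
              above′ r r<i left with r ℕ.≟ p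
              ... | yes _ = s≤s k<mx
              ... | no  _ = RowsAbove-suc above k<mx ≤-refl r r<i left
              avoid : ∀ r → Active j (suc i) r → v r ≢ k
              avoid r act = ≔-≢ (u [ i ≔ suc k ]) p r (>⇒≢ ≤-refl) λ r≢p → ≔-≢ u i r (>⇒≢ ≤-refl) λ _ → neutral r (Active-suc j i act) r≢p

      zero-l : ∀ ζ c → B ζ (suc k) zero c ≈ B ζ (suc (suc k)) zero c
      zero-l ζ nothing  = refl
      zero-l ζ (just _) = refl

      none : ∀ ζ l c → k < l → B ζ l (suc k) c ≈ B ζ l zero c
      none ζ l c k<l = Cell-none (suc k) c j h i u l (mon ζ) λ s s≤k (l≤s , _) → <-irrefl ≡.refl (<-≤-trans k<l (≤-trans l≤s (ℕ.≤-pred s≤k)))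

      none₂ : ∀ ζ c → B ζ (suc (suc k)) (suc (suc k)) c ≈ B ζ (suc (suc k)) zero c
      none₂ ζ c = trans (Cell-skip (suc k) c j h i u _ (mon ζ) (λ (le , _) → <-irrefl ≡.refl le)) (none ζ _ c (n≤1+n _))

      high : ∀ d c → High c → Statement (d ℕ.+ suc (suc k)) c
      high zero c hi with suc k ℕ.≤? u i
      ... | no k≮ui = 0# , 0# , refl , eq z , eq z′
            where
            eq : ∀ ζ → B ζ (suc k) (suc (suc k)) c ≈ B ζ (suc (suc k)) (suc (suc k)) c + ζ (suc k) * 0#
            eq ζ = trans (trans (Cell-skip (suc k) c j h i u _ (mon ζ) (λ (_ , le) → k≮ui le))
              (trans (none ζ _ c ≤-refl) (trans (zero-l ζ c) (sym (none₂ ζ c)))))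
              (sym (trans (+-congˡ (zeroʳ _)) (+-identityʳ _)))
      ... | yes k<ui = B z (suc k) zero (add c (suc k)) , B z′ (suc k) zero (add c (suc k)) , closed c hi , eq z , eq z′
            where
            closed : ∀ c → High c → B z (suc k) zero (add c (suc k)) ≈ B z′ (suc k) zero (add c (suc k))
            closed nothing         _    = one (suc k) ≤-refl
            closed (just (mx , _)) k<mx = one mx k<mx
            eq : ∀ ζ → B ζ (suc k) (suc (suc k)) c ≈ B ζ (suc (suc k)) (suc (suc k)) c + ζ (suc k) * B ζ (suc k) zero (add c (suc k))
            eq ζ = trans (Cell-take-mon (suc k) c j h i u (suc k) ζ (≤-refl , k<ui))
              (+-cong (trans (none ζ _ c ≤-refl) (trans (zero-l ζ c) (sym (none₂ ζ c)))) (*-congˡ (none ζ _ _ ≤-refl)))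
      high (suc d) c hi with high d c hi | d ℕ.+ suc (suc k) ℕ.≤? u i
      ... | D , D′ , D≈D′ , q , q′ | no r≰u = D , D′ , D≈D′ , eq z q , eq z′ q′
            where
            r = d ℕ.+ suc (suc k)
            eq : ∀ ζ {D} → B ζ (suc k) r c ≈ B ζ (suc (suc k)) r c + ζ (suc k) * D →
                 B ζ (suc k) (suc r) c ≈ B ζ (suc (suc k)) (suc r) c + ζ (suc k) * D
            eq ζ q = trans (Cell-skip r c j h i u _ (mon ζ) (r≰u ∘ proj₂))
              (trans q (+-congʳ (sym (Cell-skip r c j h i u _ (mon ζ) (r≰u ∘ proj₂)))))
      ... | D , D′ , D≈D′ , q , q′ | yes r≤u with high d (add c (d ℕ.+ suc (suc k))) (High-add c (<⇒≤ (m≤n+m _ d)) hi)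
      ...   | E , E′ , E≈E′ , t , t′ = D + z r * E , D′ + z′ r * E′ ,
                +-cong D≈D′ (*-cong (z-high (m≤n+m _ d)) E≈E′) , eq z q t , eq z′ q′ t′
            where
            r = d ℕ.+ suc (suc k)
            eq : ∀ ζ {D E} → B ζ (suc k) r c ≈ B ζ (suc (suc k)) r c + ζ (suc k) * D →
                 B ζ (suc k) r (add c r) ≈ B ζ (suc (suc k)) r (add c r) + ζ (suc k) * E →
                 B ζ (suc k) (suc r) c ≈ B ζ (suc (suc k)) (suc r) c + ζ (suc k) * (D + ζ r * E)
            eq ζ q t = trans (Cell-take-mon r c j h i u _ ζ (<⇒≤ (m≤n+m _ d) , r≤u)) (trans (+-cong q (*-congˡ t))
              (trans (solve 6 (λ x s d v y e → (x ⊕ s ⊗ d) ⊕ v ⊗ (y ⊕ s ⊗ e) ⊜ (x ⊕ v ⊗ y) ⊕ s ⊗ (d ⊕ v ⊗ e)) refl _ _ _ _ _ _)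
                (+-congʳ (sym (Cell-take-mon r c j h i u _ ζ (m≤n+m _ d , r≤u))))))

    module RunStep (j h i : ℕ) (u₁ u₀ : ℕ → ℕ) (l p : ℕ) (i+h : i ℕ.+ suc h ≡ b j)
      (S : SymC j h) (R′ : RunC j h) (Δ : ΔC j h)
      (above : RowsAbove l j i u₁) (neutral : ∀ r → Active j i r → r ≢ p → u₁ r ≢ k) (l≢k+1 : l ≢ suc k)
      (u₁p : u₁ p ≡ suc k) (u₀p : u₀ p ≡ k) (u≗ : ∀ r → r ≢ p → u₁ r ≡ u₀ r)
      (small : ∀ r → Active j i r → r < p → u₁ r < k) where

      B₁ B₀ : (ℕ → Carrier) → ℕ → Cur → Carrier
      B₁ ζ r c = Cell r c j h i u₁ l (mon ζ)
      B₀ ζ r c = Cell r c j h i u₀ l (mon ζ)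

      module _ (i≢p : i ≢ p) (¬al : ¬ Allowed l (u₁ i) k) (¬al′ : ¬ Allowed l (u₁ i) (suc k)) where

        Fits : Cur → Set
        Fits nothing         = ⊤
        Fits (just (_ , mn)) = mn ≤ u₁ i

        Fits-add : ∀ c {r} → r ≤ u₁ i → Fits (add c r)
        Fits-add nothing  le = le
        Fits-add (just _) le = le

        other : ∀ r c → Valid l r c → Avoids-k c → Fits c →
                Run z (B₁ z r c) (B₀ z r c) ≈ Run z′ (B₁ z′ r c) (B₀ z′ r c)
        other zero nothing _ _ _ = trans (Run-factor z 0#) (trans (zeroʳ _) (sym (trans (Run-factor z′ 0#) (zeroʳ _))))
        other zero (just (mx , mn)) (_ , mn≤mx , l≤mn) (mx≢k , mn≢k) mn≤u =
          R′ (suc i) (u₁ [ i ≔ mn ]) (u₀ [ i ≔ mn ]) (suc mx) p (shift i h i+h) (RowsAbove-suc above mn≤mx l≤mn)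
            (λ r act r≢p → ≔-≢ u₁ i r mn≢k (λ _ → neutral r (Active-suc j i act) r≢p)) (mx≢k ∘ ℕ.suc-injective)
            (≡.trans (≔-there u₁ i mn (i≢p ∘ ≡.sym)) u₁p) (≡.trans (≔-there u₀ i mn (i≢p ∘ ≡.sym)) u₀p)
            agree small′
          where
          agree : ∀ r → r ≢ p → (u₁ [ i ≔ mn ]) r ≡ (u₀ [ i ≔ mn ]) r
          agree r r≢p with r ℕ.≟ i
          ... | yes _ = ≡.refl
          ... | no  _ = u≗ r r≢p
          small′ : ∀ r → Active j (suc i) r → r < p → (u₁ [ i ≔ mn ]) r < k
          small′ r act r<p with r ℕ.≟ i
          ... | yes ≡.refl = ℕ.≤-<-trans mn≤u (small i (inj₁ ≤-refl) r<p)
          ... | no  _ = small r (Active-suc j i act) r<p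
        other (suc r) c v av fits = by (allowed? l (u₁ i) r)
          where
          ih = other r c (Valid-skip c v) av fits
          to₀ : ∀ {r} → Allowed l (u₁ i) r → Allowed l (u₀ i) r
          to₀ = ≡.subst (λ v → Allowed l v _) (u≗ i i≢p)
          from₀ : ∀ {r} → Allowed l (u₀ i) r → Allowed l (u₁ i) r
          from₀ = ≡.subst (λ v → Allowed l v _) (≡.sym (u≗ i i≢p))
          expand : ∀ ζ → Allowed l (u₁ i) r → Run ζ (B₁ ζ (suc r) c) (B₀ ζ (suc r) c) ≈
                   Run ζ (B₁ ζ r c) (B₀ ζ r c) + ζ r * Run ζ (B₁ ζ r (add c r)) (B₀ ζ r (add c r))
          expand ζ al = trans (+-cong (*-congˡ (Cell-take-mon r c j h i u₁ l ζ al)) (*-congˡ (Cell-take-mon r c j h i u₀ l ζ (to₀ al))))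
            (solve 7 (λ s t p q v p′ q′ → s ⊗ (p ⊕ v ⊗ p′) ⊕ t ⊗ (q ⊕ v ⊗ q′) ⊜ (s ⊗ p ⊕ t ⊗ q) ⊕ v ⊗ (s ⊗ p′ ⊕ t ⊗ q′)) refl _ _ _ _ _ _ _)
          skips : ∀ ζ → ¬ Allowed l (u₁ i) r → Run ζ (B₁ ζ (suc r) c) (B₀ ζ (suc r) c) ≈ Run ζ (B₁ ζ r c) (B₀ ζ r c)
          skips ζ ¬al = +-cong (*-congˡ (Cell-skip r c j h i u₁ l _ ¬al)) (*-congˡ (Cell-skip r c j h i u₀ l _ (¬al ∘ from₀)))
          by : Dec (Allowed l (u₁ i) r) → Run z (B₁ z (suc r) c) (B₀ z (suc r) c) ≈ Run z′ (B₁ z′ (suc r) c) (B₀ z′ (suc r) c)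
          by (no ¬al) = trans (skips z ¬al) (trans ih (sym (skips z′ ¬al)))
          by (yes al) = trans (expand z al) (trans (+-cong ih (*-cong (z-else r r≢k r≢k+1)
              (other r (add c r) (Valid-add c v (proj₁ al)) (Avoids-k-add c av r≢k) (Fits-add c (proj₂ al))))) (sym (expand z′ al)))
            where
            r≢k : r ≢ k
            r≢k ≡.refl = ¬al al
            r≢k+1 : r ≢ suc k
            r≢k+1 ≡.refl = ¬al′ al

      module _ (i≡p : i ≡ p) where
        private
          u₁i : u₁ i ≡ suc k
          u₁i = ≡.trans (≡.cong u₁ i≡p) u₁p
          u₀i : u₀ i ≡ k
          u₀i = ≡.trans (≡.cong u₀ i≡p) u₀p
          module P = CellPhase j h i u₁ l i+h S R′ Δ above
            (λ r act r≢i → neutral r (Active-suc j i act) (λ e → r≢i (≡.trans e (≡.sym i≡p))))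

        same : Run z (B₁ z n nothing) (B₀ z n nothing) ≈ Run z′ (B₁ z′ n nothing) (B₀ z′ n nothing)
        same with l ℕ.≤? k
        ... | no l≰k = trans (vanish z) (sym (vanish z′))
              where
              k+1<l : suc k < l
              k+1<l = ≤∧≢⇒< (≰⇒> l≰k) (l≢k+1 ∘ ≡.sym)
              vanish : ∀ ζ → Run ζ (B₁ ζ n nothing) (B₀ ζ n nothing) ≈ 0#
              vanish ζ = trans (+-cong
                (*-congˡ (Cell-empty n j h i u₁ l _ λ s (l≤s , s≤u) → <⇒≱ k+1<l (≤-trans l≤s (≤-trans s≤u (≤-reflexive u₁i)))))
                (*-congˡ (Cell-empty n j h i u₀ l _ λ s (l≤s , s≤u) → <⇒≱ (<-trans (n<1+n k) k+1<l) (≤-trans l≤s (≤-trans s≤u (≤-reflexive u₀i))))))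
                (trans (Run-factor ζ 0#) (zeroʳ _))
        ... | yes l≤k with P.ΔLow k k ≤-refl ≤-refl l≤k
        -- The term moved to the left belongs to the box {k + 1} followed by letters below k; it is
        -- symmetric by `symLow` and cancels.
        ...   | D , D′ , D≈D′ , q , q′ = +-cancelʳ _ _ _ (trans (form z q) (trans
                  (+-cong (+-cong (*-cong e-sym (P.symLow k nothing ≤-refl tt tt))
                    (*-cong x+y-sym (P.runLow l≤k k (suc k) ≤-refl ≤-refl))) (*-cong (*-cong xy-sym e-sym) D≈D′))
                  (trans (sym (form z′ q′)) (+-congˡ (*-cong (sym xy-sym) (sym q₁-sym))))))
          where
          q₁-sym : B₁ z k (just (suc k , suc k)) ≈ B₁ z′ k (just (suc k , suc k))
          q₁-sym = P.symLow k _ ≤-refl (n≤1+n k , ≤-refl , ≤-trans l≤k (n≤1+n k)) (>⇒≢ ≤-refl , >⇒≢ ≤-refl)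
          al₁ : Allowed l (u₁ i) k
          al₁ = l≤k , ≤-trans (n≤1+n k) (≤-reflexive (≡.sym u₁i))
          al₁′ : Allowed l (u₁ i) (suc k)
          al₁′ = ≤-trans l≤k (n≤1+n k) , ≤-reflexive (≡.sym u₁i)
          al₀ : Allowed l (u₀ i) k
          al₀ = l≤k , ≤-reflexive (≡.sym u₀i)
          top : ∀ ζ u → u i ≤ suc k → Cell n nothing j h i u l (mon ζ) ≈ Cell (suc (suc k)) nothing j h i u l (mon ζ)
          top ζ u ui≤ = let (d , n≡) = n-split in
            ≡.subst (λ m → Cell m nothing j h i u l (mon ζ) ≈ Cell (suc (suc k)) nothing j h i u l (mon ζ)) n≡
              (Cell-skips d _ nothing j h i u l (mon ζ) λ s le (_ , s≤u) → <⇒≱ le (≤-trans s≤u ui≤))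
          from₀ : ∀ ζ c → B₀ ζ k c ≈ B₁ ζ k c
          from₀ ζ c = Cell-ext k c j h i u₀ u₁ l (mon ζ)
            (λ s s<k (l≤s , _) → l≤s , ≤-trans (≤-trans (<⇒≤ s<k) (n≤1+n k)) (≤-reflexive (≡.sym u₁i)))
            (λ s s<k (l≤s , _) → l≤s , ≤-trans (<⇒≤ s<k) (≤-reflexive (≡.sym u₀i)))
            (λ s _ s≢i → ≡.sym (u≗ s (λ e → s≢i (≡.trans e (≡.sym i≡p)))))
          -- The recursion h_{m+1} = (x + y) h_m − x y h_{m−1} of the complete
          -- symmetric polynomials, with the subtracted term moved to the left.
          form : ∀ ζ {D} → B₁ ζ k (just (k , k)) ≈ B₁ ζ k (just (suc k , k)) + ζ (suc k) * D →
            Run ζ (B₁ ζ n nothing) (B₀ ζ n nothing) + xy ζ * B₁ ζ k (just (suc k , suc k)) ≈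
            (e ζ * B₁ ζ k nothing + (ζ k + ζ (suc k)) * Run ζ (B₁ ζ k (just (suc k , suc k))) (B₁ ζ k (just (suc k , k))))
              + (xy ζ * e ζ) * D
          form ζ q = trans (+-congʳ (+-cong
              (*-congˡ (trans (top ζ u₁ (≤-reflexive u₁i)) (trans (P.expand₂ ζ nothing al₁ al₁′) (+-congʳ (+-congˡ (*-congˡ q))))))
              (*-congˡ (trans (top ζ u₀ (≤-trans (≤-reflexive u₀i) (n≤1+n k)))
                (trans (Cell-skip (suc k) nothing j h i u₀ l _ (λ (_ , le) → <⇒≱ ≤-refl (≤-trans le (≤-reflexive u₀i))))
                (trans (Cell-take-mon k nothing j h i u₀ l ζ al₀)
                  (+-cong (from₀ ζ nothing) (*-congˡ (trans (from₀ ζ (just (k , k))) q)))))))))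
            (solve 6 (λ x y w q₀ q₁ d →
                (y ⊗ ((w ⊕ x ⊗ (q₀ ⊕ y ⊗ d)) ⊕ y ⊗ (q₁ ⊕ x ⊗ q₀)) ⊕ (x ⊕ x ⊗ y) ⊗ (w ⊕ x ⊗ (q₀ ⊕ y ⊗ d))) ⊕ (x ⊗ y) ⊗ q₁
              ⊜ ((y ⊕ (x ⊕ x ⊗ y)) ⊗ w ⊕ (x ⊕ y) ⊗ (y ⊗ q₁ ⊕ (x ⊕ x ⊗ y) ⊗ q₀)) ⊕ ((x ⊗ y) ⊗ (y ⊕ (x ⊕ x ⊗ y))) ⊗ d)
              refl _ _ _ _ _ _)

      -- If row `i` is above `p`, its bound is below k and forbids both letters. If it is below `p`
      -- and row `p` continues to the left, then l > u₁ p = k + 1 forbids them. If row `p` does not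
      -- continue, its bound is never read and the weights merge into `e`. In row `p` itself `same`
      -- applies.
      step : SymC j (suc h) → Run z (B₁ z n nothing) (B₀ z n nothing) ≈ Run z′ (B₁ z′ n nothing) (B₀ z′ n nothing)
      step S′ with ℕ.<-cmp i p
      ... | tri≈ _ i≡p _ = same i≡p
      ... | tri< i<p i≢p _ = other i≢p (λ (_ , le) → <⇒≱ (small i (inj₁ ≤-refl) i<p) le)
              (λ (_ , le) → <⇒≱ (small i (inj₁ ≤-refl) i<p) (≤-trans (n≤1+n k) le)) n nothing tt tt tt
      ... | tri> _ i≢p p<i with Left? j p
      ...   | yes left = other i≢p (λ (le , _) → <⇒≱ (k+1<l) (≤-trans le (n≤1+n k))) (λ (le , _) → <⇒≱ k+1<l le) n nothing tt tt tt
              where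
              k+1<l : suc k < l
              k+1<l = ≡.subst (_< l) u₁p (above p p<i left)
      ...   | no ¬left = trans (+-congˡ (*-congˡ (ext z))) (trans (Run-factor z _) (trans (*-cong e-sym sym₁)
                (sym (trans (+-congˡ (*-congˡ (ext z′))) (Run-factor z′ _)))))
              where
              inactive : ∀ r → Active j i r → r ≢ p
              inactive r (inj₁ i≤r) ≡.refl = <⇒≱ p<i i≤r
              inactive r (inj₂ left) ≡.refl = ¬left left
              ext : ∀ ζ → B₀ ζ n nothing ≈ B₁ ζ n nothing
              ext ζ = Col-ext j (suc h) i u₀ u₁ l (mon ζ) λ r act → ≡.sym (u≗ r (inactive r act))
              sym₁ : B₁ z n nothing ≈ B₁ z′ n nothing
              sym₁ = S′ i u₁ l i+h above (λ r act → neutral r act (inactive r act)) l≢k+1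

    sym-suc : ∀ j h → SymC j h → RunC j h → ΔC j h → SymC j (suc h)
    sym-suc j h S R′ Δ i u l i+h above neutral l≢k+1 = let (d , n≡) = n-split in
      ≡.subst (λ m → Cell m nothing j h i u l (mon z) ≈ Cell m nothing j h i u l (mon z′)) n≡
        (CellPhase.symHigh j h i u l i+h S R′ Δ above (λ r act _ → neutral r (Active-suc j i act))
          (neutral i (inj₁ ≤-refl)) l≢k+1 d nothing tt)

    -- All three claims for h boxes give `SymC` for h + 1, which in turn serves `RunC` for h + 1. A
    -- new column starts with l = 0 and no rows to its left above it, so its hypotheses on rows
    -- above are vacuous; at the end of a column no box below remains, whence D = 0.
    claims : ∀ j h → SymC j h × RunC j h × ΔC j h
    claims zero zero = (λ _ _ _ _ _ _ _ → refl) ,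
      (λ _ _ _ _ _ _ _ _ _ _ _ _ _ → trans (Run-factor z 1#) (trans (*-congʳ e-sym) (sym (Run-factor z′ 1#)))) ,
      λ _ _ _ _ _ _ → 0# , 0# , refl , trivial , trivial
      where
      trivial : ∀ {x y} → x ≈ x + y * 0#
      trivial = sym (trans (+-congˡ (zeroʳ _)) (+-identityʳ _))
    claims (suc j) zero =
      (λ i u l _ _ neutral _ → S (a j) u 0 (height j) (λ r r<a left → ⊥-elim (¬above j r<a left)) (λ r act → neutral r (Active-next j act)) λ ()) ,
      (λ i u₁ u₀ l p _ _ neutral _ u₁p u₀p u≗ small → R′ (a j) u₁ u₀ 0 p (height j) (λ r r<a left → ⊥-elim (¬above j r<a left))
        (λ r act → neutral r (Active-next j act)) (λ ()) u₁p u₀p u≗ (λ r act → small r (Active-next j act))) ,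
      λ _ _ _ _ _ _ → 0# , 0# , refl , trivial , trivial
      where
      S = proj₁ (claims j (b j ∸ a j))
      R′ = proj₁ (proj₂ (claims j (b j ∸ a j)))
      trivial : ∀ {x y} → x ≈ x + y * 0#
      trivial = sym (trans (+-congˡ (zeroʳ _)) (+-identityʳ _))
    claims j (suc h) with claims j h
    ... | S , R′ , Δ = S′ ,
      (λ i u₁ u₀ l p i+h above neutral l≢k+1 u₁p u₀p u≗ small →
        RunStep.step j h i u₁ u₀ l p i+h S R′ Δ above neutral l≢k+1 u₁p u₀p u≗ small S′) ,
      Δ-suc j h S
      where
      S′ = sym-suc j h S R′ Δ

-- Alternants

module Alternants {c ℓ₁} (R : CommutativeRing c ℓ₁) where
  open CommutativeRing R hiding (zero)
  open import Algebra.Properties.Semiring.Exp semiring using (_^_)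
  open Solver commutativeSemiring using (solve)
    renaming (_:=_ to infix 4 _⊜_; _:+_ to infixl 6 _⊕_; _:*_ to infixl 7 _⊗_)
  open RingProperties ring using (-0#≈0#; -‿distribʳ-*; -‿+-comm)

  -- The choice of a first element, with alternating signs, the others keeping their order: the
  -- expansion of a determinant along a row.
  Remove : List Carrier → (Carrier → List Carrier → Carrier) → Carrier
  Remove []       φ = 0#
  Remove (z ∷ zs) φ = φ z zs - Remove zs (λ y ys → φ y (z ∷ ys))

  -- For m = length zs, the signed sum of f over the permutations of zs.
  Alt : ℕ → List Carrier → (List Carrier → Carrier) → Carrier
  Alt zero    zs f = f zs
  Alt (suc m) zs f = Remove zs (λ y ys → Alt m ys (λ ws → f (y ∷ ws)))

  Remove-cong : ∀ zs {φ ψ} → (∀ y ys → y ∷ ys ↭ zs → φ y ys ≈ ψ y ys) → Remove zs φ ≈ Remove zs ψ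
  Remove-cong []       e = refl
  Remove-cong (z ∷ zs) e = +-cong (e z zs ↭-refl)
    (-‿cong (Remove-cong zs λ y ys p → e y (z ∷ ys) (↭-trans (swap y z ↭-refl) (prep z p))))

  Remove-+ : ∀ zs φ ψ → Remove zs (λ y ys → φ y ys + ψ y ys) ≈ Remove zs φ + Remove zs ψ
  Remove-+ []       φ ψ = sym (+-identityʳ 0#)
  Remove-+ (z ∷ zs) φ ψ = trans (+-congˡ (trans (-‿cong (Remove-+ zs _ _)) (sym (-‿+-comm _ _))))
    (solve 4 (λ x y z w → (x ⊕ y) ⊕ (z ⊕ w) ⊜ (x ⊕ z) ⊕ (y ⊕ w)) refl _ _ _ _)

  Remove-* : ∀ zs x φ → Remove zs (λ y ys → x * φ y ys) ≈ x * Remove zs φ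
  Remove-* []       x φ = sym (zeroʳ x)
  Remove-* (z ∷ zs) x φ = trans (+-congˡ (trans (-‿cong (Remove-* zs x _)) (-‿distribʳ-* x _))) (sym (distribˡ x _ _))

  Remove-0 : ∀ zs → Remove zs (λ _ _ → 0#) ≈ 0#
  Remove-0 []       = refl
  Remove-0 (z ∷ zs) = trans (+-identityˡ _) (trans (-‿cong (Remove-0 zs)) -0#≈0#)

  Remove-neg : ∀ zs φ → Remove zs (λ y ys → - φ y ys) ≈ - Remove zs φ
  Remove-neg []       φ = sym -0#≈0#
  Remove-neg (z ∷ zs) φ = trans (+-congˡ (-‿cong (Remove-neg zs _))) (-‿+-comm _ _)

  Alt-cong : ∀ m zs {f g} → (∀ ys → ys ↭ zs → f ys ≈ g ys) → Alt m zs f ≈ Alt m zs g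
  Alt-cong zero    zs e = e zs ↭-refl
  Alt-cong (suc m) zs e = Remove-cong zs λ y ys p → Alt-cong m ys λ ws q → e (y ∷ ws) (↭-trans (prep y q) p)

  Alt-+ : ∀ m zs f g → Alt m zs (λ ys → f ys + g ys) ≈ Alt m zs f + Alt m zs g
  Alt-+ zero    zs f g = refl
  Alt-+ (suc m) zs f g = trans (Remove-cong zs λ y ys _ → Alt-+ m ys _ _) (Remove-+ zs _ _)

  Alt-* : ∀ m zs x f → Alt m zs (λ ys → x * f ys) ≈ x * Alt m zs f
  Alt-* zero    zs x f = refl
  Alt-* (suc m) zs x f = trans (Remove-cong zs λ y ys _ → Alt-* m ys x _) (Remove-* zs x _)

  Alt-0 : ∀ m zs → Alt m zs (λ _ → 0#) ≈ 0#
  Alt-0 zero    zs = refl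
  Alt-0 (suc m) zs = trans (Remove-cong zs λ y ys _ → Alt-0 m ys) (Remove-0 zs)

  -- Choosing x after y and y after x leave the same list and have opposite signs. The terms in
  -- which `z` is chosen first cancel those in which it is chosen second.
  Remove-Remove : ∀ zs (φ : Carrier → Carrier → List Carrier → Carrier) →
    (∀ y x xs → suc (suc (length xs)) ≡ length zs → φ y x xs ≈ φ x y xs) →
    Remove zs (λ y ys → Remove ys (φ y)) ≈ 0#
  Remove-Remove []       φ s = refl
  Remove-Remove (z ∷ zs) φ s = trans (+-congˡ (-‿cong (trans (Remove-+ zs _ _)
      (+-cong (Remove-cong zs (λ y ys p → s y z ys (≡.cong suc (↭-length p))))
        (trans (Remove-neg zs _) (trans (-‿cong (Remove-Remove zs (λ y x xs → φ y x (z ∷ xs)) λ y x xs l → s y x (z ∷ xs) (≡.cong suc l))) -0#≈0#))))))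
    (trans (+-congˡ (-‿cong (+-identityʳ _))) (-‿inverseʳ _))

  -- The letter of a position in a list is the number of positions after it.
  Swappable : ℕ → (List Carrier → Carrier) → Set _
  Swappable k f = ∀ as x y bs → length bs ≡ k → f (as ++ x ∷ y ∷ bs) ≈ f (as ++ y ∷ x ∷ bs)

  -- Letters count from the end of the list, so removing heads does not renumber them. When k + 1
  -- has become the letter of the head, the two outermost choices fill the letters k + 1 and k, and
  -- `Remove-Remove` applies.
  Alt-vanishes : ∀ m zs k f → length zs ≡ m → suc k < m → Swappable k f → Alt m zs f ≈ 0#
  Alt-vanishes (suc m) zs k f len k<m s with suc k ℕ.<? m
  ... | yes k<m′ = trans (Remove-cong zs λ y ys p → Alt-vanishes m ys k _
          (ℕ.suc-injective (≡.trans (↭-length p) len)) k<m′ λ as x y′ bs → s (y ∷ as) x y′ bs) (Remove-0 zs)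
  ... | no k≮m with ℕ.≤-antisym (ℕ.≤-pred k<m) (≮⇒≥ k≮m)
  ...   | ≡.refl = Remove-Remove zs _ λ y x xs l → Alt-cong k xs λ ws p → s [] y x ws
            (≡.trans (↭-length p) (ℕ.suc-injective (ℕ.suc-injective (≡.trans l len))))

  Swappable⇒↭ : ∀ m {f} → (∀ as x y bs → length (as ++ x ∷ y ∷ bs) ≡ m → f (as ++ x ∷ y ∷ bs) ≈ f (as ++ y ∷ x ∷ bs)) →
                ∀ {xs ys : List Carrier} → xs ↭ ys → ∀ as → length (as ++ xs) ≡ m → f (as ++ xs) ≈ f (as ++ ys)
  Swappable⇒↭ m s _↭_.refl as len = refl
  Swappable⇒↭ m {f} s {x ∷ xs} {_ ∷ ys} (prep x p) as len = trans (reflexive (≡.cong f (≡.sym (List.++-assoc as _ xs))))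
    (trans (Swappable⇒↭ m {f} s p (as ++ x ∷ []) (≡.trans (≡.cong length (List.++-assoc as _ xs)) len))
      (reflexive (≡.cong f (List.++-assoc as _ ys))))
  Swappable⇒↭ m {f} s {_ ∷ _ ∷ xs} {_ ∷ _ ∷ ys} (swap x y p) as len = trans (s as x y xs len)
    (trans (reflexive (≡.cong f (≡.sym (List.++-assoc as _ xs))))
      (trans (Swappable⇒↭ m {f} s p (as ++ y ∷ x ∷ []) (≡.trans (≡.cong length (List.++-assoc as _ xs))
          (≡.trans (List.length-++ as {y ∷ x ∷ xs}) (≡.trans (≡.sym (List.length-++ as {x ∷ y ∷ xs})) len))))
        (reflexive (≡.cong f (List.++-assoc as _ ys)))))
  Swappable⇒↭ m {f} s {xs} {zs} (_↭_.trans {ys = ys} p q) as len = trans (Swappable⇒↭ m {f} s p as len)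
    (Swappable⇒↭ m {f} s q as (≡.trans (≡.trans (List.length-++ as) (≡.trans (≡.cong (length as ℕ.+_) (≡.sym (↭-length p))) (≡.sym (List.length-++ as)))) len))

  infixl 10 _‼_
  _‼_ : List Carrier → ℕ → Carrier
  []       ‼ r = 0#
  (y ∷ ys) ‼ r with r ℕ.≟ length ys
  ... | yes _ = y
  ... | no  _ = ys ‼ r

  ‼-here : ∀ y ys {r} → r ≡ length ys → (y ∷ ys) ‼ r ≡ y
  ‼-here y ys {r} e with r ℕ.≟ length ys
  ... | yes _ = ≡.refl
  ... | no ¬e = ⊥-elim (¬e e)

  ‼-there : ∀ y ys {r} → r ≢ length ys → (y ∷ ys) ‼ r ≡ ys ‼ r
  ‼-there y ys {r} ¬e with r ℕ.≟ length ys
  ... | yes e = ⊥-elim (¬e e)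
  ... | no  _ = ≡.refl

  ‼-++ : ∀ as ys {r} → r < length ys → (as ++ ys) ‼ r ≡ ys ‼ r
  ‼-++ []       ys r<l = ≡.refl
  ‼-++ (a ∷ as) ys r<l = ≡.trans (‼-there a (as ++ ys) (<⇒≢ (<-≤-trans r<l
    (≡.subst (length ys ≤_) (≡.sym (List.length-++ as)) (m≤n+m _ (length as)))))) (‼-++ as ys r<l)

  ‼-swap : ∀ as x y bs → (as ++ x ∷ y ∷ bs) ‼ length bs ≡ (as ++ y ∷ x ∷ bs) ‼ suc (length bs)
  ‼-swap as x y bs = ≡.trans (‼-++ as (x ∷ y ∷ bs) (<-trans (n<1+n _) (n<1+n _)))
    (≡.trans (‼-there x (y ∷ bs) (<⇒≢ (n<1+n _))) (≡.trans (‼-here y bs ≡.refl)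
      (≡.sym (≡.trans (‼-++ as (y ∷ x ∷ bs) (n<1+n _)) (‼-here y (x ∷ bs) ≡.refl)))))

  ‼-else : ∀ as x y bs {r} → r ≢ length bs → r ≢ suc (length bs) → (as ++ x ∷ y ∷ bs) ‼ r ≡ (as ++ y ∷ x ∷ bs) ‼ r
  ‼-else [] x y bs r≢k r≢k+1 = ≡.trans (‼-there x (y ∷ bs) r≢k+1) (≡.trans (‼-there y bs r≢k)
    (≡.sym (≡.trans (‼-there y (x ∷ bs) r≢k+1) (‼-there x bs r≢k))))
  ‼-else (a ∷ as) x y bs {r} r≢k r≢k+1 with r ℕ.≟ length (as ++ x ∷ y ∷ bs) | r ℕ.≟ length (as ++ y ∷ x ∷ bs)
  ... | yes _ | yes _ = ≡.refl
  ... | no  _ | no  _ = ‼-else as x y bs r≢k r≢k+1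
  ... | yes e | no ¬e = ⊥-elim (¬e (≡.trans e (≡.trans (List.length-++ as) (≡.sym (List.length-++ as)))))
  ... | no ¬e | yes e = ⊥-elim (¬e (≡.trans e (≡.trans (List.length-++ as) (≡.sym (List.length-++ as)))))

  ‼-snoc-zero : ∀ xs y → (xs ++ y ∷ []) ‼ 0 ≡ y
  ‼-snoc-zero []       y = ≡.refl
  ‼-snoc-zero (x ∷ xs) y = ≡.trans (‼-there x (xs ++ y ∷ []) λ e → <⇒≢ (s≤s z≤n)
    (≡.trans e (≡.trans (List.length-++ xs) (ℕ.+-comm _ 1)))) (‼-snoc-zero xs y)

  ‼-snoc-suc : ∀ xs y r → (xs ++ y ∷ []) ‼ suc r ≡ xs ‼ r
  ‼-snoc-suc []       y r = ≡.refl
  ‼-snoc-suc (x ∷ xs) y r with r ℕ.≟ length xs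
  ... | yes e = ‼-here x (xs ++ y ∷ []) (≡.trans (≡.cong suc e) (≡.sym (≡.trans (List.length-++ xs) (ℕ.+-comm _ 1))))
  ... | no ¬e = ≡.trans (‼-there x (xs ++ y ∷ []) λ e → ¬e (ℕ.suc-injective
          (≡.trans e (≡.trans (List.length-++ xs) (ℕ.+-comm _ 1))))) (‼-snoc-suc xs y r)

  prod : List Carrier → Carrier
  prod []       = 1#
  prod (y ∷ ys) = y * prod ys

  -- In letters, this is ∏_r y_r ^ (γ r + m ∸ 1 ∸ r) (1 + y_r) ^ r for a list
  -- of length m.
  W : (ℕ → ℕ) → List Carrier → Carrier
  W γ []       = 1#
  W γ (y ∷ ys) = (y ^ γ (length ys) * (1# + y) ^ length ys) * (prod ys * W γ ys)

  prod-swap : ∀ as x y bs → prod (as ++ x ∷ y ∷ bs) ≈ prod (as ++ y ∷ x ∷ bs)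
  prod-swap []       x y bs = solve 3 (λ x y z → x ⊗ (y ⊗ z) ⊜ y ⊗ (x ⊗ z)) refl _ _ _
  prod-swap (a ∷ as) x y bs = *-congˡ (prod-swap as x y bs)

  W-ext : ∀ {γ δ} ys → (∀ r → r < length ys → γ r ≡ δ r) → W γ ys ≈ W δ ys
  W-ext [] e = refl
  W-ext (y ∷ ys) e = *-cong (*-congʳ (reflexive (≡.cong (y ^_) (e (length ys) ≤-refl))))
    (*-congˡ (W-ext ys λ r r<l → e r (m<n⇒m<1+n r<l)))

  W-suc : ∀ {γ δ} ys r → r < length ys → δ r ≡ suc (γ r) → (∀ s → s ≢ r → δ s ≡ γ s) → W δ ys ≈ ys ‼ r * W γ ys
  W-suc (y ∷ ys) r (s≤s r≤l) e e′ with r ℕ.≟ length ys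
  ... | yes ≡.refl rewrite e = trans (*-congˡ (*-congˡ (W-ext ys λ s s<l → e′ s (<⇒≢ s<l))))
        (solve 4 (λ y p q w → (y ⊗ p ⊗ q) ⊗ w ⊜ y ⊗ (p ⊗ q ⊗ w)) refl _ _ _ _)
  ... | no r≢l rewrite e′ (length ys) (λ e → r≢l (≡.sym e)) = trans (*-congˡ (*-congˡ (W-suc ys r (≤∧≢⇒< r≤l r≢l) e e′)))
        (solve 4 (λ a p y w → a ⊗ (p ⊗ (y ⊗ w)) ⊜ y ⊗ (a ⊗ (p ⊗ w))) refl _ _ _ _)

  -- With equal exponents, x · W is (1 + x) times an expression symmetric in x and y: the later
  -- variable y has one more factor from `prod`, which x makes up for, and x has one more factor 1 +
  -- x.
  W-swap : ∀ γ as x y bs p q → γ (suc (length bs)) ≡ γ (length bs) → (1# + x) * p ≈ (1# + y) * q →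
           W γ (as ++ x ∷ y ∷ bs) * (x * p) ≈ W γ (as ++ y ∷ x ∷ bs) * (y * q)
  W-swap γ [] x y bs p q e pq rewrite e = trans
    (solve 10 (λ x y p X Y 1x 1xk 1yk b w →
       ((X ⊗ (1x ⊗ 1xk)) ⊗ ((y ⊗ b) ⊗ ((Y ⊗ 1yk) ⊗ (b ⊗ w)))) ⊗ (x ⊗ p)
     ⊜ (x ⊗ y ⊗ X ⊗ Y ⊗ 1xk ⊗ 1yk ⊗ b ⊗ b ⊗ w) ⊗ (1x ⊗ p)) refl x y p (x ^ g) (y ^ g) (1# + x) ((1# + x) ^ k) ((1# + y) ^ k) (prod bs) (W γ bs))
    (trans (*-congˡ pq)
    (solve 10 (λ x y q X Y 1y 1xk 1yk b w →
       (x ⊗ y ⊗ X ⊗ Y ⊗ 1xk ⊗ 1yk ⊗ b ⊗ b ⊗ w) ⊗ (1y ⊗ q)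
     ⊜ ((Y ⊗ (1y ⊗ 1yk)) ⊗ ((x ⊗ b) ⊗ ((X ⊗ 1xk) ⊗ (b ⊗ w)))) ⊗ (y ⊗ q)) refl x y q (x ^ g) (y ^ g) (1# + y) ((1# + x) ^ k) ((1# + y) ^ k) (prod bs) (W γ bs)))
    where
    k = length bs
    g = γ (length bs)
  W-swap γ (a ∷ as) x y bs p q e pq
    rewrite ≡.trans (List.length-++ as {x ∷ y ∷ bs}) (≡.sym (List.length-++ as {y ∷ x ∷ bs})) =
    trans (solve 4 (λ a p w r → (a ⊗ (p ⊗ w)) ⊗ r ⊜ a ⊗ (p ⊗ (w ⊗ r))) refl _ _ _ _)
    (trans (*-congˡ (*-cong (prod-swap as x y bs) (W-swap γ as x y bs p q e pq)))
    (solve 4 (λ a p w r → a ⊗ (p ⊗ (w ⊗ r)) ⊜ (a ⊗ (p ⊗ w)) ⊗ r) refl _ _ _ _))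

-- Paths of partitions

part : List ℕ → ℕ → ℕ
part []      _       = 0
part (m ∷ p) zero    = m
part (m ∷ p) (suc i) = part p i

rowLength-part : ∀ ρ i → rowLength ρ i ≡ part (parts ρ) i
rowLength-part (mkPartition p d q) i = go p d q i
  where
  go : ∀ p .(d : Linked _≥_ p) .(q : All (0 <_) p) i → rowLength (mkPartition p d q) i ≡ part p i
  go []      d q i       = ≡.refl
  go (m ∷ p) d q zero    = ≡.refl
  go (m ∷ p) d q (suc i) = go p (Linked.tail d) (All.tail q) i

part-anti : ∀ {p} → Linked _≥_ p → ∀ i → part p (suc i) ≤ part p i
part-anti []       i       = z≤n
part-anti [-]      zero    = z≤n
part-anti [-]      (suc i) = z≤n
part-anti (le ∷ d) zero    = le
part-anti (le ∷ d) (suc i) = part-anti d i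

partition-linked : ∀ ρ → Linked _≥_ (parts ρ)
partition-linked (mkPartition p d _) = recompute (linked? ℕ._≥?_ p) d

partition-positive : ∀ ρ → All (0 <_) (parts ρ)
partition-positive (mkPartition p _ q) = recompute (All.all? (0 ℕ.<?_) p) q

rowLength-anti : ∀ ρ i → rowLength ρ (suc i) ≤ rowLength ρ i
rowLength-anti ρ i = ≡.subst₂ _≤_ (≡.sym (rowLength-part ρ (suc i))) (≡.sym (rowLength-part ρ i)) (part-anti (partition-linked ρ) i)

+□-here : ∀ {p r q} → p +□[ r ] q → part q r ≡ suc (part p r)
+□-here new       = ≡.refl
+□-here here      = ≡.refl
+□-here (there s) = +□-here s

+□-there : ∀ {p r q} → p +□[ r ] q → ∀ s → s ≢ r → part q s ≡ part p s
+□-there new       zero    s≢r = ⊥-elim (s≢r ≡.refl)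
+□-there new       (suc s) s≢r = ≡.refl
+□-there here      zero    s≢r = ⊥-elim (s≢r ≡.refl)
+□-there here      (suc s) s≢r = ≡.refl
+□-there (there t) zero    s≢r = ≡.refl
+□-there (there t) (suc s) s≢r = +□-there t s (s≢r ∘ ≡.cong suc)

step-here : ∀ {ρ r σ} → ρ ⟶[ r ] σ → rowLength σ r ≡ suc (rowLength ρ r)
step-here {ρ} {r} {σ} s = ≡.trans (rowLength-part σ r) (≡.trans (+□-here s) (≡.cong suc (≡.sym (rowLength-part ρ r))))

step-there : ∀ {ρ r σ} → ρ ⟶[ r ] σ → ∀ s → s ≢ r → rowLength σ s ≡ rowLength ρ s
step-there {ρ} {r} {σ} t s s≢r = ≡.trans (rowLength-part σ s) (≡.trans (+□-there t s s≢r) (≡.sym (rowLength-part ρ s)))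

addable : ∀ p r → Linked _≥_ p → (∀ k → r ≡ suc k → part p (suc k) < part p k) → ∃ λ q → p +□[ r ] q × Linked _≥_ q
addable []          zero          d        lt = _ , new , [-]
addable []          (suc k)       d        lt with () ← lt k ≡.refl
addable (m ∷ [])    zero          [-]      lt = _ , here , [-]
addable (m ∷ _ ∷ _) zero          (le ∷ d) lt = _ , here , ℕ.m≤n⇒m≤1+n le ∷ d
addable (m ∷ [])    (suc zero)    [-]      lt = _ , there new , lt 0 ≡.refl ∷ [-]
addable (m ∷ [])    (suc (suc k)) [-]      lt with () ← lt (suc k) ≡.refl
addable (m ∷ _ ∷ p) (suc zero)    (le ∷ d) lt with addable (_ ∷ p) zero d (λ _ ())
... | _ , here , d′ = _ , there here , lt 0 ≡.refl ∷ d′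
addable (m ∷ _ ∷ p) (suc (suc k)) (le ∷ d) lt with addable (_ ∷ p) (suc k) d (λ { k ≡.refl → lt (suc k) ≡.refl })
... | _ , there s , d′ = _ , there (there s) , le ∷ d′

-- A box cannot be added only where the row above has the same length. This is the equality of
-- exponents that `W-swap` needs.
¬step : ∀ ρ r → ¬ (∃ λ σ → ρ ⟶[ r ] σ) → ∃ λ k → r ≡ suc k × rowLength ρ (suc k) ≡ rowLength ρ k
¬step ρ zero ¬s with addable (parts ρ) zero (partition-linked ρ) (λ _ ())
... | q , s , d = ⊥-elim (¬s (mkPartition q d (+□-positive s (partition-positive ρ)) , s))
¬step ρ (suc k) ¬s with rowLength ρ (suc k) ℕ.<? rowLength ρ k
... | no ≮ = k , ≡.refl , ℕ.≤-antisym (rowLength-anti ρ k) (≮⇒≥ ≮)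
... | yes lt with addable (parts ρ) (suc k) (partition-linked ρ)
                    (λ { k ≡.refl → ≡.subst₂ _<_ (rowLength-part ρ (suc k)) (rowLength-part ρ k) lt })
...   | q , s , d = ⊥-elim (¬s (mkPartition q d (+□-positive s (partition-positive ρ)) , s))

-- A word admits at most one path from a given partition, so paths can be traced by a function;
-- `nothing` marks a word that leaves the partitions.
advance : Partition → List ℕ → Maybe Partition
advance-by : ∀ ρ r → Dec (∃ λ σ → ρ ⟶[ r ] σ) → List ℕ → Maybe Partition
advance ρ []      = just ρ
advance ρ (r ∷ w) = advance-by ρ r (step? ρ r) w
advance-by ρ r (yes (σ , _)) w = advance σ w
advance-by ρ r (no _)        w = nothing

advance⇒Path : ∀ ρ w {ν} → advance ρ w ≡ just ν → Path ρ w ν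
advance⇒Path ρ []      ≡.refl = []
advance⇒Path ρ (r ∷ w) e with step? ρ r
... | yes (σ , s) = _∷_ {σ = σ} s (advance⇒Path σ w e)

Path⇒advance : ∀ ρ w {ν} → Path ρ w ν → advance ρ w ≡ just ν
Path⇒advance ρ []      []      = ≡.refl
Path⇒advance ρ (r ∷ w) (_∷_ {σ = τ} t p) with step? ρ r
... | no ¬s = ⊥-elim (¬s (τ , t))
... | yes (σ , s) with parts-injective {σ} {τ} (+□-functional s t)
...   | ≡.refl = Path⇒advance σ w p

part-zero : ∀ p i → length p ≤ i → part p i ≡ 0
part-zero []      i       _         = ≡.refl
part-zero (m ∷ p) (suc i) (s≤s le) = part-zero p i le

part-pos : ∀ {p} → All (0 <_) p → ∀ i → i < length p → 0 < part p i
part-pos (m>0 ∷ q) zero    _        = m>0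
part-pos (m>0 ∷ q) (suc i) (s≤s lt) = part-pos q i lt

step-ℓ : ∀ {p r q n} → p +□[ r ] q → r < n → length p ≤ n → length q ≤ n
step-ℓ new       r<n       le       = r<n
step-ℓ here      r<n       le       = le
step-ℓ (there s) (s≤s r<n) (s≤s le) = s≤s (step-ℓ s r<n le)

-- Cancellation of the words that leave the partitions

module Values {c ℓ₁} (R : CommutativeRing c ℓ₁) (n : ℕ) (zs : List (CommutativeRing.Carrier R)) where
  open CommutativeRing R using (Carrier; 0#)
  open Alternants R

  A : Partition → Carrier
  A ρ = Alt n zs (W (rowLength ρ))

  value : Maybe Partition → Carrier
  value = maybe′ A 0#

module Cancellation {c ℓ₁} (R : CommutativeRing c ℓ₁) (n : ℕ) (a b : ℕ → ℕ)
  (a-anti : ∀ j → a (suc j) ≤ a j) (b-anti : ∀ j → b (suc j) ≤ b j) (a≤b : ∀ j → a j ≤ b j)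
  (zs : List (CommutativeRing.Carrier R)) (zs-length : length zs ≡ n) where

  open CommutativeRing R hiding (zero)
  open Solver commutativeSemiring using (solve)
    renaming (_:=_ to infix 4 _⊜_; _:+_ to infixl 6 _⊕_; _:*_ to infixl 7 _⊗_)
  open Words R n a b
  open Geometry a-anti b-anti a≤b
  open Alternants R
  open Values R n zs

  -- A at the weight ρ + content of w, which need not be a partition.
  E : Partition → List ℕ → Carrier
  E ρ w = Alt n zs (λ ys → W (rowLength ρ) ys * mon (ys ‼_) w)

  -- A filled column leaves strictly increasing bounds; a row not yet entered has bound n, no
  -- restriction on letters below n.
  Increasing : ℕ → ℕ → (ℕ → ℕ) → Set
  Increasing j i u = ∀ r s → Active j i r → Active j i s → r < s → u r < u s ⊎ n ≤ u s

  -- Here m = l - 1 is the maximum of the box above. Since m was read, row m is longer than row m +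
  -- 1, and letters above m + 1 change neither. So the letter l itself never fails.
  Strict : ℕ → ℕ → Partition → Set
  Strict l r ρ = ∀ m → l ≡ suc m → suc m < r → rowLength ρ (suc m) < rowLength ρ m

  length-n : ∀ {ys} → ys ↭ zs → length ys ≡ n
  length-n p = ≡.trans (↭-length p) zs-length

  Cancels : ℕ → ℕ → Set ℓ₁
  Cancels j h = ∀ i u l ρ → i ℕ.+ h ≡ b j → RowsAbove l j i u → Increasing j i u → Strict l n ρ →
    Col j h i u l (E ρ) ≈ Col j h i u l (λ w → value (advance ρ w))

  -- Reading k + 1 when the parts k and k + 1 of ρ are equal leaves the set of
  -- partitions.  The factor W gives such a term the extra factor
  -- x y (1 + y) over something symmetric, and (1 + y) times the sum over the
  -- entries still to be read is symmetric, so the alternation kills it.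
  module Violation (j h i : ℕ) (u : ℕ → ℕ) (l k : ℕ) (i+h : i ℕ.+ suc h ≡ b j)
    (above : RowsAbove l j i u) (inc : Increasing j i u) (k+1<n : suc k < n) (l≤k : l ≤ k) (k<u : suc k ≤ u i)
    (mx : ℕ) (k<mx : suc k ≤ mx) where

    rest : List Carrier → Carrier
    rest ys = Cell (suc k) (just (mx , suc k)) j h i u l (mon (ys ‼_))

    -- The bounds of rows above that continue are below l ≤ k; those of rows below exceed u i ≥ k +
    -- 1 or are at least n. None separates k from k + 1.
    neutral : ∀ r → Active j (suc i) r → r ≢ i → u r ≢ k
    neutral r act r≢i e with ℕ.<-cmp r i
    ... | tri≈ _ r≡i _ = r≢i r≡i
    neutral r (inj₁ i<r)  r≢i e | tri< r<i _ _ = <-asym i<r r<i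
    neutral r (inj₂ left) r≢i e | tri< r<i _ _ = <⇒≢ (<-≤-trans (above r r<i left) l≤k) e
    neutral r act r≢i e | tri> _ _ i<r with inc i r (inj₁ ≤-refl) (Active-suc j i act) i<r
    ... | inj₁ ui<ur = >⇒≢ (<-trans (≤-trans (n<1+n k) k<u) ui<ur) e
    ... | inj₂ n≤ur  = >⇒≢ (<-trans (n<1+n k) (<-≤-trans k+1<n n≤ur)) e

    expand : ∀ ζ → (1# + ζ (suc k)) * Cell (suc k) (just (mx , suc k)) j h i u l (mon ζ) ≈
      Cell k (just (mx , suc k)) j h i u l (mon ζ)
      + (ζ (suc k) * Cell k (just (mx , suc k)) j h i u l (mon ζ) + (ζ k + ζ k * ζ (suc k)) * Cell k (just (mx , k)) j h i u l (mon ζ))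
    expand ζ = trans (distribʳ _ _ _) (trans (+-congʳ (*-identityˡ _)) (trans
      (+-cong take (*-congˡ take))
      (solve 4 (λ x y p q → (p ⊕ x ⊗ q) ⊕ y ⊗ (p ⊕ x ⊗ q) ⊜ p ⊕ (y ⊗ p ⊕ (x ⊕ x ⊗ y) ⊗ q)) refl _ _ _ _)))
      where
      take = Cell-take-mon k (just (mx , suc k)) j h i u l ζ (l≤k , <⇒≤ k<u)

    -- By `expand`, the factor 1 + ζ (k + 1) turns `rest` into a box to which only letters below k
    -- are added, covered by `symLow`, plus a `Run`, covered by `runLow`.
    rest-swap : ∀ as x y bs → length bs ≡ k → (1# + x) * rest (as ++ x ∷ y ∷ bs) ≈ (1# + y) * rest (as ++ y ∷ x ∷ bs)
    rest-swap as x y bs ≡.refl = trans (*-congʳ (+-congˡ (sym x≈)))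
      (trans (expand (_‼_ (as ++ x ∷ y ∷ bs))) (trans (+-cong
        (P.symLow k (just (mx , suc k)) ≤-refl (n≤1+n k , k<mx , ≤-trans l≤k (n≤1+n k)) (>⇒≢ k<mx , >⇒≢ ≤-refl))
        (P.runLow l≤k k mx ≤-refl k<mx))
      (trans (sym (expand (_‼_ (as ++ y ∷ x ∷ bs)))) (*-congʳ (+-congˡ y≈)))))
      where
      module S = Symmetry R n a b a-anti b-anti a≤b k k+1<n
      z-k = reflexive (‼-swap as x y bs)
      z-k+1 = reflexive (≡.sym (‼-swap as y x bs))
      z-else = λ r r≢k r≢k+1 → reflexive (‼-else as x y bs {r} r≢k r≢k+1)
      cl = S.claims (_‼_ (as ++ x ∷ y ∷ bs)) (_‼_ (as ++ y ∷ x ∷ bs)) z-k z-k+1 z-else j h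
      module P = S.CellPhase (_‼_ (as ++ x ∷ y ∷ bs)) (_‼_ (as ++ y ∷ x ∷ bs)) z-k z-k+1 z-else
        j h i u l i+h (proj₁ cl) (proj₁ (proj₂ cl)) (proj₂ (proj₂ cl)) above neutral
      x≈ : (as ++ x ∷ y ∷ bs) ‼ suc k ≈ x
      x≈ = reflexive (≡.trans (‼-++ as (x ∷ y ∷ bs) (n<1+n _)) (‼-here x (y ∷ bs) ≡.refl))
      y≈ : (as ++ y ∷ x ∷ bs) ‼ suc k ≈ y
      y≈ = reflexive (≡.trans (‼-++ as (y ∷ x ∷ bs) (n<1+n _)) (‼-here y (x ∷ bs) ≡.refl))

    vanishes : ∀ ρ → rowLength ρ (suc k) ≡ rowLength ρ k →
      Cell (suc k) (just (mx , suc k)) j h i u l (λ w → E ρ (suc k ∷ w)) ≈ 0#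
    vanishes ρ e = trans (sym (Cell-Λ (Alt n zs) (λ e → Alt-cong n zs (λ ys _ → e ys)) (Alt-0 n zs) (Alt-+ n zs)
        (suc k) (just (mx , suc k)) j h i u l (λ w ys → W (rowLength ρ) ys * (ys ‼ suc k * mon (ys ‼_) w))))
      (trans (Alt-cong n zs λ ys _ → trans (Cell-* (suc k) (just (mx , suc k)) j h i u l _ _)
        (*-congˡ (Cell-* (suc k) (just (mx , suc k)) j h i u l _ _)))
      (Alt-vanishes n zs k _ zs-length k+1<n swaps))
      where
      swaps : Swappable k (λ ys → W (rowLength ρ) ys * (ys ‼ suc k * rest ys))
      swaps as x y bs ≡.refl = trans (*-congˡ (*-congʳ (x≈ as x y bs)))
        (trans (W-swap (rowLength ρ) as x y bs _ _ e (rest-swap as x y bs ≡.refl)) (*-congˡ (*-congʳ (sym (x≈ as y x bs)))))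
        where
        x≈ : ∀ as x y bs → (as ++ x ∷ y ∷ bs) ‼ suc (length bs) ≈ x
        x≈ as x y bs = reflexive (≡.trans (‼-++ as (x ∷ y ∷ bs) (n<1+n _)) (‼-here x (y ∷ bs) ≡.refl))

  module CancelCell (j h i : ℕ) (u : ℕ → ℕ) (l : ℕ) (i+h : i ℕ.+ suc h ≡ b j)
    (above : RowsAbove l j i u) (inc : Increasing j i u) (ih : Cancels j h) where

    -- Once `mx` is read, row `mx` is longer than row `mx + 1`, and the later, smaller letters of
    -- the box touch neither row. When the box closes, this becomes `Strict` for the box below.
    Started : Cur → ℕ → Partition → Set
    Started nothing          r ρ = Strict l r ρ
    Started (just (mx , mn)) r ρ = Strict l r ρ × mn ≤ u i × rowLength ρ (suc mx) < rowLength ρ mx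

    Started-strict : ∀ c {r ρ} → Started c r ρ → Strict l r ρ
    Started-strict nothing  s       = s
    Started-strict (just _) (s , _) = s

    Started-skip : ∀ c {r ρ} → Started c (suc r) ρ → Started c r ρ
    Started-skip nothing s = λ m e lt → s m e (m<n⇒m<1+n lt)
    Started-skip (just _) (s , p) = (λ m e lt → s m e (m<n⇒m<1+n lt)) , p

    Strict-add : ∀ {r ρ σ} → ρ ⟶[ r ] σ → Strict l (suc r) ρ → Strict l r σ
    Strict-add {r} {ρ} {σ} t s m e lt = ≡.subst₂ _<_ (≡.sym (step-there {ρ} {r} {σ} t (suc m) (<⇒≢ lt)))
      (≡.sym (step-there {ρ} {r} {σ} t m (<⇒≢ (<-trans (n<1+n m) lt)))) (s m e (m<n⇒m<1+n lt))

    Started-add : ∀ c {r ρ σ} → ρ ⟶[ r ] σ → r ≤ u i → Valid l (suc r) c → Started c (suc r) ρ → Started (add c r) r σ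
    Started-add nothing {r} {ρ} {σ} t r≤u _ s = Strict-add {r} {ρ} {σ} t s , r≤u ,
      ≡.subst₂ _<_ (≡.sym (step-there {ρ} {r} {σ} t (suc r) (>⇒≢ (n<1+n r)))) (≡.sym (step-here {ρ} {r} {σ} t)) (s≤s (rowLength-anti ρ r))
    Started-add (just (mx , mn)) {r} {ρ} {σ} t r≤u (r<mn , mn≤mx , _) (s , _ , lt) = Strict-add {r} {ρ} {σ} t s , r≤u ,
      ≡.subst₂ _<_ (≡.sym (step-there {ρ} {r} {σ} t (suc mx) (>⇒≢ (m<n⇒m<1+n r<mx)))) (≡.sym (step-there {ρ} {r} {σ} t mx (>⇒≢ r<mx))) lt
      where
      r<mx : r < mx
      r<mx = <-≤-trans r<mn mn≤mx

    Increasing-suc : ∀ {mn} → l ≤ mn → mn ≤ u i → Increasing j (suc i) (u [ i ≔ mn ])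
    Increasing-suc {mn} l≤mn mn≤u r s actr acts r<s with r ℕ.≟ i | s ℕ.≟ i
    ... | yes ≡.refl | yes ≡.refl = ⊥-elim (<-irrefl ≡.refl r<s)
    ... | no _ | no _ = inc r s (Active-suc j i actr) (Active-suc j i acts) r<s
    ... | yes ≡.refl | no _ with inc i s (inj₁ ≤-refl) (Active-suc j i acts) r<s
    ...   | inj₁ lt = inj₁ (ℕ.≤-<-trans mn≤u lt)
    ...   | inj₂ le = inj₂ le
    Increasing-suc l≤mn mn≤u r s (inj₁ i<r)  acts r<s | no _ | yes ≡.refl = ⊥-elim (<-asym i<r r<s)
    Increasing-suc l≤mn mn≤u r s (inj₂ left) acts r<s | no _ | yes ≡.refl = inj₁ (<-≤-trans (above r r<s left) l≤mn)

    add-max : ∀ c {r} → Valid l (suc r) c → ∃ λ mx → r ≤ mx × add c r ≡ just (mx , r)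
    add-max nothing            _                  = _ , ≤-refl , ≡.refl
    add-max (just (mx , mn)) (r<mn , mn≤mx , _) = mx , ≤-trans (<⇒≤ r<mn) mn≤mx , ≡.refl

    Cell-0 : ∀ r c → Cell r c j h i u l (λ _ → 0#) ≈ 0#
    Cell-0 r c = trans (Cell-cong r c j h i u l (λ _ → sym (zeroˡ 1#))) (trans (Cell-* r c j h i u l 0# (λ _ → 1#)) (zeroˡ _))

    go : ∀ r c ρ → r ≤ n → Valid l r c → Started c r ρ →
         Cell r c j h i u l (E ρ) ≈ Cell r c j h i u l (λ w → value (advance ρ w))
    go zero nothing ρ _ _ _ = refl
    go zero (just (mx , mn)) ρ _ (_ , mn≤mx , l≤mn) (_ , mn≤u , lt) =
      ih (suc i) (u [ i ≔ mn ]) (suc mx) ρ (shift i h i+h) (RowsAbove-suc above mn≤mx l≤mn) (Increasing-suc l≤mn mn≤u)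
        λ { m ≡.refl _ → lt }
    go (suc r) c ρ r<n v st = +-cong (go r c ρ (<⇒≤ r<n) (Valid-skip c v) (Started-skip c st))
      (⟦⟧-cong (allowed? l (u i) r) λ al → take al (step? ρ r))
      where
      take : Allowed l (u i) r → (d : Dec (∃ λ σ → ρ ⟶[ r ] σ)) →
             Cell r (add c r) j h i u l (λ w → E ρ (r ∷ w)) ≈ Cell r (add c r) j h i u l (λ w → value (advance-by ρ r d w))
      take (l≤r , r≤u) (yes (σ , s)) = trans
        (Cell-cong r (add c r) j h i u l λ w → Alt-cong n zs λ ys p →
          trans (solve 3 (λ x y z → x ⊗ (y ⊗ z) ⊜ (y ⊗ x) ⊗ z) refl _ _ _)
            (*-congʳ (sym (W-suc ys r (≡.subst (r <_) (≡.sym (length-n p)) r<n) (step-here {ρ} {r} {σ} s) (step-there {ρ} {r} {σ} s)))))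
        (go r (add c r) σ (<⇒≤ r<n) (Valid-add c v l≤r) (Started-add c {r} {ρ} {σ} s r≤u v st))
      take (l≤r , r≤u) (no ¬s) with ¬step ρ r ¬s
      ... | k , ≡.refl , e with add-max c v
      ...   | mx , k<mx , add≡ = trans
              (≡.subst (λ c′ → Cell (suc k) c′ j h i u l (λ w → E ρ (suc k ∷ w)) ≈ 0#) (≡.sym add≡)
                (Violation.vanishes j h i u l k i+h above inc r<n l≤k r≤u mx k<mx ρ e))
              (sym (Cell-0 (suc k) (add c (suc k))))
              where
              l≤k : l ≤ k
              l≤k with l ℕ.≟ suc k
              -- A failing letter k + 1 means equal rows k and k + 1, which `Strict` rules out for l
              -- = k + 1. Hence k is allowed too, as `Violation` requires.
              ... | yes l≡k+1 = ⊥-elim (<⇒≢ (Started-strict c st k l≡k+1 (n<1+n _)) e)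
              ... | no  l≢k+1 = ℕ.≤-pred (≤∧≢⇒< l≤r l≢k+1)

  cancels : ∀ j h → Cancels j h
  cancels zero zero i u l ρ i+h above inc st = Alt-cong n zs λ ys _ → *-identityʳ _
  cancels (suc j) zero i u l ρ i+h above inc st =
    cancels j (b j ∸ a j) (a j) u 0 ρ (height j) (λ r r<a left → ⊥-elim (¬above j r<a left))
      (λ r s actr acts → inc r s (Active-next j actr) (Active-next j acts)) λ m ()
  cancels j (suc h) i u l ρ i+h above inc st =
    CancelCell.go j h i u l i+h above inc (cancels j h) n nothing ρ ≤-refl tt st

-- Straight shapes

module TooLong {c ℓ₁} (R : CommutativeRing c ℓ₁) (n : ℕ) (a b : ℕ → ℕ) where
  open CommutativeRing R hiding (zero)
  open Words R n a b

  ⟦⟧-0 : ∀ {lev} {P : Set lev} (d : Dec P) → ⟦ d ⟧ 0# ≈ 0#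
  ⟦⟧-0 (yes _) = refl
  ⟦⟧-0 (no  _) = refl

  Next-vanishes⇒Col-vanishes : ∀ j → (∀ u f → Next j u f ≈ 0#) → ∀ h i u l f → Col j h i u l f ≈ 0#
  Next-vanishes⇒Col-vanishes j e zero    i u l f = e u f
  Next-vanishes⇒Col-vanishes j e (suc h) i u l f = cell n nothing f
    where
    cell : ∀ r c f → Cell r c j h i u l f ≈ 0#
    cell zero nothing f = refl
    cell zero (just (mx , mn)) f = Next-vanishes⇒Col-vanishes j e h (suc i) _ _ f
    cell (suc r) c f = trans (+-cong (cell r c f)
      (trans (⟦⟧-cong (allowed? l (u i) r) λ _ → cell r _ _) (⟦⟧-0 (allowed? l (u i) r)))) (+-identityʳ 0#)

  -- Each box raises the lower bound by at least one, so h boxes need h different letters between l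
  -- and n - 1.
  Col-vanishes : ∀ j h i u l f → l ≤ n → n < l ℕ.+ h → Col j h i u l f ≈ 0#
  Col-vanishes j zero    i u l f l≤n n<l = ⊥-elim (<⇒≱ n<l (≡.subst (_≤ n) (≡.sym (ℕ.+-identityʳ l)) l≤n))
  Col-vanishes j (suc h) i u l f l≤n n<l = cell n nothing f ≤-refl tt
    where
    Fits : ℕ → Cur → Set
    Fits r nothing          = ⊤
    Fits r (just (mx , _)) = l ≤ mx × mx < n
    Fits-add : ∀ c {r} → l ≤ r → r < n → Fits (suc r) c → Fits r (add c r)
    Fits-add nothing  l≤r r<n _ = l≤r , r<n
    Fits-add (just _) _   _   p = p
    Fits-skip : ∀ c {r} → Fits (suc r) c → Fits r c
    Fits-skip nothing  p = p
    Fits-skip (just _) p = p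
    cell : ∀ r c f → r ≤ n → Fits r c → Cell r c j h i u l f ≈ 0#
    cell zero nothing f _ _ = refl
    cell zero (just (mx , mn)) f _ (l≤mx , mx<n) = Col-vanishes j h (suc i) _ (suc mx) f mx<n
      (<-≤-trans n<l (≤-trans (≤-reflexive (ℕ.+-suc l h)) (s≤s (ℕ.+-monoˡ-≤ h l≤mx))))
    cell (suc r) c f r<n p = trans (+-cong (cell r c f (<⇒≤ r<n) (Fits-skip c p))
      (trans (⟦⟧-cong (allowed? l (u i) r) λ (l≤r , _) → cell r _ _ (<⇒≤ r<n) (Fits-add c l≤r r<n p)) (⟦⟧-0 (allowed? l (u i) r)))) (+-identityʳ 0#)

  Next-vanishes : ∀ j u f → n < b 0 ∸ a 0 → Next (suc j) u f ≈ 0#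
  Next-vanishes zero    u f lt = Col-vanishes 0 (b 0 ∸ a 0) (a 0) u 0 f z≤n lt
  Next-vanishes (suc j) u f lt = Next-vanishes⇒Col-vanishes (suc j) (λ u f → Next-vanishes j u f lt) (b (suc j) ∸ a (suc j)) (a (suc j)) u 0 f

-- For a straight shape and μ = ∅ the only filling that survives has {i} in
-- every box of row i.
module HighestWeight {c ℓ₁} (R : CommutativeRing c ℓ₁) (n : ℕ) (a b : ℕ → ℕ) (a≡0 : ∀ j → a j ≡ 0)
  (zs : List (CommutativeRing.Carrier R)) (zs-length : length zs ≡ n)
  (κ : Partition) (κ≤n : ℓ κ ≤ n)
  (b-sound : ∀ j s → s < b j → j < rowLength κ s) (b-complete : ∀ j s → j < rowLength κ s → s < b j) where
  open CommutativeRing R hiding (zero)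
  open Words R n a b
  open Alternants R
  open Values R n zs

  private
    row = rowLength κ

    row-short : ∀ j s → b j ≤ s → row s ≤ j
    row-short j s b≤s = ≮⇒≥ λ lt → <⇒≱ (b-complete j s lt) b≤s

    b≤n : ∀ j → b j ≤ n
    b≤n j = ≮⇒≥ λ n<b → <⇒≱ (b-sound j n n<b)
      (≡.subst (_≤ j) (≡.sym (≡.trans (rowLength-part κ n) (part-zero (parts κ) n κ≤n))) z≤n)

  -- The state with column `j` filled down to row i - 1, row s holding {s}. A row from `i` on either
  -- has bound s from its box in column j + 1, or has no box to the right of column `j` and is
  -- unrestricted.
  Tight : ℕ → ℕ → (ℕ → ℕ) → Set
  Tight j i u = (∀ s → s < i → u s ≡ s) × (∀ s → i ≤ s → u s ≡ s ⊎ (row s ≤ suc j × n ≤ u s))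

  Reached : ℕ → ℕ → Partition → Set
  Reached j i ρ = (∀ s → s < i → rowLength ρ s ≡ row s ∸ j) × (∀ s → i ≤ s → rowLength ρ s ≡ row s ∸ suc j)

  module Row (j h i : ℕ) (u : ℕ → ℕ) (ρ : Partition) (i+h : i ℕ.+ suc h ≡ b j)
    (tight : Tight j i u) (reached : Reached j i ρ) where

    f : List ℕ → Carrier
    f w = value (advance ρ w)

    i<b : i < b j
    i<b = ≡.subst (i <_) i+h (ℕ.m<m+n i (s≤s z≤n))

    i<n : i < n
    i<n = <-≤-trans i<b (b≤n j)

    i≤u : i ≤ u i
    i≤u with proj₂ tight i ≤-refl
    ... | inj₁ e        = ≤-reflexive (≡.sym e)
    ... | inj₂ (_ , le) = <⇒≤ (<-≤-trans i<n le)

    row-anti : ∀ d → row (d ℕ.+ i) ≤ row i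
    row-anti zero    = ≤-refl
    row-anti (suc d) = ≤-trans (rowLength-anti κ (d ℕ.+ i)) (row-anti d)

    blocked : ∀ d → row i ≤ suc j → ¬ (∃ λ σ → ρ ⟶[ suc d ℕ.+ i ] σ)
    blocked d short (σ , s) = <⇒≱ (s≤s z≤n) (≤-trans (≤-reflexive (≡.sym (step-here {ρ} {_} {σ} s)))
      (≤-trans (rowLength-anti σ (d ℕ.+ i)) (≤-reflexive (≡.trans (step-there {ρ} {_} {σ} s (d ℕ.+ i) (<⇒≢ ≤-refl))
        (≡.trans (proj₂ reached (d ℕ.+ i) (m≤n+m i d)) (m≤n⇒m∸n≡0 (≤-trans (row-anti d) short)))))))

    Cell-0 : ∀ r c → Cell r c j h i u i (λ _ → 0#) ≈ 0#
    Cell-0 r c = trans (Cell-cong r c j h i u i (λ _ → sym (zeroˡ 1#))) (trans (Cell-* r c j h i u i 0# (λ _ → 1#)) (zeroˡ _))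

    -- A letter above i either exceeds the bound i, or row i has no box to the right of column `j`.
    -- In the second case all rows of ρ from i on are empty, so nothing can be added below row i.
    large : ∀ d → Cell (d ℕ.+ suc i) nothing j h i u i f ≈ Cell (suc i) nothing j h i u i f
    large zero = refl
    large (suc d) = trans (+-cong (large d) (drop (allowed? i (u i) (d ℕ.+ suc i)))) (+-identityʳ _)
      where
      r = d ℕ.+ suc i
      drop : (al : Dec (Allowed i (u i) r)) → ⟦ al ⟧ (Cell r (just (r , r)) j h i u i (λ w → f (r ∷ w))) ≈ 0#
      drop (no _) = refl
      drop (yes (_ , r≤u)) = trans (Cell-cong r (just (r , r)) j h i u i λ w → fails w (step? ρ r)) (Cell-0 r _)
        where
        short : row i ≤ suc j
        short with proj₂ tight i ≤-refl
        ... | inj₁ e = ⊥-elim (<⇒≱ (m≤n+m (suc i) d) (≤-trans r≤u (≤-reflexive e)))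
        ... | inj₂ (le , _) = le
        fails : ∀ w (d′ : Dec (∃ λ σ → ρ ⟶[ r ] σ)) → value (advance-by ρ r d′ w) ≈ 0#
        fails w (no _)  = refl
        fails w (yes s) = ⊥-elim (blocked d short (≡.subst (λ r → ∃ λ σ → ρ ⟶[ r ] σ) (ℕ.+-suc d i) s))

    grows : ∃ λ σ → ρ ⟶[ i ] σ
    grows with step? ρ i
    ... | yes s = s
    ... | no ¬s with ¬step ρ i ¬s
    -- Row i - 1 already has its box of column `j` and row i does not, so their lengths in ρ differ.
    ...   | k , ≡.refl , e = ⊥-elim (<⇒≢ (≤-trans
              (≤-reflexive (≡.sym (ℕ.+-∸-assoc 1 (b-sound j i i<b))))
              (ℕ.∸-monoˡ-≤ j (rowLength-anti κ k)))
              (≡.trans (≡.sym (proj₂ reached i ≤-refl)) (≡.trans e (proj₁ reached k ≤-refl))))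

    by-step : (d : Dec (∃ λ σ → ρ ⟶[ i ] σ)) → ∃ λ σ → ρ ⟶[ i ] σ × (∀ w → advance-by ρ i d w ≡ advance σ w)
    by-step (yes (σ , s)) = σ , s , λ _ → ≡.refl
    by-step (no ¬s)       = ⊥-elim (¬s grows)

    only : ∃ λ σ → Reached j (suc i) σ × Tight j (suc i) (u [ i ≔ i ])
           × Cell n nothing j h i u i f ≈ Col j h (suc i) (u [ i ≔ i ]) (suc i) (λ w → value (advance σ w))
    only with by-step (step? ρ i)
    ... | σ , added , e = σ , (lower , upper) , (below , above) , (begin
        Cell n nothing j h i u i f
          ≈⟨ reflexive (≡.cong (λ r → Cell r nothing j h i u i f) (≡.sym (m∸n+n≡m i<n))) ⟩
        Cell (n ∸ suc i ℕ.+ suc i) nothing j h i u i f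
          ≈⟨ large (n ∸ suc i) ⟩
        Cell (suc i) nothing j h i u i f
          ≈⟨ Cell-take i nothing j h i u i f (≤-refl , i≤u) ⟩
        Cell i nothing j h i u i f + Cell i (just (i , i)) j h i u i (λ w → f (i ∷ w))
          ≈⟨ +-cong (Cell-none i nothing j h i u i f small) (Cell-none i (just (i , i)) j h i u i _ small) ⟩
        0# + Col j h (suc i) (u [ i ≔ i ]) (suc i) (λ w → f (i ∷ w))
          ≈⟨ +-identityˡ _ ⟩
        Col j h (suc i) (u [ i ≔ i ]) (suc i) (λ w → f (i ∷ w))
          ≈⟨ Col-cong j h (suc i) _ _ (λ w → reflexive (≡.cong value (e w))) ⟩
        Col j h (suc i) (u [ i ≔ i ]) (suc i) (λ w → value (advance σ w)) ∎)
      where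
      open import Relation.Binary.Reasoning.Setoid setoid
      small : ∀ s → s < i → ¬ Allowed i (u i) s
      small s s<i (i≤s , _) = <⇒≱ s<i i≤s
      lower : ∀ s → s < suc i → rowLength σ s ≡ row s ∸ j
      lower s (s≤s s≤i) with s ℕ.≟ i
      ... | yes ≡.refl = ≡.trans (step-here {ρ} {_} {σ} added) (≡.trans (≡.cong suc (proj₂ reached i ≤-refl)) (≡.sym (ℕ.+-∸-assoc 1 (b-sound j i i<b))))
      ... | no s≢i = ≡.trans (step-there {ρ} {_} {σ} added _ s≢i) (proj₁ reached _ (≤∧≢⇒< s≤i s≢i))
      upper : ∀ s → suc i ≤ s → rowLength σ s ≡ row s ∸ suc j
      upper t i<t = ≡.trans (step-there {ρ} {_} {σ} added t (>⇒≢ i<t)) (proj₂ reached t (<⇒≤ i<t))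
      below : ∀ s → s < suc i → (u [ i ≔ i ]) s ≡ s
      below s (s≤s s≤i) with s ℕ.≟ i
      ... | yes ≡.refl = ≡.refl
      ... | no s≢i = proj₁ tight s (≤∧≢⇒< s≤i s≢i)
      above : ∀ s → suc i ≤ s → (u [ i ≔ i ]) s ≡ s ⊎ (row s ≤ suc j × n ≤ (u [ i ≔ i ]) s)
      above s i<s rewrite ≔-there u i i (>⇒≢ i<s) = proj₂ tight s (<⇒≤ i<s)

  highest : ∀ j h i u ρ → i ℕ.+ h ≡ b j → Tight j i u → Reached j i ρ →
            Col j h i u i (λ w → value (advance ρ w)) ≈ A κ
  highest zero zero i u ρ i+h tight (lower , upper) = Alt-cong n zs λ ys _ → W-ext ys λ s _ → agree s
    where
    agree : ∀ s → rowLength ρ s ≡ row s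
    agree s with s ℕ.<? i
    ... | yes s<i = lower s s<i
    ... | no  s≮i = ≡.trans (upper s (≮⇒≥ s≮i)) (≡.trans (≡.cong (_∸ 1) e) (≡.sym e))
      where
      e : row s ≡ 0
      e = ℕ.n≤0⇒n≡0 (row-short 0 s (≡.subst (_≤ s) (≡.trans (≡.sym (ℕ.+-identityʳ i)) i+h) (≮⇒≥ s≮i)))
  highest (suc j) zero i u ρ i+h (below , above) (lower , upper) rewrite a≡0 j =
    highest j (b j) 0 u ρ ≡.refl ((λ s ()) , λ s _ → tight s) ((λ s ()) , λ s _ → agree s)
    where
    beyond : ∀ s → ¬ s < i → row s ≤ suc j
    beyond s s≮i = row-short (suc j) s (≡.subst (_≤ s) (≡.trans (≡.sym (ℕ.+-identityʳ i)) i+h) (≮⇒≥ s≮i))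
    tight : ∀ s → u s ≡ s ⊎ (row s ≤ suc j × n ≤ u s)
    tight s with s ℕ.<? i
    ... | yes s<i = inj₁ (below s s<i)
    ... | no  s≮i with above s (≮⇒≥ s≮i)
    ...   | inj₁ e = inj₁ e
    ...   | inj₂ (_ , le) = inj₂ (beyond s s≮i , le)
    agree : ∀ s → rowLength ρ s ≡ row s ∸ suc j
    agree s with s ℕ.<? i
    ... | yes s<i = lower s s<i
    ... | no  s≮i = ≡.trans (upper s (≮⇒≥ s≮i)) (≡.trans (m≤n⇒m∸n≡0 (≤-trans (beyond s s≮i) (n≤1+n _))) (≡.sym (m≤n⇒m∸n≡0 (beyond s s≮i))))
  highest j (suc h) i u ρ i+h tight reached with Row.only j h i u ρ i+h tight reached
  ... | σ , reached′ , tight′ , e = trans e (highest j h (suc i) (u [ i ≔ i ]) σ (shift i h i+h) tight′ reached′)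

-- Linear independence of the alternants

module Cancellability {c ℓ₁} (R : CommutativeRing c ℓ₁) where
  open CommutativeRing R hiding (zero)

  -- The constructive substitute for being nonzero: it needs no test of equality and is what
  -- division by an alternant uses.
  Cancellable : Carrier → Set _
  Cancellable x = ∀ y → x * y ≈ 0# → y ≈ 0#

  Cancellable-1 : Cancellable 1#
  Cancellable-1 y e = trans (sym (*-identityˡ y)) e

  Cancellable-* : ∀ {x y} → Cancellable x → Cancellable y → Cancellable (x * y)
  Cancellable-* cx cy z e = cy z (cx _ (trans (sym (*-assoc _ _ _)) e))

  Cancellable-≈ : ∀ {x y} → x ≈ y → Cancellable x → Cancellable y
  Cancellable-≈ x≈y cx z e = cx z (trans (*-congʳ x≈y) e)

  open Alternants R using (prod)

  Cancellable-prod : ∀ {zs} → All Cancellable zs → Cancellable (prod zs)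
  Cancellable-prod []       = Cancellable-1
  Cancellable-prod (c ∷ cs) = Cancellable-* c (Cancellable-prod cs)

open Cancellability using (Cancellable; Cancellable-*; Cancellable-≈; Cancellable-1; Cancellable-prod)

module Constants {c ℓ₁} (R : CommutativeRing c ℓ₁) where
  open CommutativeRing R hiding (zero)
  open Polynomials R
  private module P = CommutativeRing (R [X])
  open RingProperties ring using (-0#≈0#)

  -- The coefficients of the other factor are forced to vanish one after another, from the lowest
  -- upwards.
  Cancellable-constant-term : ∀ p → Cancellable R (coeff p 0) → Cancellable (R [X]) p
  Cancellable-constant-term p cp []      e = P.refl
  Cancellable-constant-term p cp (b ∷ q) e = coeffwise λ { zero → b≈0 ; (suc k) → at (Cancellable-constant-term p cp q pq≈0) k }
    where
    first : ∀ p → coeff (p *ₚ (b ∷ q)) 0 ≈ coeff p 0 * b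
    first []      = sym (zeroˡ b)
    first (a ∷ p) = coeff-*-zero a p (b ∷ q)
    b≈0 : b ≈ 0#
    b≈0 = cp b (trans (sym (first p)) (at e 0))
    pq≈0 : p *ₚ q ≈ₚ []
    pq≈0 = coeffwise λ k → trans (sym (trans (+-congʳ (trans (*-congˡ b≈0) (zeroʳ _))) (+-identityˡ _)))
      (trans (sym (coeff-*ʳ-suc p b q k)) (at e (suc k)))

  coeff-constant-* : ∀ a q k → coeff (constant a *ₚ q) k ≈ a * coeff q k
  coeff-constant-* a q zero    = coeff-*-zero a [] q
  coeff-constant-* a q (suc k) = trans (coeff-*-suc a [] q k) (+-identityʳ _)

  Cancellable-constant : ∀ {a} → Cancellable R a → Cancellable (R [X]) (constant a)
  Cancellable-constant {a} ca q e = coeffwise λ k → ca _ (trans (sym (coeff-constant-* a q k)) (at e k))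

  Cancellable-X : Cancellable (R [X]) X
  Cancellable-X q e = coeffwise λ k → trans (sym (*-identityˡ _)) (trans (sym (coeff-constant-* 1# q k))
    (trans (sym (trans (coeff-*-suc 0# (1# ∷ []) q k) (trans (+-congʳ (zeroˡ _)) (+-identityˡ _)))) (at e (suc k))))

  constant-cong : ∀ {a b} → a ≈ b → constant a ≈ₚ constant b
  constant-cong e = coeffwise λ { zero → e ; (suc k) → refl }

  constant-0 : constant 0# ≈ₚ []
  constant-0 = coeffwise λ { zero → refl ; (suc k) → refl }

  constant-* : ∀ a b → constant (a * b) ≈ₚ constant a *ₚ constant b
  constant-* a b = P.sym (coeffwise λ { zero → coeff-constant-* a (constant b) zero ; (suc k) → trans (coeff-constant-* a (constant b) (suc k)) (zeroʳ a) })

  coeff₀-neg : ∀ p → coeff (-ₚ p) 0 ≈ - coeff p 0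
  coeff₀-neg []      = sym -0#≈0#
  coeff₀-neg (a ∷ p) = refl

  coeff₀-* : ∀ p q → coeff (p *ₚ q) 0 ≈ coeff p 0 * coeff q 0
  coeff₀-* []      q = sym (zeroˡ _)
  coeff₀-* (a ∷ p) q = coeff-*-zero a p q

module AltHom {c c′ ℓ₁ ℓ₂} (R : CommutativeRing c ℓ₁) (S : CommutativeRing c′ ℓ₂) where
  private
    module R = CommutativeRing R
    module S = CommutativeRing S
    module AR = Alternants R
    module AS = Alternants S

  module _ (φ : R.Carrier → S.Carrier) (φ-+ : ∀ x y → φ (x R.+ y) S.≈ φ x S.+ φ y)
    (φ-neg : ∀ x → φ (R.- x) S.≈ S.- φ x) (φ-0 : φ R.0# S.≈ S.0#) where

    _~_ : R.Carrier → S.Carrier → Set _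
    x ~ y = φ x S.≈ y

    Remove-hom : ∀ {zs zs′ ψ ψ′} → Pointwise _~_ zs zs′ →
                 (∀ {y y′ ys ys′} → y ~ y′ → Pointwise _~_ ys ys′ → ψ y ys ~ ψ′ y′ ys′) →
                 AR.Remove zs ψ ~ AS.Remove zs′ ψ′
    Remove-hom []       e = φ-0
    Remove-hom (z ∷ zs) e = S.trans (φ-+ _ _) (S.+-cong (e z zs)
      (S.trans (φ-neg _) (S.-‿cong (Remove-hom zs λ y ys → e y (z ∷ ys)))))

    Alt-hom : ∀ m {zs zs′ f g} → Pointwise _~_ zs zs′ → (∀ {ys ys′} → Pointwise _~_ ys ys′ → f ys ~ g ys′) →
              AR.Alt m zs f ~ AS.Alt m zs′ g
    Alt-hom zero    zs e = e zs
    Alt-hom (suc m) zs e = Remove-hom zs λ y ys → Alt-hom m ys λ ws → e (y ∷ ws)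

-- Alternants in terms of the numbers of columns of each length

module Differences {c ℓ₁} (R : CommutativeRing c ℓ₁) where
  open CommutativeRing R hiding (zero)
  open Alternants R
  open Exp commutativeSemiring

  -- W in terms of the successive differences of the parts, the smallest
  -- part first.
  V : ∀ {m} → Vec ℕ m → List Carrier → Carrier
  V (d ∷ ds) (y ∷ ys) = prod (y ∷ ys) ^ d * ((1# + y) ^ length ys * (prod ys * V ds ys))
  V _        _        = 1#

  1^ : ∀ c → 1# ^ c ≈ 1#
  1^ zero    = refl
  1^ (suc c) = trans (*-identityˡ _) (1^ c)

open Differences using (V)

-- For a partition with at most n rows and c = 0, m = n, the entries are the numbers of columns of
-- lengths n, n - 1, ..., 1.
differences : (ℕ → ℕ) → ℕ → ∀ m → Vec ℕ m
differences γ c zero    = []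
differences γ c (suc m) = γ m ∸ c ∷ differences γ (γ m) m

module _ {c ℓ₁} (R : CommutativeRing c ℓ₁) where
  open CommutativeRing R hiding (zero)
  open Alternants R
  open Exp commutativeSemiring
  open Differences R using (1^)
  open Solver commutativeSemiring using (solve)
    renaming (_:=_ to infix 4 _⊜_; _:+_ to infixl 6 _⊕_; _:*_ to infixl 7 _⊗_)

  W-V : ∀ {γ} → (∀ i → γ (suc i) ≤ γ i) → ∀ ys e → (∀ m → length ys ≡ suc m → e ≤ γ m) →
        W γ ys ≈ prod ys ^ e * V R (differences γ e (length ys)) ys
  W-V anti []       e le = sym (trans (*-identityʳ _) (1^ e))
  W-V {γ} anti (y ∷ ys) e le = begin
    (y ^ g * (1# + y) ^ m) * (prod ys * W γ ys)
      ≈⟨ *-congˡ (*-congˡ (W-V anti ys g λ { m e → ≡.subst (λ l → γ l ≤ γ m) (≡.sym e) (anti m) })) ⟩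
    (y ^ g * (1# + y) ^ m) * (prod ys * (prod ys ^ g * v))
      ≈⟨ solve 5 (λ yg b p pg v → (yg ⊗ b) ⊗ (p ⊗ (pg ⊗ v)) ⊜ (yg ⊗ pg) ⊗ (b ⊗ (p ⊗ v))) refl _ _ _ _ _ ⟩
    (y ^ g * prod ys ^ g) * ((1# + y) ^ m * (prod ys * v))
      ≈⟨ *-congʳ (sym (^-distrib-* y (prod ys) g)) ⟩
    prod (y ∷ ys) ^ g * ((1# + y) ^ m * (prod ys * v))
      ≈⟨ *-congʳ (trans (reflexive (≡.cong (prod (y ∷ ys) ^_) (≡.sym (ℕ.m+[n∸m]≡n (le m ≡.refl))))) (^-homo-* (prod (y ∷ ys)) e (g ∸ e))) ⟩
    (prod (y ∷ ys) ^ e * prod (y ∷ ys) ^ (g ∸ e)) * ((1# + y) ^ m * (prod ys * v))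
      ≈⟨ *-assoc _ _ _ ⟩
    prod (y ∷ ys) ^ e * (prod (y ∷ ys) ^ (g ∸ e) * ((1# + y) ^ m * (prod ys * v))) ∎
    where
    open import Relation.Binary.Reasoning.Setoid setoid
    m = length ys
    g = γ m
    v = V R (differences γ g m) ys

module _ {c ℓ₁} (R : CommutativeRing c ℓ₁) where
  open CommutativeRing R hiding (zero)
  open Alternants R
  open Exp commutativeSemiring

  prod-↭ : ∀ {xs ys} → xs ↭ ys → prod xs ≈ prod ys
  prod-↭ {xs} p = Swappable⇒↭ (length xs) {prod} (λ as x y bs _ → prod-swap as x y bs) p [] ≡.refl

  Alt-V-suc : ∀ {m} zs → length zs ≡ suc m → ∀ d (ds : Vec ℕ m) →
              Alt (suc m) zs (V R (suc d ∷ ds)) ≈ prod zs * Alt (suc m) zs (V R (d ∷ ds))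
  Alt-V-suc {m} zs len d ds = trans (Alt-cong (suc m) zs factor) (Alt-* (suc m) zs (prod zs) (V R (d ∷ ds)))
    where
    factor : ∀ ys → ys ↭ zs → V R (suc d ∷ ds) ys ≈ prod zs * V R (d ∷ ds) ys
    factor [] p with () ← ≡.trans (↭-length p) len
    factor (y ∷ ys) p = trans (*-assoc _ _ _) (*-congʳ (prod-↭ p))

  -- Every variable but the first of an arrangement divides `V`, so only the arrangements that begin
  -- with the variable 0 survive.
  Alt-V-0 : ∀ {m} zs (ds : Vec ℕ m) → Alt (suc m) (0# ∷ zs) (V R (0 ∷ ds)) ≈ prod zs * Alt m zs (V R ds)
  Alt-V-0 {m} zs ds = trans (+-cong first (trans (-‿cong rest) -0#≈0#)) (+-identityʳ _)
    where
    open RingProperties ring using (-0#≈0#)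
    first : Alt m zs (λ ws → V R (0 ∷ ds) (0# ∷ ws)) ≈ prod zs * Alt m zs (V R ds)
    first = trans (Alt-cong m zs λ ws p → trans (*-identityˡ _) (trans (*-congʳ (one (length ws)))
      (trans (*-identityˡ _) (*-congʳ (prod-↭ p))))) (Alt-* m zs _ _)
      where
      one : ∀ m → (1# + 0#) ^ m ≈ 1#
      one zero    = refl
      one (suc m) = trans (*-cong (+-identityʳ 1#) (one m)) (*-identityˡ _)
    rest : Remove zs (λ y ys → Alt m (0# ∷ ys) (λ ws → V R (0 ∷ ds) (y ∷ ws))) ≈ 0#
    rest = trans (Remove-cong zs λ y ys _ → trans (Alt-cong m (0# ∷ ys) λ ws p → trans (*-identityˡ _)
        (trans (*-congˡ (trans (*-congʳ (trans (prod-↭ p) (zeroˡ _))) (zeroˡ _))) (zeroʳ _))) (Alt-0 m (0# ∷ ys))) (Remove-0 zs)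

-- Formal linear combinations

module Collect {c ℓ₁} (R : CommutativeRing c ℓ₁) {n : ℕ} where
  open CommutativeRing R hiding (zero)

  Terms : Set c
  Terms = List (Carrier × Vec ℕ n)

  _≟ᵥ_ : (ds es : Vec ℕ n) → Dec (ds ≡ es)
  _≟ᵥ_ = Vec.≡-dec ℕ._≟_

  collect : Vec ℕ n → Terms → Carrier
  collect ds [] = 0#
  collect ds ((a , es) ∷ L) with es ≟ᵥ ds
  ... | yes _ = a + collect ds L
  ... | no  _ = collect ds L

  remove : Vec ℕ n → Terms → Terms
  remove ds [] = []
  remove ds ((a , es) ∷ L) with es ≟ᵥ ds
  ... | yes _ = remove ds L
  ... | no  _ = (a , es) ∷ remove ds L

  remove-length : ∀ ds L → length (remove ds L) ≤ length L
  remove-length ds [] = z≤n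
  remove-length ds ((a , es) ∷ L) with es ≟ᵥ ds
  ... | yes _ = ℕ.m≤n⇒m≤1+n (remove-length ds L)
  ... | no  _ = s≤s (remove-length ds L)

  collect-remove : ∀ ds es L → collect es L ≈ 0# → collect es (remove ds L) ≈ 0#
  collect-remove ds es L e with ds ≟ᵥ es
  ... | yes ≡.refl = gone L
    where
    gone : ∀ L → collect ds (remove ds L) ≈ 0#
    gone [] = refl
    gone ((a , fs) ∷ L) with fs ≟ᵥ ds
    ... | yes _ = gone L
    ... | no fs≢ds with fs ≟ᵥ ds
    ...   | yes fs≡ds = ⊥-elim (fs≢ds fs≡ds)
    ...   | no _ = gone L
  ... | no ds≢es = trans (stays L) e
    where
    stays : ∀ L → collect es (remove ds L) ≈ collect es L
    stays [] = refl
    stays ((a , fs) ∷ L) with fs ≟ᵥ ds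
    stays ((a , fs) ∷ L) | yes ≡.refl with fs ≟ᵥ es
    ...   | yes fs≡es = ⊥-elim (ds≢es fs≡es)
    ...   | no _ = stays L
    stays ((a , fs) ∷ L) | no _ with fs ≟ᵥ es
    ...   | yes _ = +-congˡ (stays L)
    ...   | no _ = stays L

  module _ {c′ ℓ₂} (M : CommutativeRing c′ ℓ₂) (ι : Carrier → CommutativeRing.Carrier M)
    (ι-cong : ∀ {a b} → a ≈ b → CommutativeRing._≈_ M (ι a) (ι b))
    (ι-0 : CommutativeRing._≈_ M (ι 0#) (CommutativeRing.0# M))
    (ι-+ : ∀ a b → CommutativeRing._≈_ M (ι (a + b)) (CommutativeRing._+_ M (ι a) (ι b))) where
    private module M = CommutativeRing M
    open Solver M.commutativeSemiring using (solve)
      renaming (_:=_ to infix 4 _⊜_; _:+_ to infixl 6 _⊕_; _:*_ to infixl 7 _⊗_)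

    evaluate : (Vec ℕ n → M.Carrier) → Terms → M.Carrier
    evaluate g [] = M.0#
    evaluate g ((a , ds) ∷ L) = ι a M.* g ds M.+ evaluate g L

    evaluate-++ : ∀ g L K → evaluate g (L ++ K) M.≈ evaluate g L M.+ evaluate g K
    evaluate-++ g [] K = M.sym (M.+-identityˡ _)
    evaluate-++ g (_ ∷ L) K = M.trans (M.+-congˡ (evaluate-++ g L K)) (M.sym (M.+-assoc _ _ _))

    split : ∀ g ds L → evaluate g L M.≈ ι (collect ds L) M.* g ds M.+ evaluate g (remove ds L)
    split g ds [] = M.sym (M.trans (M.+-identityʳ _) (M.trans (M.*-congʳ ι-0) (M.zeroˡ _)))
    split g ds ((a , es) ∷ L) with es ≟ᵥ ds
    ... | yes ≡.refl = M.trans (M.+-congˡ (split g ds L)) (M.trans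
          (solve 4 (λ a c g r → a ⊗ g ⊕ (c ⊗ g ⊕ r) ⊜ (a ⊕ c) ⊗ g ⊕ r) M.refl _ _ _ _)
          (M.+-congʳ (M.*-congʳ (M.sym (ι-+ a (collect ds L))))))
    ... | no _ = M.trans (M.+-congˡ (split g ds L)) (solve 3 (λ a c r → a ⊕ (c ⊕ r) ⊜ c ⊕ (a ⊕ r)) M.refl _ _ _)

    -- Single coefficients need not vanish, only their totals. So all terms with the index of the
    -- head are split off together, and the recursion runs on a bound for the length of the rest.
    evaluate-vanishes : ∀ g L → (∀ ds → collect ds L ≈ 0#) → evaluate g L M.≈ M.0#
    evaluate-vanishes g L = go (length L) L ≤-refl
      where
      go : ∀ m L → length L ≤ m → (∀ ds → collect ds L ≈ 0#) → evaluate g L M.≈ M.0#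
      go m [] _ _ = M.refl
      go (suc m) L@((a , ds) ∷ K) (s≤s le) e = M.trans (split g ds L)
        (M.trans (M.+-cong (M.trans (M.*-congʳ (M.trans (ι-cong (e ds)) ι-0)) (M.zeroˡ _))
          (go m (remove ds L) (shorter (ds ≟ᵥ ds)) (λ es → collect-remove ds es L (e es)))) (M.+-identityˡ _))
        where
        shorter : Dec (ds ≡ ds) → length (remove ds L) ≤ m
        shorter _ with ds ≟ᵥ ds
        ... | yes _ = ≤-trans (remove-length ds K) le
        ... | no ¬e = ⊥-elim (¬e ≡.refl)

module Independence {c ℓ₁} (R : CommutativeRing c ℓ₁) (β : CommutativeRing.Carrier R) (β-cancellable : Cancellable R β) where
  private module R = CommutativeRing R

  Rx : ℕ → CommutativeRing c ℓ₁
  Rx n = R [x n ]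

  module _ (n : ℕ) where
    open CommutativeRing (Rx n) public using (Carrier)

  ι : ∀ n → R.Carrier → Carrier n
  ι = scalar R

  zs : ∀ n → List (Carrier n)
  zs zero    = []
  zs (suc n) = Polynomials._*ₚ_ (Rx n) (ι (suc n) β) (Polynomials.X (Rx n)) ∷ map (Polynomials.constant (Rx n)) (zs n)

  zs-length : ∀ n → length (zs n) ≡ n
  zs-length zero    = ≡.refl
  zs-length (suc n) = ≡.cong suc (≡.trans (List.length-map _ (zs n)) (zs-length n))

  ι-cong : ∀ n {a b} → a R.≈ b → CommutativeRing._≈_ (Rx n) (ι n a) (ι n b)
  ι-cong zero    e = e
  ι-cong (suc n) e = Constants.constant-cong (Rx n) (ι-cong n e)

  ι-0 : ∀ n → CommutativeRing._≈_ (Rx n) (ι n R.0#) (CommutativeRing.0# (Rx n))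
  ι-0 zero    = R.refl
  ι-0 (suc n) = CommutativeRing.trans (Rx (suc n)) (Constants.constant-cong (Rx n) (ι-0 n)) (Constants.constant-0 (Rx n))

  ι-1 : ∀ n → CommutativeRing._≈_ (Rx n) (ι n R.1#) (CommutativeRing.1# (Rx n))
  ι-1 zero    = R.refl
  ι-1 (suc n) = Constants.constant-cong (Rx n) (ι-1 n)

  ι-+ : ∀ n a b → CommutativeRing._≈_ (Rx n) (ι n (a R.+ b)) (CommutativeRing._+_ (Rx n) (ι n a) (ι n b))
  ι-+ zero    a b = R.refl
  ι-+ (suc n) a b = Constants.constant-cong (Rx n) (ι-+ n a b)

  ι-* : ∀ n a b → CommutativeRing._≈_ (Rx n) (ι n (a R.* b)) (CommutativeRing._*_ (Rx n) (ι n a) (ι n b))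
  ι-* zero    a b = R.refl
  ι-* (suc n) a b = CommutativeRing.trans (Rx (suc n)) (Constants.constant-cong (Rx n) (ι-* n a b)) (Constants.constant-* (Rx n) (ι n a) (ι n b))

  ι-cancellable : ∀ n → Cancellable (Rx n) (ι n β)
  ι-cancellable zero    = β-cancellable
  ι-cancellable (suc n) = Constants.Cancellable-constant (Rx n) (ι-cancellable n)

  zs-cancellable : ∀ n → All (Cancellable (Rx n)) (zs n)
  zs-cancellable zero    = []
  zs-cancellable (suc n) = Cancellable-* (Rx (suc n)) {ι (suc n) β} {Polynomials.X (Rx n)} (ι-cancellable (suc n)) (Constants.Cancellable-X (Rx n)) ∷ constants (zs-cancellable n)
    where
    constants : ∀ {zs} → All (Cancellable (Rx n)) zs → All (Cancellable (Rx (suc n))) (map (Polynomials.constant (Rx n)) zs)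
    constants []       = []
    constants (c ∷ cs) = Constants.Cancellable-constant (Rx n) c ∷ constants cs

  alternant : ∀ n → Vec ℕ n → Carrier n
  alternant n ds = Alternants.Alt (Rx n) n (zs n) (V (Rx n) ds)

  Π : ∀ n → Carrier n
  Π n = Alternants.prod (Rx n) (zs n)

  Π-cancellable : ∀ n → Cancellable (Rx n) (Π n)
  Π-cancellable n = Cancellable-prod (Rx n) (zs-cancellable n)

  alternant-suc : ∀ n d ds → CommutativeRing._≈_ (Rx (suc n)) (alternant (suc n) (suc d ∷ ds))
                  (CommutativeRing._*_ (Rx (suc n)) (Π (suc n)) (alternant (suc n) (d ∷ ds)))
  alternant-suc n = Alt-V-suc (Rx (suc n)) (zs (suc n)) (zs-length (suc n))

  module _ (n : ℕ) where
    open CommutativeRing (Rx n) hiding (Carrier; zero)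
    open Alternants (Rx n)
    open Polynomials (Rx n) using (coeff; coeff-+; coeff-*-zero; X; constant; at; _*ₚ_; _+ₚ_)
    open Constants (Rx n)

    z₀≈0 : coeff (ι (suc n) β *ₚ X) 0 ≈ 0#
    z₀≈0 = trans (coeff₀-* (ι (suc n) β) X) (zeroʳ _)

    constants~ : ∀ zs → Pointwise (λ p x → coeff p 0 ≈ x) (map constant zs) zs
    constants~ []       = []
    constants~ (z ∷ zs) = refl ∷ constants~ zs

    zs~ : Pointwise (λ p x → coeff p 0 ≈ x) (zs (suc n)) (0# ∷ zs n)
    zs~ = z₀≈0 ∷ constants~ (zs n)

    private module H = AltHom (Rx (suc n)) (Rx n)

    coeff₀-prod : ∀ {xs ys} → Pointwise (λ p x → coeff p 0 ≈ x) xs ys → coeff (Alternants.prod (Rx (suc n)) xs) 0 ≈ prod ys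
    coeff₀-prod []           = refl
    coeff₀-prod {x ∷ xs} (z ∷ zs) = trans (coeff₀-* x (Alternants.prod (Rx (suc n)) xs)) (*-cong z (coeff₀-prod zs))

    coeff₀-^ : ∀ {p x} → coeff p 0 ≈ x → ∀ d → coeff (Exp._^_ (CommutativeRing.commutativeSemiring (Rx (suc n))) p d) 0 ≈ Exp._^_ commutativeSemiring x d
    coeff₀-^ e zero    = refl
    coeff₀-^ {p} e (suc d) = trans (coeff₀-* p (Exp._^_ (CommutativeRing.commutativeSemiring (Rx (suc n))) p d)) (*-cong e (coeff₀-^ e d))

    coeff₀-V : ∀ {m} (ds : Vec ℕ m) {xs ys} → Pointwise (λ p x → coeff p 0 ≈ x) xs ys → coeff (V (Rx (suc n)) ds xs) 0 ≈ V (Rx n) ds ys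
    coeff₀-V []       []       = refl
    coeff₀-V []       (_ ∷ _)  = refl
    coeff₀-V (d ∷ ds) []       = refl
    coeff₀-V (d ∷ ds) {x ∷ xs} {y ∷ ys} (z ∷ zs) = trans (coeff₀-* (_^′_ (Alternants.prod (Rx (suc n)) (x ∷ xs)) d) _) (*-cong (coeff₀-^ (coeff₀-prod {x ∷ xs} {y ∷ ys} (z ∷ zs)) d)
      (trans (coeff₀-* (_^′_ ((constant 1#) +ₚ x) (length xs)) _) (*-cong (trans (coeff₀-^ (trans (coeff-+ (constant 1#) x 0) (+-congˡ z)) (length xs)) (reflexive (≡.cong (Exp._^_ commutativeSemiring (1# + y)) (same-length zs))))
        (trans (coeff₀-* (Alternants.prod (Rx (suc n)) xs) _) (*-cong (coeff₀-prod zs) (coeff₀-V ds zs))))))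
      where
      _^′_ = Exp._^_ (CommutativeRing.commutativeSemiring (Rx (suc n)))
      same-length : ∀ {xs ys} → Pointwise (λ p x → coeff p 0 ≈ x) xs ys → length xs ≡ length ys
      same-length []       = ≡.refl
      same-length (_ ∷ zs) = ≡.cong suc (same-length zs)

    alternant₀ : ∀ ds → coeff (alternant (suc n) (0 ∷ ds)) 0 ≈ Π n * alternant n ds
    alternant₀ ds = trans (H.Alt-hom (λ p → coeff p 0) (λ p q → coeff-+ p q 0) coeff₀-neg refl (suc n) {f = V (Rx (suc n)) (0 ∷ ds)} zs~ (coeff₀-V (0 ∷ ds)))
      (Alt-V-0 (Rx n) (zs n) ds)

    -- A column of length n + 1 contributes the factor `Π (suc n)`, whose constant term in x₁ is 0.
    alternant₊ : ∀ d ds → coeff (alternant (suc n) (suc d ∷ ds)) 0 ≈ 0#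
    alternant₊ d ds = trans (at (alternant-suc n d ds) 0) (trans (coeff₀-* (Π (suc n)) (alternant (suc n) (d ∷ ds)))
      (trans (*-congʳ (trans (coeff₀-prod zs~) (zeroˡ _))) (zeroˡ _)))

  -- At x₁ = 0 the alternant of ∅ becomes that in one variable fewer, times the
  -- product of the variables.
  alternant-cancellable : ∀ n → Cancellable (Rx n) (alternant n (Vec.replicate n 0))
  alternant-cancellable zero    = Cancellable-1 R
  alternant-cancellable (suc n) = Constants.Cancellable-constant-term (Rx n) (alternant (suc n) (Vec.replicate (suc n) 0))
    (Cancellable-≈ (Rx n) (CommutativeRing.sym (Rx n) (alternant₀ n (Vec.replicate n 0)))
      (Cancellable-* (Rx n) (Π-cancellable n) (alternant-cancellable n)))

  eval : ∀ {m} n → (Vec ℕ m → Carrier n) → Collect.Terms R {m} → Carrier n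
  eval n = Collect.evaluate R (Rx n) (ι n) (ι-cong n) (ι-0 n) (ι-+ n)

  eval-vanishes : ∀ {m} n g (L : Collect.Terms R {m}) → (∀ ds → Collect.collect R ds L R.≈ R.0#) →
                  CommutativeRing._≈_ (Rx n) (eval n g L) (CommutativeRing.0# (Rx n))
  eval-vanishes n = Collect.evaluate-vanishes R (Rx n) (ι n) (ι-cong n) (ι-0 n) (ι-+ n)

  zeros : ∀ {n} → Collect.Terms R {suc n} → Collect.Terms R {n}
  zeros []                        = []
  zeros ((a , zero  ∷ ds) ∷ L) = (a , ds) ∷ zeros L
  zeros ((a , suc d ∷ ds) ∷ L) = zeros L

  predecessors : ∀ {n} → Collect.Terms R {suc n} → Collect.Terms R {suc n}
  predecessors []                     = []
  predecessors ((a , zero  ∷ ds) ∷ L) = predecessors L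
  predecessors ((a , suc d ∷ ds) ∷ L) = (a , d ∷ ds) ∷ predecessors L

  Bounded : ∀ {n} → ℕ → Collect.Terms R {suc n} → Set _
  Bounded D = All (λ (_ , ds) → Vec.head ds < D)

  bounded-mono : ∀ {n D E} {L : Collect.Terms R {suc n}} → D ≤ E → Bounded D L → Bounded E L
  bounded-mono le []       = []
  bounded-mono le (p ∷ ps) = <-≤-trans p le ∷ bounded-mono le ps

  bound : ∀ {n} (L : Collect.Terms R {suc n}) → ∃ λ D → Bounded D L
  bound [] = 0 , []
  bound ((a , d ∷ ds) ∷ L) with bound L
  ... | D , p = suc d ℕ.+ D , ℕ.m≤m+n (suc d) D ∷ bounded-mono (m≤n+m D (suc d)) p

  predecessors-bounded : ∀ {n D} (L : Collect.Terms R {suc n}) → Bounded (suc D) L → Bounded D (predecessors L)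
  predecessors-bounded []                     []           = []
  predecessors-bounded ((a , zero  ∷ ds) ∷ L) (_ ∷ ps)     = predecessors-bounded L ps
  predecessors-bounded ((a , suc d ∷ ds) ∷ L) (s≤s p ∷ ps) = p ∷ predecessors-bounded L ps

  collect-zero : ∀ {n} ds (L : Collect.Terms R {suc n}) → Collect.collect R ds (zeros L) R.≈ R.0# → Collect.collect R (0 ∷ ds) L R.≈ R.0#
  collect-zero {n} ds L e = R.trans (same L) e
    where
    open Collect R {n} using (_≟ᵥ_)
    module C = Collect R {suc n}
    same : ∀ L → C.collect (0 ∷ ds) L R.≈ Collect.collect R ds (zeros L)
    same [] = R.refl
    same ((a , d ∷ es) ∷ L) with (d ∷ es) C.≟ᵥ (0 ∷ ds)
    same ((a , zero ∷ es) ∷ L) | yes ≡.refl with es ≟ᵥ ds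
    ... | yes _ = R.+-congˡ (same L)
    ... | no ¬e = ⊥-elim (¬e ≡.refl)
    same ((a , zero ∷ es) ∷ L) | no ¬e with es ≟ᵥ ds
    ... | yes ≡.refl = ⊥-elim (¬e ≡.refl)
    ... | no _ = same L
    same ((a , suc d ∷ es) ∷ L) | no ¬e = same L

  collect-suc : ∀ {n} d ds (L : Collect.Terms R {suc n}) → Collect.collect R (d ∷ ds) (predecessors L) R.≈ R.0# →
                Collect.collect R (suc d ∷ ds) L R.≈ R.0#
  collect-suc {n} d ds L e = R.trans (same L) e
    where
    module C = Collect R {suc n}
    same : ∀ L → C.collect (suc d ∷ ds) L R.≈ C.collect (d ∷ ds) (predecessors L)
    same [] = R.refl
    same ((a , d′ ∷ es) ∷ L) with (d′ ∷ es) C.≟ᵥ (suc d ∷ ds)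
    same ((a , suc d ∷ es) ∷ L) | yes ≡.refl with (d ∷ es) C.≟ᵥ (d ∷ es)
    ... | yes _ = R.+-congˡ (same L)
    ... | no ¬e = ⊥-elim (¬e ≡.refl)
    same ((a , zero ∷ es) ∷ L) | no ¬e = same L
    same ((a , suc d′ ∷ es) ∷ L) | no ¬e with (d′ ∷ es) C.≟ᵥ (d ∷ ds)
    ... | yes ≡.refl = ⊥-elim (¬e ≡.refl)
    ... | no _ = same L

  module _ (n : ℕ) where
    open CommutativeRing (Rx n) hiding (Carrier; zero)
    private module P = CommutativeRing (Rx (suc n))
    open Polynomials (Rx n) using (coeff; coeff-+; at; constant)
    open Constants (Rx n)
    open Solver P.commutativeSemiring using (solve)
      renaming (_:=_ to infix 4 _⊜_; _:+_ to infixl 6 _⊕_; _:*_ to infixl 7 _⊗_)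

    eval₀ : ∀ L → coeff (eval (suc n) (alternant (suc n)) L) 0 ≈ Π n * eval n (alternant n) (zeros L)
    eval₀ [] = sym (zeroʳ _)
    eval₀ ((a , zero ∷ ds) ∷ L) = trans (coeff-+ (ι (suc n) a P.* alternant (suc n) (0 ∷ ds)) (eval (suc n) (alternant (suc n)) L) 0)
      (trans (+-cong (trans (coeff₀-* (ι (suc n) a) (alternant (suc n) (0 ∷ ds))) (trans (*-congˡ (alternant₀ n ds))
        (trans (sym (*-assoc _ _ _)) (trans (*-congʳ (*-comm _ _)) (*-assoc _ _ _))))) (eval₀ L)) (sym (distribˡ _ _ _)))
    eval₀ ((a , suc d ∷ ds) ∷ L) = trans (coeff-+ (ι (suc n) a P.* alternant (suc n) (suc d ∷ ds)) (eval (suc n) (alternant (suc n)) L) 0)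
      (trans (+-cong (trans (coeff₀-* (ι (suc n) a) (alternant (suc n) (suc d ∷ ds))) (trans (*-congˡ (alternant₊ n d ds)) (zeroʳ _))) (eval₀ L)) (+-identityˡ _))

    -- `predecessors` divides by `Π (suc n)` every term that has a column of full length; the terms
    -- of `zeros` are those without one.
    eval-split : ∀ L → eval (suc n) (alternant (suc n)) L P.≈
      eval (suc n) (λ ds → alternant (suc n) (0 ∷ ds)) (zeros L) P.+ Π (suc n) P.* eval (suc n) (alternant (suc n)) (predecessors L)
    eval-split [] = P.sym (P.trans (P.+-identityˡ (Π (suc n) P.* P.0#)) (P.zeroʳ (Π (suc n))))
    eval-split ((a , zero ∷ ds) ∷ L) = P.trans (P.+-congˡ {ι (suc n) a P.* alternant (suc n) (0 ∷ ds)} (eval-split L))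
      (P.sym (P.+-assoc (ι (suc n) a P.* alternant (suc n) (0 ∷ ds)) (eval (suc n) (λ ds → alternant (suc n) (0 ∷ ds)) (zeros L))
        (Π (suc n) P.* eval (suc n) (alternant (suc n)) (predecessors L))))
    eval-split ((a , suc d ∷ ds) ∷ L) = P.trans (P.+-cong {ι (suc n) a P.* alternant (suc n) (suc d ∷ ds)}
        (P.*-congˡ {ι (suc n) a} (alternant-suc n d ds)) (eval-split L))
      (solve 5 (λ a p x z r → a ⊗ (p ⊗ x) ⊕ (z ⊕ p ⊗ r) ⊜ z ⊕ p ⊗ (a ⊗ x ⊕ r)) P.refl
        (ι (suc n) a) (Π (suc n)) (alternant (suc n) (d ∷ ds)) (eval (suc n) (λ ds → alternant (suc n) (0 ∷ ds)) (zeros L)) (eval (suc n) (alternant (suc n)) (predecessors L)))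

  -- At x₁ = 0 only the terms without a column of length n survive, so their
  -- coefficients vanish by induction on n; the other terms are divisible by the
  -- product of the variables.
  independent : ∀ n (L : Collect.Terms R {n}) → CommutativeRing._≈_ (Rx n) (eval n (alternant n) L) (CommutativeRing.0# (Rx n)) →
                ∀ ds → Collect.collect R ds L R.≈ R.0#
  independent zero L e [] = R.trans (R.sym (same L)) e
    where
    same : ∀ L → eval zero (alternant zero) L R.≈ Collect.collect R [] L
    same [] = R.refl
    same ((a , []) ∷ L) = R.+-cong (R.*-identityʳ a) (same L)
  -- `D` exceeds the number of full columns in every term, and each division by `Π (suc n)` lowers
  -- that number by one.
  independent (suc n) L e = let (D , p) = bound L in go D L p e
    where
    open CommutativeRing (Rx n) hiding (Carrier; zero)
    module P = CommutativeRing (Rx (suc n))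
    open Polynomials (Rx n) using (at)
    go : ∀ D L → Bounded D L → eval (suc n) (alternant (suc n)) L P.≈ P.0# → ∀ ds → Collect.collect R ds L R.≈ R.0#
    go zero    []      [] e ds = R.refl
    go (suc D) L       p  e = λ { (zero ∷ ds) → collect-zero ds L (zeros-vanish ds) ; (suc d ∷ ds) → collect-suc d ds L (go D (predecessors L) (predecessors-bounded L p) rest (d ∷ ds)) }
      where
      zeros-vanish : ∀ ds → Collect.collect R ds (zeros L) R.≈ R.0#
      zeros-vanish = independent n (zeros L) (Π-cancellable n _ (trans (sym (eval₀ n L)) (at e 0)))
      rest : eval (suc n) (alternant (suc n)) (predecessors L) P.≈ P.0#
      rest = Π-cancellable (suc n) (eval (suc n) (alternant (suc n)) (predecessors L))
        (P.trans (P.sym (P.+-identityˡ (Π (suc n) P.* eval (suc n) (alternant (suc n)) (predecessors L))))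
        (P.trans (P.+-congʳ {Π (suc n) P.* eval (suc n) (alternant (suc n)) (predecessors L)} (P.sym (eval-vanishes (suc n) (λ ds → alternant (suc n) (0 ∷ ds)) (zeros L) zeros-vanish)))
        (P.trans (P.sym (eval-split n L)) e)))

-- Tableaux as fillings in reading order

-- Counts only the leading parts greater than j; for a weakly decreasing list this is the length of
-- column j.
conjugate : List ℕ → ℕ → ℕ
conjugate []      j = 0
conjugate (m ∷ p) j with j ℕ.<? m
... | yes _ = suc (conjugate p j)
... | no  _ = 0

conjugate-sound : ∀ p {i j} → i < conjugate p j → j < part p i
conjugate-sound (m ∷ p) {i} {j} lt with j ℕ.<? m
conjugate-sound (m ∷ p) {zero}  lt       | yes j<m = j<m
conjugate-sound (m ∷ p) {suc i} (s≤s lt) | yes j<m = conjugate-sound p lt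

conjugate-complete : ∀ {p} → Linked _≥_ p → ∀ {i j} → j < part p i → i < conjugate p j
conjugate-complete {m ∷ p} d {i} {j} lt with j ℕ.<? m
conjugate-complete {m ∷ p} d {zero}  lt | yes _ = s≤s z≤n
conjugate-complete {m ∷ p} d {suc i} lt | yes _ = s≤s (conjugate-complete (Linked.tail d) lt)
conjugate-complete {m ∷ p} d {i} {j} lt | no j≮m = ⊥-elim (j≮m (<-≤-trans lt (first i)))
  where
  first : ∀ i → part (m ∷ p) i ≤ m
  first zero    = ≤-refl
  first (suc i) = ≤-trans (part-anti d i) (first i)

conjugate-length : ∀ p j → conjugate p j ≤ length p
conjugate-length []      j = z≤n
conjugate-length (m ∷ p) j with j ℕ.<? m
... | yes _ = s≤s (conjugate-length p j)
... | no  _ = z≤n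

conjugate-anti : ∀ p j → conjugate p (suc j) ≤ conjugate p j
conjugate-anti [] j = z≤n
conjugate-anti (m ∷ p) j with suc j ℕ.<? m | j ℕ.<? m
... | yes _    | yes _   = s≤s (conjugate-anti p j)
... | yes j+1< | no  j≮m = ⊥-elim (j≮m (<-trans (n<1+n j) j+1<))
... | no  _    | _       = z≤n

module Shape (θ : SkewDiagram) where

  top bottom : ℕ → ℕ
  top    = conjugate (parts (inner θ))
  bottom = conjugate (parts (outer θ))

  below-top : ∀ {i j} → i < top j → j < rowLength (inner θ) i
  below-top {i} lt = ≡.subst (_ <_) (≡.sym (rowLength-part (inner θ) i)) (conjugate-sound (parts (inner θ)) lt)

  above-top : ∀ {i j} → j < rowLength (inner θ) i → i < top j
  above-top {i} lt = conjugate-complete (partition-linked (inner θ)) (≡.subst (_ <_) (rowLength-part (inner θ) i) lt)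

  below-bottom : ∀ {i j} → i < bottom j → j < rowLength (outer θ) i
  below-bottom {i} lt = ≡.subst (_ <_) (≡.sym (rowLength-part (outer θ) i)) (conjugate-sound (parts (outer θ)) lt)

  above-bottom : ∀ {i j} → j < rowLength (outer θ) i → i < bottom j
  above-bottom {i} lt = conjugate-complete (partition-linked (outer θ)) (≡.subst (_ <_) (rowLength-part (outer θ) i) lt)

  top-anti : ∀ j → top (suc j) ≤ top j
  top-anti = conjugate-anti (parts (inner θ))

  bottom-anti : ∀ j → bottom (suc j) ≤ bottom j
  bottom-anti = conjugate-anti (parts (outer θ))

  top≤bottom : ∀ j → top j ≤ bottom j
  top≤bottom j = ≮⇒≥ λ lt → <-irrefl ≡.refl (above-bottom (<-≤-trans (below-top lt) (contained θ (bottom j))))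

  remaining : (j h i : ℕ) → List Box
  columns   : ℕ → List Box
  remaining j zero    i = columns j
  remaining j (suc h) i = (i , j) ∷ remaining j h (suc i)
  columns zero    = []
  columns (suc j) = remaining j (bottom j ∸ top j) (top j)

  run : (i h j : ℕ) → List Box
  run i zero    j = []
  run i (suc h) j = (i , j) ∷ run (suc i) h j

  run-++ : ∀ j h i → run i h j ++ columns j ≡ remaining j h i
  run-++ j zero    i = ≡.refl
  run-++ j (suc h) i = ≡.cong ((i , j) ∷_) (run-++ j h (suc i))

  upTo-run : ∀ m i j → map (λ r → r , j) (List.applyUpTo (i ℕ.+_) m) ≡ run i m j
  upTo-run zero    i j = ≡.refl
  upTo-run (suc m) i j = ≡.cong₂ _∷_ (≡.cong (_, j) (ℕ.+-identityʳ i))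
    (≡.trans (≡.cong (map (λ r → r , j)) (applyUpTo-cong m (ℕ.+-suc i))) (upTo-run m (suc i) j))
    where
    applyUpTo-cong : ∀ m {f g : ℕ → ℕ} → (∀ r → f r ≡ g r) → List.applyUpTo f m ≡ List.applyUpTo g m
    applyUpTo-cong zero    e = ≡.refl
    applyUpTo-cong (suc m) e = ≡.cong₂ _∷_ (e 0) (applyUpTo-cong m (e ∘ suc))

  -- A column of a skew shape is an interval of rows, from `top j` up to `bottom j`; the maximum
  -- with `i` allows the scan to start inside it.
  filter-run : ∀ m i j → bottom j ≤ i ℕ.+ m →
               filter (_∈ₛ? θ) (run i m j) ≡ run (i ⊔ top j) (bottom j ∸ (i ⊔ top j)) j
  filter-run zero i j le rewrite m≤n⇒m∸n≡0 (≤-trans (≤-trans le (≤-reflexive (ℕ.+-identityʳ i))) (ℕ.m≤m⊔n i (top j))) = ≡.refl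
  filter-run (suc m) i j le = by ((i , j) ∈ₛ? θ)
    where
    ih = filter-run m (suc i) j (≡.subst (bottom j ≤_) (ℕ.+-suc i m) le)
    none : ∀ r → bottom j ≤ r → run r (bottom j ∸ r) j ≡ []
    none r le rewrite m≤n⇒m∸n≡0 le = ≡.refl
    by : Dec ((i , j) ∈ₛ θ) → filter (_∈ₛ? θ) (run i (suc m) j) ≡ run (i ⊔ top j) (bottom j ∸ (i ⊔ top j)) j
    by (yes (inner≤j , j<outer)) = ≡.trans (List.filter-accept (_∈ₛ? θ) (inner≤j , j<outer)) (≡.trans (≡.cong ((i , j) ∷_) ih)
      (≡.trans (≡.cong (λ r → (i , j) ∷ run r (bottom j ∸ r) j) (ℕ.m≥n⇒m⊔n≡m (≤-trans top≤i (n≤1+n i))))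
      (≡.trans (≡.cong (λ h → run i h j) (≡.sym (ℕ.+-∸-assoc 1 (above-bottom {i} {j} j<outer))))
        (≡.cong (λ r → run r (bottom j ∸ r) j) (≡.sym (ℕ.m≥n⇒m⊔n≡m top≤i))))))
      where
      top≤i : top j ≤ i
      top≤i = ≮⇒≥ λ lt → <⇒≱ (below-top {i} {j} lt) inner≤j
    by (no outside-θ) = ≡.trans (List.filter-reject (_∈ₛ? θ) outside-θ) (≡.trans ih (skip (i ℕ.<? top j)))
      where
      skip : Dec (i < top j) → run (suc i ⊔ top j) (bottom j ∸ (suc i ⊔ top j)) j ≡ run (i ⊔ top j) (bottom j ∸ (i ⊔ top j)) j
      skip (yes i<top) = ≡.cong (λ r → run r (bottom j ∸ r) j) (≡.trans (ℕ.m≤n⇒m⊔n≡n i<top) (≡.sym (ℕ.m≤n⇒m⊔n≡n (<⇒≤ i<top))))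
      skip (no  i≮top) = ≡.trans (none (suc i ⊔ top j) (≤-trans (≤-trans bottom≤i (n≤1+n i)) (ℕ.m≤m⊔n (suc i) (top j))))
        (≡.sym (none (i ⊔ top j) (≤-trans bottom≤i (ℕ.m≤m⊔n i (top j)))))
        where
        bottom≤i : bottom j ≤ i
        bottom≤i = ≮⇒≥ λ lt → outside-θ (≮⇒≥ (λ lt′ → i≮top (above-top lt′)) , below-bottom lt)

  boxes≡columns : boxes θ ≡ columns (rowLength (outer θ) 0)
  boxes≡columns = ≡.trans (List.concatMap-cong column≡ (downFrom (rowLength (outer θ) 0))) (concat (rowLength (outer θ) 0))
    where
    column≡ : ∀ j → filter (_∈ₛ? θ) (map (λ i → i , j) (upTo (ℓ (outer θ)))) ≡ run (top j) (bottom j ∸ top j) j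
    column≡ j = ≡.trans (≡.cong (filter (_∈ₛ? θ)) (upTo-run (ℓ (outer θ)) 0 j))
      (filter-run (ℓ (outer θ)) 0 j (conjugate-length (parts (outer θ)) j))
    concat : ∀ m → concatMap (λ j → run (top j) (bottom j ∸ top j) j) (downFrom m) ≡ columns m
    concat zero    = ≡.refl
    concat (suc m) = ≡.trans (≡.cong (run (top m) (bottom m ∸ top m) m ++_) (concat m)) (run-++ m (bottom m ∸ top m) (top m))

  _≺_ : Box → Box → Set
  (i , j) ≺ (i₁ , j₁) = j₁ < j ⊎ (j₁ ≡ j × i < i₁)

  remaining-after : ∀ j h i → All (λ (i₁ , j₁) → j₁ < j ⊎ (j₁ ≡ j × i ≤ i₁)) (remaining j h i)
  columns-left    : ∀ j → All (λ (i₁ , j₁) → j₁ < j) (columns j)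
  remaining-after j zero    i = All.map inj₁ (columns-left j)
  remaining-after j (suc h) i = inj₂ (≡.refl , ≤-refl) ∷
    All.map (λ { (inj₁ lt) → inj₁ lt ; (inj₂ (e , le)) → inj₂ (e , <⇒≤ le) }) (remaining-after j h (suc i))
  columns-left zero    = []
  columns-left (suc j) = All.map (λ { (inj₁ lt) → m<n⇒m<1+n lt ; (inj₂ (≡.refl , _)) → ≤-refl })
    (remaining-after j (bottom j ∸ top j) (top j))

  remaining-ordered : ∀ j h i → AllPairs _≺_ (remaining j h i)
  columns-ordered   : ∀ j → AllPairs _≺_ (columns j)
  remaining-ordered j zero    i = columns-ordered j
  remaining-ordered j (suc h) i = remaining-after j h (suc i) ∷ remaining-ordered j h (suc i)
  columns-ordered zero    = []
  columns-ordered (suc j) = remaining-ordered j (bottom j ∸ top j) (top j)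

abstract
  leftOf? : ∀ b b₁ → Dec (b ImmediatelyLeftOf b₁)
  leftOf? (i , j) (i₁ , j₁) = (i ℕ.≟ i₁) ×-dec (suc j ℕ.≟ j₁)

  above? : ∀ b b₁ → Dec (b ImmediatelyAbove b₁)
  above? (i , j) (i₁ , j₁) = (suc i ℕ.≟ i₁) ×-dec (j ℕ.≟ j₁)

-- How an entry set in box b sharpens the bounds U (above) and L (below) of the
-- boxes read later.
capped : (Box → ℕ) → Box → ℕ → Box → ℕ
capped U b mn b₁ with leftOf? b₁ b
... | yes _ = U b₁ ⊓ mn
... | no  _ = U b₁

raised : (Box → ℕ) → Box → ℕ → Box → ℕ
raised L b mx b₁ with above? b b₁
... | yes _ = L b₁ ⊔ suc mx
... | no  _ = L b₁

module Fillings {n : ℕ} where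

  Fits : (Box → ℕ) → (Box → ℕ) → Box → Subset n → Set
  Fits U L b S = Nonempty S × max S ≤ U b × L b ≤ min S

  fits? : ∀ U L b S → Dec (Fits U L b S)
  fits? U L b S = nonempty? S ×-dec ((max S ℕ.≤? U b) ×-dec (L b ℕ.≤? min S))

  Admissible : ∀ (bs : List Box) (U L : Box → ℕ) → Vec (Subset n) (length bs) → Set
  Admissible []       U L []      = ⊤
  Admissible (b ∷ bs) U L (S ∷ T) = Fits U L b S × Admissible bs (capped U b (min S)) (raised L b (max S)) T

  admissible? : ∀ (bs : List Box) U L T → Dec (Admissible bs U L T)
  admissible? []       U L []      = yes tt
  admissible? (b ∷ bs) U L (S ∷ T) = fits? U L b S ×-dec admissible? bs (capped U b (min S)) (raised L b (max S)) T

  record Tableau (bs : List Box) (U L : Box → ℕ) (T : Vec (Subset n) (length bs)) : Set where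
    field
      nonempty : ∀ α → Nonempty (lookup T α)
      rows     : ∀ α α₁ → List.lookup bs α ImmediatelyLeftOf List.lookup bs α₁ → max (lookup T α) ≤ min (lookup T α₁)
      cols     : ∀ α α₁ → List.lookup bs α ImmediatelyAbove List.lookup bs α₁ → max (lookup T α) < min (lookup T α₁)
      upper    : ∀ α → max (lookup T α) ≤ U (List.lookup bs α)
      lower    : ∀ α → L (List.lookup bs α) ≤ min (lookup T α)

  -- Right and upper neighbours come earlier in the reading order, so every tableau condition can be
  -- imposed as a bound set by an earlier box.
  Ordered : List Box → Set
  Ordered = AllPairs (λ b b₁ → ¬ (b ImmediatelyLeftOf b₁) × ¬ (b₁ ImmediatelyAbove b))

  admissible⇒tableau : ∀ (bs : List Box) U L T → Ordered bs → Admissible bs U L T → Tableau bs U L T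
  admissible⇒tableau [] U L [] _ _ = record { nonempty = λ () ; rows = λ () ; cols = λ () ; upper = λ () ; lower = λ () }
  admissible⇒tableau (b ∷ bs) U L (S ∷ T) (first ∷ ordered) ((ne , mx≤ , ≤mn) , v) = record
    { nonempty = λ { zero → ne ; (suc α) → t.nonempty α }
    ; rows = λ { zero zero (_ , e) → ⊥-elim (ℕ.1+n≢n e)
               ; zero (suc α₁) left → ⊥-elim (proj₁ (apart first α₁) left)
               ; (suc α) zero left → ≤-trans (t.upper α) (cap≤ left)
               ; (suc α) (suc α₁) left → t.rows α α₁ left }
    ; cols = λ { zero zero (e , _) → ⊥-elim (ℕ.1+n≢n e)
               ; zero (suc α₁) up → ≤-trans (≤raise up) (t.lower α₁)
               ; (suc α) zero up → ⊥-elim (proj₂ (apart first α) up)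
               ; (suc α) (suc α₁) up → t.cols α α₁ up }
    ; upper = λ { zero → mx≤ ; (suc α) → ≤-trans (t.upper α) (cap (List.lookup bs α)) }
    ; lower = λ { zero → ≤mn ; (suc α) → ≤-trans (raise (List.lookup bs α)) (t.lower α) }
    }
    where
    apart : ∀ {bs} → All (λ b₁ → ¬ (b ImmediatelyLeftOf b₁) × ¬ (b₁ ImmediatelyAbove b)) bs →
            ∀ α → ¬ (b ImmediatelyLeftOf List.lookup bs α) × ¬ (List.lookup bs α ImmediatelyAbove b)
    apart (px ∷ _)  zero    = px
    apart (_ ∷ pxs) (suc α) = apart pxs α
    module t = Tableau (admissible⇒tableau bs (capped U b (min S)) (raised L b (max S)) T ordered v)
    cap≤ : ∀ {b₁} → b₁ ImmediatelyLeftOf b → capped U b (min S) b₁ ≤ min S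
    cap≤ {b₁} left with leftOf? b₁ b
    ... | yes _ = ℕ.m⊓n≤n (U b₁) (min S)
    ... | no ¬l = ⊥-elim (¬l left)
    cap : ∀ b₁ → capped U b (min S) b₁ ≤ U b₁
    cap b₁ with leftOf? b₁ b
    ... | yes _ = ℕ.m⊓n≤m (U b₁) (min S)
    ... | no _  = ≤-refl
    ≤raise : ∀ {b₁} → b ImmediatelyAbove b₁ → suc (max S) ≤ raised L b (max S) b₁
    ≤raise {b₁} up with above? b b₁
    ... | yes _ = ℕ.m≤n⊔m (L b₁) (suc (max S))
    ... | no ¬u = ⊥-elim (¬u up)
    raise : ∀ b₁ → L b₁ ≤ raised L b (max S) b₁
    raise b₁ with above? b b₁
    ... | yes _ = ℕ.m≤m⊔n (L b₁) (suc (max S))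
    ... | no _  = ≤-refl

  tableau⇒admissible : ∀ (bs : List Box) U L T → Tableau bs U L T → Admissible bs U L T
  tableau⇒admissible [] U L [] _ = tt
  tableau⇒admissible (b ∷ bs) U L (S ∷ T) t = (t.nonempty zero , t.upper zero , t.lower zero) ,
    tableau⇒admissible bs (capped U b (min S)) (raised L b (max S)) T record
      { nonempty = λ α → t.nonempty (suc α)
      ; rows = λ α α₁ → t.rows (suc α) (suc α₁)
      ; cols = λ α α₁ → t.cols (suc α) (suc α₁)
      ; upper = upper
      ; lower = lower
      }
    where
    module t = Tableau t
    upper : ∀ α → max (lookup T α) ≤ capped U b (min S) (List.lookup bs α)
    upper α with leftOf? (List.lookup bs α) b
    ... | yes left = ℕ.⊓-glb (t.upper (suc α)) (t.rows (suc α) zero left)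
    ... | no _     = t.upper (suc α)
    lower : ∀ α → raised L b (max S) (List.lookup bs α) ≤ min (lookup T α)
    lower α with above? b (List.lookup bs α)
    ... | yes up = ℕ.⊔-lub (t.lower (suc α)) (t.cols zero (suc α) up)
    ... | no _   = t.lower (suc α)

-- The reading word of a single box

entryList : ∀ {n} → Subset n → List ℕ
entryList S = map toℕ (elements S)

word : ∀ {n} → Subset n → List ℕ
word S = map toℕ (reverse (elements S))

private
  tail-elements : ∀ {m n} b (S : Subset n) (f : Fin m → Fin n) →
    map toℕ (filter (_∈? (b ∷ S)) (List.tabulate (suc ∘ f))) ≡ map suc (map toℕ (filter (_∈? S) (List.tabulate f)))
  tail-elements {zero}  b S f = ≡.refl
  tail-elements {suc m} b S f with f zero ∈? S
  ... | yes _ = ≡.cong (suc (toℕ (f zero)) ∷_) (tail-elements b S (f ∘ suc))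
  ... | no  _ = tail-elements b S (f ∘ suc)

entryList-outside : ∀ {n} (S : Subset n) → entryList (outside ∷ S) ≡ map suc (entryList S)
entryList-outside S = tail-elements outside S id

entryList-inside : ∀ {n} (S : Subset n) → entryList (inside ∷ S) ≡ 0 ∷ map suc (entryList S)
entryList-inside S = ≡.cong (0 ∷_) (tail-elements inside S id)

word-reverse : ∀ {n} (S : Subset n) → word S ≡ reverse (entryList S)
word-reverse S = List.reverse-map toℕ (elements S)

word-outside : ∀ {n} (S : Subset n) → word (outside ∷ S) ≡ map suc (word S)
word-outside S = ≡.trans (word-reverse (outside ∷ S)) (≡.trans (≡.cong reverse (entryList-outside S))
  (≡.trans (≡.sym (List.reverse-map suc (entryList S))) (≡.cong (map suc) (≡.sym (word-reverse S)))))

word-inside : ∀ {n} (S : Subset n) → word (inside ∷ S) ≡ map suc (word S) ++ 0 ∷ []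
word-inside S = ≡.trans (word-reverse (inside ∷ S)) (≡.trans (≡.cong reverse (entryList-inside S))
  (≡.trans (List.unfold-reverse 0 (map suc (entryList S))) (≡.cong (_++ 0 ∷ [])
    (≡.trans (≡.sym (List.reverse-map suc (entryList S))) (≡.cong (map suc) (≡.sym (word-reverse S)))))))

entryList-ascending : ∀ {n} (S : Subset n) → AllPairs _<_ (entryList S)
entryList-ascending []            = []
entryList-ascending (outside ∷ S) rewrite entryList-outside S = AllPairs.map⁺ (AllPairs.map s≤s (entryList-ascending S))
entryList-ascending (inside ∷ S)  rewrite entryList-inside S =
  All.map⁺ (All.universal (λ _ → s≤s z≤n) (entryList S)) ∷ AllPairs.map⁺ (AllPairs.map s≤s (entryList-ascending S))

entryList-bounded : ∀ {n} (S : Subset n) → All (_< n) (entryList S)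
entryList-bounded S = All.map⁺ (All.universal Fin.toℕ<n (elements S))

record Range (E : List ℕ) : Set where
  field
    mx mn : ℕ
    cur   : foldr (flip add) nothing E ≡ just (mx , mn)
    mx∈E  : mx ∈ E
    ≤mx   : All (_≤ mx) E
    mn∈E  : mn ∈ E
    mn≤   : All (mn ≤_) E

range : ∀ {e E} → AllPairs _<_ (e ∷ E) → Range (e ∷ E)
range {e} {[]} _ = record { mx = e ; mn = e ; cur = ≡.refl ; mx∈E = here ≡.refl ; ≤mx = ≤-refl ∷ [] ; mn∈E = here ≡.refl ; mn≤ = ≤-refl ∷ [] }
range {e} {e₁ ∷ E} (e< ∷ asc) = record
  { mx = r.mx ; mn = e ; cur = ≡.cong (λ c → add c e) r.cur ; mx∈E = there r.mx∈E
  ; ≤mx = <⇒≤ (All.lookup e< r.mx∈E) ∷ r.≤mx ; mn∈E = here ≡.refl ; mn≤ = ≤-refl ∷ All.map <⇒≤ e< }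
  where module r = Range (range asc)

word-range : ∀ {n} (S : Subset n) → (foldl add nothing (word S) ≡ nothing × ¬ Nonempty S)
             ⊎ (foldl add nothing (word S) ≡ just (max S , min S) × Nonempty S)
word-range {n} S rewrite word-reverse S | List.reverse-foldl add nothing (entryList S)
  with elements S in e | entryList-ascending S | entryList-bounded S
... | [] | _ | _ = inj₁ (≡.refl , λ (x , x∈S) → empty (≡.subst (x ∈_) e (∈-filter⁺ (_∈? S) (∈-allFin x) x∈S)))
  where
  empty : ∀ {x : Fin n} → ¬ (x ∈ [])
  empty ()
-- All entries lie between 0 and n, so the default values 0 of `max` and n of `min` do not affect
-- the result.
... | x ∷ xs | asc | bounded = inj₂ (≡.trans r.cur (≡.cong₂ (λ mx mn → just (mx , mn))
        (≡.sym (Extrema.max≈v⁺ r.mx∈E r.≤mx z≤n)) (≡.sym (Extrema.min≈v⁺ r.mn∈E r.mn≤ (<⇒≤ (All.lookup bounded r.mn∈E))))) ,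
      (x , proj₂ (∈-filter⁻ (_∈? S) {xs = allFin n} (≡.subst (x ∈_) (≡.sym e) (here ≡.refl)))))
      where module r = Range (range asc)

-- Sums over tableaux as sums letter by letter

module TableauSums {c ℓ₁} (R : CommutativeRing c ℓ₁) (n : ℕ) (θ : SkewDiagram) where
  open CommutativeRing R hiding (zero)
  open Solver commutativeSemiring using (solve)
    renaming (_:=_ to infix 4 _⊜_; _:+_ to infixl 6 _⊕_; _:*_ to infixl 7 _⊗_)
  open Shape θ
  open Words R n top bottom
  open Geometry top-anti bottom-anti top≤bottom
  open Fillings {n}

  ∑ : List Ix → (Ix → Carrier) → Carrier
  ∑ xs f = foldr (λ x s → f x + s) 0# xs

  ∑-cong : ∀ (xs : List Ix) {f g} → (∀ x → f x ≈ g x) → ∑ xs f ≈ ∑ xs g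
  ∑-cong []       e = refl
  ∑-cong (x ∷ xs) e = +-cong (e x) (∑-cong xs e)

  ∑-++ : ∀ (xs ys : List Ix) f → ∑ (xs ++ ys) f ≈ ∑ xs f + ∑ ys f
  ∑-++ []       ys f = sym (+-identityˡ _)
  ∑-++ (x ∷ xs) ys f = trans (+-congˡ (∑-++ xs ys f)) (sym (+-assoc _ _ _))

  ∑-map : ∀ (h : Ix → Iy) xs f → ∑ (map h xs) f ≈ ∑ xs (f ∘ h)
  ∑-map h []       f = refl
  ∑-map h (x ∷ xs) f = +-congˡ (∑-map h xs f)

  ∑-cartesian : ∀ {m} (xs : List Ix) (ys : List (Vec Ix m)) f →
                ∑ (cartesianProductWith _∷_ xs ys) f ≈ ∑ xs (λ x → ∑ ys (λ y → f (x ∷ y)))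
  ∑-cartesian []       ys f = refl
  ∑-cartesian (x ∷ xs) ys f = trans (∑-++ (map (x ∷_) ys) _ f) (+-cong (∑-map (x ∷_) ys f) (∑-cartesian xs ys f))

  ∑-filter : ∀ {P : Ix → Set lev} (P? : ∀ x → Dec (P x)) xs f → ∑ (filter P? xs) f ≈ ∑ xs (λ x → ⟦ P? x ⟧ (f x))
  ∑-filter P? []       f = refl
  ∑-filter P? (x ∷ xs) f with P? x in e
  ... | yes _ = +-congˡ (∑-filter P? xs f)
  ... | no  _ = trans (∑-filter P? xs f) (sym (+-identityˡ _))

  ∑-0 : ∀ (xs : List Ix) → ∑ xs (λ _ → 0#) ≈ 0#
  ∑-0 []       = refl
  ∑-0 (x ∷ xs) = trans (+-identityˡ _) (∑-0 xs)

  ∑-⟦⟧ : ∀ {P : Set lev} (d : Dec P) (xs : List Ix) f → ∑ xs (λ x → ⟦ d ⟧ (f x)) ≈ ⟦ d ⟧ (∑ xs f)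
  ∑-⟦⟧ (yes _) xs f = refl
  ∑-⟦⟧ (no  _) xs f = ∑-0 xs

  ⟦⟧-× : ∀ {P : Set lev} {Q : Set lev′} (d : Dec P) (d₁ : Dec Q) x → ⟦ d ×-dec d₁ ⟧ x ≈ ⟦ d ⟧ (⟦ d₁ ⟧ x)
  ⟦⟧-× (yes _) (yes _) x = refl
  ⟦⟧-× (yes _) (no  _) x = refl
  ⟦⟧-× (no  _) _       x = refl

  Decreasing : ℕ → (List ℕ → Carrier) → Carrier
  Decreasing zero    f = f []
  Decreasing (suc r) f = Decreasing r f + Decreasing r (λ w → f (r ∷ w))

  Decreasing-cong : ∀ r {f g} → (∀ w → All (_< r) w → f w ≈ g w) → Decreasing r f ≈ Decreasing r g
  Decreasing-cong zero    e = e [] []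
  Decreasing-cong (suc r) e = +-cong
    (Decreasing-cong r λ w lt → e w (All.map m<n⇒m<1+n lt))
    (Decreasing-cong r λ w lt → e (r ∷ w) (≤-refl ∷ All.map m<n⇒m<1+n lt))

  Decreasing-0 : ∀ r → Decreasing r (λ _ → 0#) ≈ 0#
  Decreasing-0 zero    = refl
  Decreasing-0 (suc r) = trans (+-cong (Decreasing-0 r) (Decreasing-0 r)) (+-identityʳ 0#)

  -- Subsets are enumerated by deciding the smallest letter first, words by deciding the largest
  -- first. Peeling the letter 0 off the end reconciles the two.
  Decreasing-shift : ∀ r f → Decreasing (suc r) f ≈ Decreasing r (λ w → f (map suc w ++ 0 ∷ [])) + Decreasing r (λ w → f (map suc w))
  Decreasing-shift zero    f = +-comm _ _
  Decreasing-shift (suc r) f = trans (+-cong (Decreasing-shift r f) (Decreasing-shift r (λ w → f (suc r ∷ w))))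
    (solve 4 (λ a b c d → (a ⊕ b) ⊕ (c ⊕ d) ⊜ (a ⊕ c) ⊕ (b ⊕ d)) refl _ _ _ _)

  ∑-subsets : ∀ m f → ∑ (subsets m) (λ S → f (word S)) ≈ Decreasing m f
  ∑-subsets zero    f = +-identityʳ _
  ∑-subsets (suc m) f = trans (∑-cartesian (inside ∷ outside ∷ []) (subsets m) (f ∘ word)) (trans
    (+-cong (trans (∑-cong (subsets m) λ S → reflexive (≡.cong f (word-inside S))) (∑-subsets m _))
      (trans (+-identityʳ _) (trans (∑-cong (subsets m) λ S → reflexive (≡.cong f (word-outside S))) (∑-subsets m _))))
    (sym (Decreasing-shift m f)))

  module _ (j h i : ℕ) (u : ℕ → ℕ) (l : ℕ) where

    completed : (List ℕ → Carrier) → Cur → List ℕ → Carrier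
    completed f nothing          w = 0#
    completed f (just (mx , mn)) w =
      ⟦ (mx ℕ.≤? u i) ×-dec (l ℕ.≤? mn) ⟧ (Col j h (suc i) (u [ i ≔ mn ]) (suc mx) (λ w′ → f (w ++ w′)))

    completed-∷ : ∀ f r c w → completed f c (r ∷ w) ≈ completed (f ∘ (r ∷_)) c w
    completed-∷ f r nothing  w = refl
    completed-∷ f r (just _) w = refl

    Within : ℕ → Cur → Set
    Within r nothing           = ⊤
    Within r (just (mx , mn)) = mx ≤ u i × l ≤ mn × r ≤ mn × mn ≤ mx

    last-≤ : ∀ mx mn w → All (_< mn) w → ∃ λ mn₁ → mn₁ ≤ mn × foldl add (just (mx , mn)) w ≡ just (mx , mn₁)
    last-≤ mx mn []      _          = mn , ≤-refl , ≡.refl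
    last-≤ mx mn (r ∷ w) (r<mn ∷ lt) = go r w (<⇒≤ r<mn) (All.map <⇒≤ lt)
      where
      go : ∀ r w → r ≤ mn → All (_≤ mn) w → ∃ λ mn₁ → mn₁ ≤ mn × foldl add (just (mx , r)) w ≡ just (mx , mn₁)
      go r []      r≤ _         = r , r≤ , ≡.refl
      go r (s ∷ w) r≤ (s≤ ∷ le) = go s w s≤ le

    -- `completed` tests the bounds once per box, `Cell` at every letter. They agree because the
    -- first letter is the maximum, and a later letter can only fail by lying below l, which the
    -- minimum then does as well.
    Decreasing-Cell : ∀ r c f → Within r c → Decreasing r (λ w → completed f (foldl add c w) w) ≈ Cell r c j h i u l f
    Decreasing-Cell zero nothing          f _ = refl
    Decreasing-Cell zero (just (mx , mn)) f (mx≤u , l≤mn , _) = ⟦⟧-yes ((mx ℕ.≤? u i) ×-dec (l ℕ.≤? mn)) (mx≤u , l≤mn)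
    Decreasing-Cell (suc r) c f within = +-cong (Decreasing-Cell r c f (skip c within)) (take c within (allowed? l (u i) r))
      where
      skip : ∀ c → Within (suc r) c → Within r c
      skip nothing  _                           = tt
      skip (just _) (mx≤u , l≤mn , r<mn , mn≤mx) = mx≤u , l≤mn , <⇒≤ r<mn , mn≤mx
      within-add : ∀ c → Within (suc r) c → Allowed l (u i) r → Within r (add c r)
      within-add nothing  _ (l≤r , r≤u) = r≤u , l≤r , ≤-refl , ≤-refl
      within-add (just _) (mx≤u , _ , r<mn , mn≤mx) (l≤r , _) = mx≤u , l≤r , ≤-refl , ≤-trans (<⇒≤ r<mn) mn≤mx
      drop : ∀ c → Within (suc r) c → ¬ Allowed l (u i) r → ∀ w → All (_< r) w → completed f (foldl add (add c r) w) (r ∷ w) ≈ 0#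
      drop nothing _ ¬al w lt with last-≤ r r w lt
      ... | mn , mn≤r , e rewrite e = ⟦⟧-no ((r ℕ.≤? u i) ×-dec (l ℕ.≤? mn)) λ (r≤u , l≤mn) → ¬al (≤-trans l≤mn mn≤r , r≤u)
      drop (just (mx , mn₀)) (mx≤u , _ , r<mn , mn≤mx) ¬al w lt with last-≤ mx r w lt
      ... | mn , mn≤r , e rewrite e = ⟦⟧-no ((mx ℕ.≤? u i) ×-dec (l ℕ.≤? mn)) λ (_ , l≤mn) →
              ¬al (≤-trans l≤mn mn≤r , ≤-trans (<⇒≤ r<mn) (≤-trans mn≤mx mx≤u))
      take : ∀ c → Within (suc r) c → (d : Dec (Allowed l (u i) r)) →
             Decreasing r (λ w → completed f (foldl add (add c r) w) (r ∷ w)) ≈ ⟦ d ⟧ (Cell r (add c r) j h i u l (λ w → f (r ∷ w)))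
      take c within (yes al) = trans (Decreasing-cong r λ w _ → completed-∷ f r (foldl add (add c r) w) w)
        (Decreasing-Cell r (add c r) (f ∘ (r ∷_)) (within-add c within al))
      take c within (no ¬al) = trans (Decreasing-cong r (drop c within ¬al)) (Decreasing-0 r)

  Sum : List Box → (U L : Box → ℕ) → (List ℕ → Carrier) → Carrier
  Sum []       U L f = f []
  Sum (b ∷ bs) U L f = ∑ (subsets n) (λ S → ⟦ fits? U L b S ⟧ (Sum bs (capped U b (min S)) (raised L b (max S)) (λ w → f (word S ++ w))))

  readingWord : ∀ {m} → Vec (Subset n) m → List ℕ
  readingWord T = map toℕ (concatMap (λ S → reverse (elements S)) (toList T))

  ∑-valid : ∀ bs U L f → ∑ (vectors (subsets n) (length bs)) (λ T → ⟦ admissible? bs U L T ⟧ (f (readingWord T))) ≈ Sum bs U L f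
  ∑-valid []       U L f = +-identityʳ _
  ∑-valid (b ∷ bs) U L f = trans (∑-cartesian (subsets n) (vectors (subsets n) (length bs)) _)
    (∑-cong (subsets n) λ S → trans
      (trans (∑-cong (vectors (subsets n) (length bs)) λ T →
          trans (⟦⟧-× (fits? U L b S) (admissible? bs (capped U b (min S)) (raised L b (max S)) T) _)
            (⟦⟧-cong (fits? U L b S) λ _ → ⟦⟧-cong (admissible? bs _ _ T) λ _ → reflexive (≡.cong f (List.map-++ toℕ (reverse (elements S)) _))))
        (∑-⟦⟧ (fits? U L b S) (vectors (subsets n) (length bs)) _))
      (⟦⟧-cong (fits? U L b S) λ _ → ∑-valid bs (capped U b (min S)) (raised L b (max S)) (λ w → f (word S ++ w))))

  -- Replaces bounds on boxes by one bound per row: `u r` belongs to column j while row r is unread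
  -- there, and to column j - 1 afterwards. Rows below column j have bound n until a longer column
  -- reaches them.
  record Represents (j i : ℕ) (U L : Box → ℕ) (u : ℕ → ℕ) (l : ℕ) : Set where
    field
      here-U  : ∀ r → i ≤ r → U (r , j) ≡ u r
      done-U  : ∀ {j₁} → j ≡ suc j₁ → ∀ r → r < i → top j₁ ≤ r → U (r , j₁) ≡ u r
      fresh-U : ∀ {j₁} → j ≡ suc j₁ → ∀ r → i ≤ r → U (r , j₁) ≡ n
      left-U  : ∀ {j₁} → suc j₁ < j → ∀ r → U (r , j₁) ≡ n
      free-u  : ∀ r → bottom j ≤ r → u r ≡ n
      here-L  : L (i , j) ≡ l
      below-L : ∀ r → i < r → L (r , j) ≡ 0
      left-L  : ∀ {j₁} → j₁ < j → ∀ r → L (r , j₁) ≡ 0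

  module Step {j h i U L u l} (i+h : i ℕ.+ suc h ≡ bottom j) (ρ : Represents j i U L u l) (mx mn : ℕ) (mn≤n : mn ≤ n) where
    open Represents ρ

    capped-else : ∀ r j₁ → ¬ (r ≡ i × suc j₁ ≡ j) → capped U (i , j) mn (r , j₁) ≡ U (r , j₁)
    capped-else r j₁ ne with leftOf? (r , j₁) (i , j)
    ... | yes e = ⊥-elim (ne e)
    ... | no _  = ≡.refl

    raised-else : ∀ r j₁ → ¬ (suc i ≡ r × j ≡ j₁) → raised L (i , j) mx (r , j₁) ≡ L (r , j₁)
    raised-else r j₁ ne with above? (i , j) (r , j₁)
    ... | yes e = ⊥-elim (ne e)
    ... | no _  = ≡.refl

    done : ∀ {j₁} → j ≡ suc j₁ → ∀ r → r < suc i → top j₁ ≤ r → capped U (i , j) mn (r , j₁) ≡ (u [ i ≔ mn ]) r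
    done {j₁} e r (s≤s r≤i) top≤r with r ℕ.≟ i
    ... | no r≢i = ≡.trans (capped-else r j₁ (r≢i ∘ proj₁)) (done-U e r (≤∧≢⇒< r≤i r≢i) top≤r)
    ... | yes r≡i with leftOf? (r , j₁) (i , j)
    -- The box to the left was unrestricted, with bound n, so the minimum with mn ≤ n is mn.
    ...   | yes _ = ≡.trans (≡.cong (_⊓ mn) (fresh-U e r (≤-reflexive (≡.sym r≡i)))) (ℕ.m≥n⇒m⊓n≡n mn≤n)
    ...   | no ¬l = ⊥-elim (¬l (r≡i , ≡.sym e))

    lower : raised L (i , j) mx (suc i , j) ≡ suc mx
    lower with above? (i , j) (suc i , j)
    ... | yes _ = ≡.cong (_⊔ suc mx) (below-L (suc i) ≤-refl)
    ... | no ¬u = ⊥-elim (¬u (≡.refl , ≡.refl))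

    represents : Represents j (suc i) (capped U (i , j) mn) (raised L (i , j) mx) (u [ i ≔ mn ]) (suc mx)
    represents = record
      { here-U  = λ r i<r → ≡.trans (capped-else r j (λ (_ , e) → ℕ.1+n≢n e))
                    (≡.trans (here-U r (<⇒≤ i<r)) (≡.sym (≔-there u i mn (>⇒≢ i<r))))
      ; done-U  = done
      ; fresh-U = λ e r i<r → ≡.trans (capped-else r _ (λ (e , _) → >⇒≢ i<r e)) (fresh-U e r (<⇒≤ i<r))
      ; left-U  = λ lt r → ≡.trans (capped-else r _ (λ (_ , e) → <⇒≢ lt e)) (left-U lt r)
      ; free-u  = λ r le → ≡.trans (≔-there u i mn (>⇒≢ (<-≤-trans (≡.subst (i <_) i+h (ℕ.m<m+n i (s≤s z≤n))) le))) (free-u r le)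
      ; here-L  = lower
      ; below-L = λ r lt → ≡.trans (raised-else r j (λ (e , _) → <⇒≢ lt e)) (below-L r (<-trans (n<1+n i) lt))
      ; left-L  = λ {j₁} lt r → ≡.trans (raised-else r j₁ (λ (_ , e) → >⇒≢ lt e)) (left-L lt r)
      }

  next-column : ∀ {j i U L u l} → Represents (suc j) i U L u l → i ≡ bottom (suc j) → (∀ r → L (r , j) ≡ 0) → Represents j (top j) U L u 0
  next-column {j} {i} {U} {L} {u} ρ i≡b L≡0 = record
    { here-U  = agree
    ; done-U  = λ { ≡.refl r r<top top≤r → ⊥-elim (<⇒≱ r<top (≤-trans (top-anti _) top≤r)) }
    ; fresh-U = λ { ≡.refl r _ → left-U ≤-refl r }
    ; left-U  = λ lt r → left-U (m<n⇒m<1+n lt) r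
    ; free-u  = λ r le → free-u r (≤-trans (bottom-anti j) le)
    ; here-L  = L≡0 (top j)
    ; below-L = λ r _ → L≡0 r
    ; left-L  = λ lt r → left-L (m<n⇒m<1+n lt) r
    }
    where
    open Represents ρ
    agree : ∀ r → top j ≤ r → U (r , j) ≡ u r
    agree r top≤r with r ℕ.<? i
    ... | yes r<i = done-U ≡.refl r r<i top≤r
    ... | no  r≮i = ≡.trans (fresh-U ≡.refl r (≮⇒≥ r≮i)) (≡.sym (free-u r (≡.subst (_≤ r) i≡b (≮⇒≥ r≮i))))

  Sum-Col : ∀ j h i U L u l f → i ℕ.+ h ≡ bottom j → Represents j i U L u l → Sum (remaining j h i) U L f ≈ Col j h i u l f
  Sum-Col zero    zero i U L u l f _   _ = refl
  Sum-Col (suc j) zero i U L u l f i+h ρ = Sum-Col j (bottom j ∸ top j) (top j) U L u 0 f (height j)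
    (next-column ρ (≡.trans (≡.sym (ℕ.+-identityʳ i)) i+h) (λ r → Represents.left-L ρ ≤-refl r))
  Sum-Col j (suc h) i U L u l f i+h ρ = trans (∑-cong (subsets n) summand)
    (trans (∑-subsets n (λ w → completed j h i u l f (foldl add nothing w) w)) (Decreasing-Cell j h i u l n nothing f tt))
    where
    open Represents ρ
    summand : ∀ S → ⟦ fits? U L (i , j) S ⟧ (Sum (remaining j h (suc i)) (capped U (i , j) (min S)) (raised L (i , j) (max S)) (λ w → f (word S ++ w)))
              ≈ completed j h i u l f (foldl add nothing (word S)) (word S)
    summand S with word-range S
    ... | inj₁ (e , empty) rewrite e = ⟦⟧-no (fits? U L (i , j) S) (empty ∘ proj₁)
    ... | inj₂ (e , nonempty) rewrite e = ⟦⟧-cong₂ (fits? U L (i , j) S) ((max S ℕ.≤? u i) ×-dec (l ℕ.≤? min S))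
            (λ (_ , mx≤ , ≤mn) → ≡.subst (max S ≤_) (here-U i ≤-refl) mx≤ , ≡.subst (_≤ min S) here-L ≤mn)
            (λ (mx≤ , ≤mn) → nonempty , ≡.subst (max S ≤_) (≡.sym (here-U i ≤-refl)) mx≤ , ≡.subst (_≤ min S) (≡.sym here-L) ≤mn)
            λ _ → Sum-Col j h (suc i) _ _ (u [ i ≔ min S ]) (suc (max S)) (λ w → f (word S ++ w)) (shift i h i+h)
                    (Step.represents i+h ρ (max S) (min S) (Extrema.min≤⊤ n (entryList S)))

  J : ℕ
  J = rowLength (outer θ) 0

  Sum-columns : ∀ j f → Sum (columns j) (λ _ → n) (λ _ → 0) f ≈ Next j (λ _ → n) f
  Sum-columns zero    f = refl
  Sum-columns (suc j) f = Sum-Col j (bottom j ∸ top j) (top j) _ _ (λ _ → n) 0 f (height j) record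
    { here-U = λ _ _ → ≡.refl ; done-U = λ _ _ _ _ → ≡.refl ; fresh-U = λ _ _ _ → ≡.refl ; left-U = λ _ _ → ≡.refl
    ; free-u = λ _ _ → ≡.refl ; here-L = ≡.refl ; below-L = λ _ _ → ≡.refl ; left-L = λ _ _ → ≡.refl }

  columns-apart : Ordered (columns J)
  columns-apart = AllPairs.map apart (columns-ordered J)
    where
    apart : ∀ {b b₁} → b ≺ b₁ → ¬ (b ImmediatelyLeftOf b₁) × ¬ (b₁ ImmediatelyAbove b)
    apart (inj₁ j₁<j)          = (λ (_ , e) → <-asym j₁<j (≤-reflexive e)) , λ (_ , e) → <⇒≢ j₁<j e
    apart (inj₂ (≡.refl , lt)) = (λ (_ , e) → ℕ.1+n≢n e) , λ (e , _) → <-asym lt (≤-reflexive e)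

  -- The initial bounds n above and 0 below restrict nothing, so the admissible fillings are
  -- precisely the tableaux.
  ∑-tableaux : ∀ f → ∑ (tableaux n θ) (λ T → f (map toℕ (columnWord θ T))) ≈ Next J (λ _ → n) f
  ∑-tableaux f = trans (∑-filter (isTableau? θ) (vectors (subsets n) ∣ θ ∣ₛ) _)
    (trans (∑-cong (vectors (subsets n) ∣ θ ∣ₛ) λ T →
        ⟦⟧-cong₂ (isTableau? θ T) (admissible? (boxes θ) (λ _ → n) (λ _ → 0) T)
          (λ t → tableau⇒admissible (boxes θ) _ _ T (to T t))
          (λ v → from T (admissible⇒tableau (boxes θ) _ _ T (≡.subst Ordered (≡.sym boxes≡columns) columns-apart) v))
          λ _ → refl)
    (trans (∑-valid (boxes θ) (λ _ → n) (λ _ → 0) f)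
      (trans (reflexive (≡.cong (λ bs → Sum bs (λ _ → n) (λ _ → 0) f) boxes≡columns)) (Sum-columns J f))))
    where
    max≤n : ∀ S → max S ≤ n
    max≤n S = Extrema.max≤v⁺ z≤n (All.map <⇒≤ (entryList-bounded S))
    to : ∀ T → IsTableau θ T → Tableau (boxes θ) (λ _ → n) (λ _ → 0) T
    to T t = record { nonempty = nonempty ; rows = rowsWeak ; cols = columnsStrict ; upper = λ α → max≤n (lookup T α) ; lower = λ _ → z≤n }
      where open IsTableau t
    from : ∀ T → Tableau (boxes θ) (λ _ → n) (λ _ → 0) T → IsTableau θ T
    from T t = record { nonempty = nonempty ; rowsWeak = rows ; columnsStrict = cols }
      where open Tableau t

-- Products of Grothendieck polynomials with alternants

module Products {c ℓ₁} (R : CommutativeRing c ℓ₁) (n : ℕ) (zs : List (CommutativeRing.Carrier R)) (zs-length : length zs ≡ n) (θ : SkewDiagram) where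
  open CommutativeRing R hiding (zero)
  open TableauSums R n θ using (∑; ∑-tableaux; J)
  open Shape θ
  open Words R n top bottom
  open Alternants R
  open Values R n zs

  -- β^|θ| times the Grothendieck polynomial of θ at ys, when ys is the list
  -- of the β x_i.
  g : List Carrier → Carrier
  g ys = Next J (λ _ → n) (mon (ys ‼_))

  g-swap : ∀ as x y bs → length (as ++ x ∷ y ∷ bs) ≡ n → g (as ++ x ∷ y ∷ bs) ≈ g (as ++ y ∷ x ∷ bs)
  g-swap as x y bs len = proj₁ (S.claims (_‼_ (as ++ x ∷ y ∷ bs)) (_‼_ (as ++ y ∷ x ∷ bs)) (reflexive (‼-swap as x y bs)) (reflexive (≡.sym (‼-swap as y x bs)))
      (λ r r≢k r≢k+1 → reflexive (‼-else as x y bs {r} r≢k r≢k+1)) J 0)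
    (bottom J) (λ _ → n) (suc n) (ℕ.+-identityʳ _) (λ _ _ _ → ≤-refl) (λ _ _ → >⇒≢ (<-trans (n<1+n _) k+1<n)) (λ e → >⇒≢ (<-trans (n<1+n _) k+1<n) (ℕ.suc-injective e))
    where
    k+1<n : suc (length bs) < n
    k+1<n = ≡.subst (suc (length bs) <_) (≡.trans (≡.sym (List.length-++ as)) len) (m≤n+m _ (length as))
    module S = Symmetry R n top bottom top-anti bottom-anti top≤bottom (length bs) k+1<n

  g-↭ : ∀ {ys} → ys ↭ zs → g ys ≈ g zs
  g-↭ p = Swappable⇒↭ n {g} g-swap p [] (≡.trans (↭-length p) zs-length)

  product : ∀ μ → g zs * A μ ≈ ∑ (tableaux n θ) (λ T → value (advance μ (map toℕ (columnWord θ T))))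
  product μ = begin
    g zs * A μ
      ≈⟨ sym (Alt-* n zs (g zs) (W (rowLength μ))) ⟩
    Alt n zs (λ ys → g zs * W (rowLength μ) ys)
      -- As `g` is symmetric, `g zs` may be evaluated at each arrangement `ys`, so that its letters
      -- match those of `W`.
      ≈⟨ Alt-cong n zs (λ ys p → trans (*-congʳ (sym (g-↭ p))) (*-comm _ _)) ⟩
    Alt n zs (λ ys → W (rowLength μ) ys * g ys)
      ≈⟨ Alt-cong n zs (λ ys _ → Next-* J (λ _ → n) (W (rowLength μ) ys) (mon (ys ‼_))) ⟩
    Alt n zs (λ ys → Next J (λ _ → n) (λ w → W (rowLength μ) ys * mon (ys ‼_) w))
      ≈⟨ Next-Λ (Alt n zs) (λ e → Alt-cong n zs (λ ys _ → e ys)) (Alt-0 n zs) (Alt-+ n zs) J (λ _ → n) (λ w ys → W (rowLength μ) ys * mon (ys ‼_) w) ⟩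
    Next J (λ _ → n) (E μ)
      ≈⟨ cancels J 0 (bottom J) (λ _ → n) (suc n) μ (ℕ.+-identityʳ _) (λ _ _ _ → ≤-refl) (λ _ _ _ _ _ → inj₂ ≤-refl)
           (λ { m ≡.refl lt → ⊥-elim (<⇒≱ lt (n≤1+n m)) }) ⟩
    Next J (λ _ → n) (λ w → value (advance μ w))
      ≈⟨ sym (∑-tableaux (λ w → value (advance μ w))) ⟩
    ∑ (tableaux n θ) (λ T → value (advance μ (map toℕ (columnWord θ T)))) ∎
    where
    open import Relation.Binary.Reasoning.Setoid setoid
    open Cancellation R n top bottom top-anti bottom-anti top≤bottom zs zs-length using (E; cancels)
    Next-* : ∀ j u x f → x * Next j u f ≈ Next j u (λ w → x * f w)
    Next-* j u x f = Next-Λ {I = Lift _ ⊤} (λ h → x * h (lift tt)) (λ e → *-congˡ (e _)) (zeroʳ x) (λ _ _ → distribˡ x _ _) j u (λ w _ → f w)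
      where open import Data.Unit.Base using (⊤; tt)

module StraightProducts {c ℓ₁} (R : CommutativeRing c ℓ₁) (n : ℕ) (zs : List (CommutativeRing.Carrier R)) (zs-length : length zs ≡ n) (κ : Partition) where
  open CommutativeRing R hiding (zero)
  open TableauSums R n (straight κ) using (∑-tableaux; J)
  open Shape (straight κ)
  open Words R n top bottom
  open Alternants R using (_‼_)
  open Values R n zs
  open Products R n zs zs-length (straight κ)

  straight-product : ℓ κ ≤ n → g zs * A ∅ ≈ A κ
  straight-product κ≤n = trans (product ∅) (trans (∑-tableaux (λ w → value (advance ∅ w)))
    (H.highest J 0 0 (λ _ → n) ∅ (≡.sym bottom-J) ((λ _ ()) , λ s _ → inj₂ (≤-trans (row≤J s) (n≤1+n J) , ≤-refl))
      ((λ _ ()) , λ s _ → ≡.sym (m≤n⇒m∸n≡0 (≤-trans (row≤J s) (n≤1+n J))))))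
    where
    module H = HighestWeight R n top bottom (λ _ → ≡.refl) zs zs-length κ κ≤n
      (λ j s lt → below-bottom {s} {j} lt) (λ j s lt → above-bottom {s} {j} lt)
    row≤J : ∀ s → rowLength κ s ≤ J
    row≤J zero    = ≤-refl
    row≤J (suc s) = ≤-trans (rowLength-anti κ s) (row≤J s)
    bottom-J : bottom J ≡ 0
    bottom-J = ℕ.n≤0⇒n≡0 (≮⇒≥ λ lt → <-irrefl ≡.refl (below-bottom {0} {J} lt))

  straight-vanishes : n < ℓ κ → g zs ≈ 0#
  straight-vanishes n<κ = go J ≡.refl
    where
    row-pos : ∀ i → i < ℓ κ → 0 < rowLength κ i
    row-pos i lt = ≡.subst (0 <_) (≡.sym (rowLength-part κ i)) (part-pos (partition-positive κ) i lt)
    go : ∀ j → J ≡ j → Next j (λ _ → n) (mon (zs ‼_)) ≈ 0#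
    go zero    e = ⊥-elim (<-irrefl (≡.sym e) (row-pos 0 (ℕ.≤-<-trans z≤n n<κ)))
    go (suc j) e = TooLong.Next-vanishes R n top bottom j (λ _ → n) _ (above-bottom {n} {0} (row-pos n n<κ))

-- Expansion in Grothendieck polynomials

conjugate-sum : List ℕ → ℕ → ℕ
conjugate-sum p zero    = 0
conjugate-sum p (suc M) = conjugate p M ℕ.+ conjugate-sum p M

conjugate-sum-∷ : ∀ {m p} → Linked _≥_ (m ∷ p) → ∀ M → conjugate-sum (m ∷ p) M ≡ (m ⊓ M) ℕ.+ conjugate-sum p M
conjugate-sum-∷ {m} {p} d zero    = ≡.sym (≡.trans (ℕ.+-identityʳ _) (ℕ.⊓-zeroʳ m))
conjugate-sum-∷ {m} {p} d (suc M) with M ℕ.<? m | conjugate-sum-∷ d M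
... | yes M<m | ih rewrite ih | ℕ.m≥n⇒m⊓n≡n M<m | ℕ.m≥n⇒m⊓n≡n (<⇒≤ M<m) =
      ≡.cong suc (≡.trans (≡.sym (ℕ.+-assoc (conjugate p M) M (conjugate-sum p M))) (≡.trans (≡.cong (λ k → k ℕ.+ conjugate-sum p M) (ℕ.+-comm (conjugate p M) M)) (ℕ.+-assoc M (conjugate p M) _)))
... | no M≮m | ih rewrite ih | ℕ.m≤n⇒m⊓n≡m (≤-trans (≮⇒≥ M≮m) (n≤1+n M)) | ℕ.m≤n⇒m⊓n≡m (≮⇒≥ M≮m) =
      ≡.cong (λ k → m ℕ.+ (k ℕ.+ conjugate-sum p M)) (≡.sym (ℕ.n≤0⇒n≡0 (≮⇒≥ λ lt →
        M≮m (<-≤-trans (conjugate-sound p lt) (part-anti d 0)))))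

conjugate-sum-all : ∀ {p} → Linked _≥_ p → ∀ M → part p 0 ≤ M → conjugate-sum p M ≡ sum p
conjugate-sum-all {[]} d M _ = empty M
  where
  empty : ∀ M → conjugate-sum [] M ≡ 0
  empty zero    = ≡.refl
  empty (suc M) = empty M
conjugate-sum-all {m ∷ p} d M m≤M = ≡.trans (conjugate-sum-∷ d M) (≡.cong₂ ℕ._+_ (ℕ.m≤n⇒m⊓n≡m m≤M)
  (conjugate-sum-all (Linked.tail d) M (≤-trans (part-anti d 0) m≤M)))

-- The powers of β in `G` count listed boxes, while the coefficient refers to sums of parts for μ
-- and ν; the two have to be identified.
straight-size : ∀ κ → ∣ straight κ ∣ₛ ≡ ∣ κ ∣ₚ
straight-size κ = ≡.trans (≡.cong length boxes≡columns) (≡.trans (columns-length (rowLength κ 0))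
  (conjugate-sum-all (partition-linked κ) (rowLength κ 0) (≤-reflexive (≡.sym (rowLength-part κ 0)))))
  where
  open Shape (straight κ)
  columns-length : ∀ j → length (columns j) ≡ conjugate-sum (parts κ) j
  remaining-length : ∀ j h i → length (remaining j h i) ≡ h ℕ.+ conjugate-sum (parts κ) j
  columns-length zero    = ≡.refl
  columns-length (suc j) = remaining-length j (bottom j) 0
  remaining-length j zero    i = columns-length j
  remaining-length j (suc h) i = ≡.cong suc (remaining-length j h (suc i))

differences-injective : ∀ {γ δ} → (∀ i → γ (suc i) ≤ γ i) → (∀ i → δ (suc i) ≤ δ i) → ∀ m e →
  (∀ k → m ≡ suc k → e ≤ γ k) → (∀ k → m ≡ suc k → e ≤ δ k) → differences γ e m ≡ differences δ e m → ∀ i → i < m → γ i ≡ δ i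
differences-injective {γ} {δ} γ-anti δ-anti (suc m) e e≤γ e≤δ eq i (s≤s i≤m) with i ℕ.≟ m
... | yes ≡.refl = same
  where
  same : γ m ≡ δ m
  same = ≡.trans (≡.sym (m∸n+n≡m (e≤γ m ≡.refl))) (≡.trans (≡.cong (ℕ._+ e) (Vec.∷-injectiveˡ eq)) (m∸n+n≡m (e≤δ m ≡.refl)))
... | no i≢m = differences-injective γ-anti δ-anti m (γ m) (λ { k ≡.refl → γ-anti k })
      (λ { k ≡.refl → ≡.subst (_≤ δ k) (≡.sym same) (δ-anti k) })
      (≡.trans (Vec.∷-injectiveʳ eq) (≡.cong (λ g → differences δ g m) (≡.sym same))) i (≤∧≢⇒< i≤m i≢m)
  where
  same : γ m ≡ δ m
  same = ≡.trans (≡.sym (m∸n+n≡m (e≤γ m ≡.refl))) (≡.trans (≡.cong (ℕ._+ e) (Vec.∷-injectiveˡ eq)) (m∸n+n≡m (e≤δ m ≡.refl)))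

part-injective : ∀ {p q} → All (0 <_) p → All (0 <_) q → (∀ i → part p i ≡ part q i) → p ≡ q
part-injective []          []          e = ≡.refl
part-injective []          (q>0 ∷ _)   e = ⊥-elim (<⇒≢ q>0 (e 0))
part-injective (p>0 ∷ _)   []          e = ⊥-elim (>⇒≢ p>0 (e 0))
part-injective (_ ∷ p>0)   (_ ∷ q>0)   e = ≡.cong₂ _∷_ (e 0) (part-injective p>0 q>0 (e ∘ suc))

-- The index of the alternant of ρ; on partitions with at most n rows it determines ρ.
steps : ∀ n → Partition → Vec ℕ n
steps n ρ = differences (rowLength ρ) 0 n

steps-injective : ∀ {n ρ σ} → ℓ ρ ≤ n → ℓ σ ≤ n → steps n ρ ≡ steps n σ → ρ ≡ σ
steps-injective {n} {ρ} {σ} ρ≤n σ≤n e = parts-injective {ρ} {σ} (part-injective (partition-positive ρ) (partition-positive σ) agree)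
  where
  agree : ∀ i → part (parts ρ) i ≡ part (parts σ) i
  agree i with i ℕ.<? n
  ... | yes i<n = ≡.trans (≡.sym (rowLength-part ρ i)) (≡.trans
          (differences-injective (rowLength-anti ρ) (rowLength-anti σ) n 0 (λ _ _ → z≤n) (λ _ _ → z≤n) e i i<n) (rowLength-part σ i))
  ... | no i≮n = ≡.trans (part-zero (parts ρ) i (≤-trans ρ≤n (≮⇒≥ i≮n))) (≡.sym (part-zero (parts σ) i (≤-trans σ≤n (≮⇒≥ i≮n))))

steps-∅ : ∀ n → steps n ∅ ≡ Vec.replicate n 0
steps-∅ zero    = ≡.refl
steps-∅ (suc n) = ≡.cong (0 ∷_) (steps-∅ n)

advance-ℓ : ∀ {n} ρ w {σ} → ℓ ρ ≤ n → All (_< n) w → advance ρ w ≡ just σ → ℓ σ ≤ n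
advance-ℓ ρ []      ρ≤n _          ≡.refl = ρ≤n
advance-ℓ ρ (r ∷ w) ρ≤n (r<n ∷ w<n) e with step? ρ r
... | yes (σ , s) = advance-ℓ σ w (step-ℓ s r<n ρ≤n) w<n e

+□-length : ∀ {p r q} → p +□[ r ] q → length p ≤ length q
+□-length new       = z≤n
+□-length here      = ≤-refl
+□-length (there s) = s≤s (+□-length s)

advance-grows : ∀ ρ w {σ} → advance ρ w ≡ just σ → ℓ ρ ≤ ℓ σ
advance-grows ρ []      ≡.refl = ≤-refl
advance-grows ρ (r ∷ w) e with step? ρ r
... | yes (σ , s) = ≤-trans (+□-length s) (advance-grows σ w e)

_≟ₚ_ : (ρ σ : Partition) → Dec (ρ ≡ σ)
ρ ≟ₚ σ with List.≡-dec ℕ._≟_ (parts ρ) (parts σ)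
... | yes e = yes (parts-injective {ρ} {σ} e)
... | no ¬e = no λ { ≡.refl → ¬e ≡.refl }

entryList-length : ∀ {n} (S : Subset n) → length (entryList S) ≡ Subset.∣ S ∣
entryList-length []            = ≡.refl
entryList-length (outside ∷ S) = ≡.trans (≡.cong length (entryList-outside S)) (≡.trans (List.length-map suc (entryList S)) (entryList-length S))
entryList-length (inside ∷ S)  = ≡.trans (≡.cong length (entryList-inside S)) (≡.cong suc (≡.trans (List.length-map suc (entryList S)) (entryList-length S)))

-- Normalising powers of β and comparison of coefficients

module Assembly {c ℓ₁} (K : CommutativeRing c ℓ₁) (β : CommutativeRing.Carrier K) (pow : ℤ → CommutativeRing.Carrier K)
  (pow-0 : CommutativeRing._≈_ K (pow (+ 0)) (CommutativeRing.1# K))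
  (pow-suc : ∀ i → CommutativeRing._≈_ K (pow (ℤ.suc i)) (CommutativeRing._*_ K β (pow i))) where
  private module K = CommutativeRing K
  open RawSemiringDefinitions (RawRing.rawSemiring K.rawRing) using () renaming (_×_ to _×ₖ_)

  pow-cancel : ∀ t i → pow (+ t) K.* pow (i ℤ.- + t) K.≈ pow i
  pow-cancel zero    i = K.trans (K.*-cong pow-0 (K.reflexive (≡.cong pow (ℤ.+-identityʳ i)))) (K.*-identityˡ _)
  pow-cancel (suc t) i = K.trans (K.*-congʳ (K.trans (pow-suc (+ t)) (K.*-comm _ _))) (K.trans (K.*-assoc _ _ _)
    (K.trans (K.*-congˡ (K.trans (K.sym (pow-suc (i ℤ.- + suc t))) (K.reflexive (≡.cong pow shifted)))) (pow-cancel t i)))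
    where
    shifted : ℤ.suc (i ℤ.- + suc t) ≡ i ℤ.- + t
    shifted = ≡.trans (≡.sym (ℤ.+-assoc (+ 1) i (ℤ.- + suc t))) (≡.trans (≡.cong (λ k → k ℤ.+ (ℤ.- + suc t)) (ℤ.+-comm (+ 1) i))
      (≡.trans (ℤ.+-assoc i (+ 1) (ℤ.- + suc t)) (≡.cong (λ k → i ℤ.+ k) (≡.trans (ℤ.m-n≡m⊖n 1 (suc t)) (≡.trans (ℤ.[1+m]⊖[1+n]≡m⊖n 0 t) (≡.trans (≡.sym (ℤ.m-n≡m⊖n 0 t)) (ℤ.+-identityˡ (ℤ.- + t))))))))

  pow-+ : ∀ s t → pow (+ (s ℕ.+ t)) K.≈ pow (+ s) K.* pow (+ t)
  pow-+ zero    t = K.sym (K.trans (K.*-congʳ pow-0) (K.*-identityˡ _))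
  pow-+ (suc s) t = K.trans (pow-suc (+ (s ℕ.+ t))) (K.trans (K.*-congˡ (pow-+ s t))
    (K.trans (K.sym (K.*-assoc _ _ _)) (K.*-congʳ (K.sym (pow-suc (+ s))))))

  pow-1 : pow (+ 1) K.≈ β
  pow-1 = K.trans (pow-suc (+ 0)) (K.trans (K.*-congˡ pow-0) (K.*-identityʳ β))

  inverse : ℕ → K.Carrier
  inverse t = pow (+ 0 ℤ.- + t)

  inverseʳ : ∀ t → pow (+ t) K.* inverse t K.≈ K.1#
  inverseʳ t = K.trans (pow-cancel t (+ 0)) pow-0

  β-cancellable : Cancellable K β
  β-cancellable y e = K.trans (K.sym (K.*-identityˡ y)) (K.trans (K.*-congʳ (K.sym (K.trans (K.*-congʳ (K.sym pow-1)) (inverseʳ 1))))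
    (K.trans (K.*-congʳ (K.*-comm _ _)) (K.trans (K.*-assoc _ _ _) (K.trans (K.*-congˡ e) (K.zeroʳ _)))))

  module I = Independence K β β-cancellable

  ‼-map-constant : ∀ n xs r → CommutativeRing._≈_ (I.Rx (suc n)) (Alternants._‼_ (I.Rx (suc n)) (map (Polynomials.constant (I.Rx n)) xs) r)
                   (Polynomials.constant (I.Rx n) (Alternants._‼_ (I.Rx n) xs r))
  ‼-map-constant n []       r = CommutativeRing.sym (I.Rx (suc n)) (Constants.constant-0 (I.Rx n))
  ‼-map-constant n (x ∷ xs) r with r ℕ.≟ length (map (Polynomials.constant (I.Rx n)) xs) | r ℕ.≟ length xs
  ... | yes _ | yes _ = CommutativeRing.refl (I.Rx (suc n))
  ... | no  _ | no  _ = ‼-map-constant n xs r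
  ... | yes e | no ¬e = ⊥-elim (¬e (≡.trans e (List.length-map _ xs)))
  ... | no ¬e | yes e = ⊥-elim (¬e (≡.trans e (≡.sym (List.length-map _ xs))))

  -- Letters count from the end of a list, whereas `zs` begins with the variable x₁. The symmetry of
  -- `g` later undoes the reversal.
  reverse-zs-‼ : ∀ n i → CommutativeRing._≈_ (I.Rx n) (Alternants._‼_ (I.Rx n) (reverse (I.zs n)) (toℕ i))
                 (CommutativeRing._*_ (I.Rx n) (scalar K n β) (variable-x K n i))
  reverse-zs-‼ (suc n) i rewrite List.unfold-reverse (Polynomials._*ₚ_ (I.Rx n) (scalar K (suc n) β) (Polynomials.X (I.Rx n))) (map (Polynomials.constant (I.Rx n)) (I.zs n))
    | ≡.sym (List.reverse-map (Polynomials.constant (I.Rx n)) (I.zs n)) = go i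
    where
    module P = CommutativeRing (I.Rx (suc n))
    z₀ = Polynomials._*ₚ_ (I.Rx n) (scalar K (suc n) β) (Polynomials.X (I.Rx n))
    zs′ = map (Polynomials.constant (I.Rx n)) (reverse (I.zs n))
    go : ∀ i → Alternants._‼_ (I.Rx (suc n)) (zs′ ++ z₀ ∷ []) (toℕ i) P.≈ scalar K (suc n) β P.* variable-x K (suc n) i
    go zero    = P.reflexive (Alternants.‼-snoc-zero (I.Rx (suc n)) zs′ z₀)
    go (suc i) = P.trans (P.reflexive (Alternants.‼-snoc-suc (I.Rx (suc n)) zs′ z₀ (toℕ i)))
      (P.trans (‼-map-constant n (reverse (I.zs n)) (toℕ i))
      (P.trans (Constants.constant-cong (I.Rx n) (reverse-zs-‼ n i))
               (Constants.constant-* (I.Rx n) (scalar K n β) (variable-x K n i))))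

  fromℕ : ℕ → K.Carrier
  fromℕ m = m ×ₖ K.1#

  module _ (n : ℕ) where
    open CommutativeRing (I.Rx n) hiding (zero)
    open RingProperties ring using (x[y-z]≈xy-xz)
    open GroupProperties +-group using (inverseˡ-unique; x∙y⁻¹≈ε⇒x≈y; x≈y⇒x∙y⁻¹≈ε)
    open Solver commutativeSemiring using (solve)
      renaming (_:=_ to infix 4 _⊜_; _:+_ to infixl 6 _⊕_; _:*_ to infixl 7 _⊗_)
    open Alternants (I.Rx n)
    open import Relation.Binary.Reasoning.Setoid setoid
    open Collect K {n} hiding (evaluate)

    ι : K.Carrier → Carrier
    ι = scalar K n

    x : Fin n → Carrier
    x = variable-x K n

    ∑ : List Ix → (Ix → Carrier) → Carrier
    ∑ is f = foldr (λ i s → f i + s) 0# is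

    ∏ : List Ix → (Ix → Carrier) → Carrier
    ∏ is f = foldr (λ i s → f i * s) 1# is

    abstract
      G : SkewDiagram → Carrier
      G θ = ∑ (tableaux n θ) λ T → ι (pow (size θ T ⊖ ∣ θ ∣ₛ)) * ∏ (entries θ T) x

      G-∑ : ∀ θ → G θ ≡ ∑ (tableaux n θ) λ T → ι (pow (size θ T ⊖ ∣ θ ∣ₛ)) * ∏ (entries θ T) x
      G-∑ θ = ≡.refl

    ∑-cong : ∀ (xs : List Ix) {f g : Ix → Carrier} → (∀ x → f x ≈ g x) → ∑ xs f ≈ ∑ xs g
    ∑-cong []       e = refl
    ∑-cong (x ∷ xs) e = +-cong (e x) (∑-cong xs e)

    ∑-* : ∀ (xs : List Ix) a f → a * ∑ xs f ≈ ∑ xs (λ x → a * f x)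
    ∑-* []       a f = zeroʳ a
    ∑-* (x ∷ xs) a f = trans (distribˡ _ _ _) (+-congˡ (∑-* xs a f))

    ∏-++ : ∀ (xs ys : List Ix) (f : Ix → Carrier) → ∏ (xs ++ ys) f ≈ ∏ xs f * ∏ ys f
    ∏-++ []       ys f = sym (*-identityˡ _)
    ∏-++ (x ∷ xs) ys f = trans (*-congˡ (∏-++ xs ys f)) (sym (*-assoc _ _ _))

    ι-* : ∀ a b → ι (a K.* b) ≈ ι a * ι b
    ι-* = I.ι-* n

    ι-cancelˡ : ∀ t {y z} → ι (pow (+ t)) * y ≈ ι (pow (+ t)) * z → y ≈ z
    ι-cancelˡ t {y} {z} e = trans (sym (undo y)) (trans (*-congˡ e) (undo z))
      where
      undo : ∀ y → ι (inverse t) * (ι (pow (+ t)) * y) ≈ y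
      undo y = trans (sym (*-assoc _ _ _)) (trans (*-congʳ (trans (sym (ι-* _ _))
        (trans (I.ι-cong n (K.trans (K.*-comm _ _) (inverseʳ t))) (I.ι-1 n)))) (*-identityˡ y))

    cancelʳ : ∀ {a y z} → Cancellable (I.Rx n) a → y * a ≈ z * a → y ≈ z
    cancelʳ {a} {y} {z} ca e = x∙y⁻¹≈ε⇒x≈y y z (ca (y - z) (trans (x[y-z]≈xy-xz a y z)
      (x≈y⇒x∙y⁻¹≈ε (trans (*-comm _ _) (trans e (*-comm _ _))))))

    module Monomials (θ : SkewDiagram) where
      open Shape θ using (top; bottom)
      open Words (I.Rx n) n top bottom using (mon)

      ζ : ℕ → Carrier
      ζ = reverse (I.zs n) ‼_

      mon-++ : ∀ v w → mon ζ (v ++ w) ≈ mon ζ v * mon ζ w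
      mon-++ []      w = sym (*-identityˡ _)
      mon-++ (r ∷ v) w = trans (*-congˡ (mon-++ v w)) (sym (*-assoc _ _ _))

      mon-reverse : ∀ is → mon ζ (map toℕ (reverse is)) ≈ ι (pow (+ length is)) * ∏ is x
      mon-reverse [] = sym (trans (*-identityʳ _) (trans (I.ι-cong n pow-0) (I.ι-1 n)))
      mon-reverse (i ∷ is) = begin
        mon ζ (map toℕ (reverse (i ∷ is)))
          ≈⟨ reflexive (≡.cong (mon ζ) (≡.trans (≡.cong (map toℕ) (List.unfold-reverse i is)) (List.map-++ toℕ (reverse is) (i ∷ [])))) ⟩
        mon ζ (map toℕ (reverse is) ++ toℕ i ∷ [])
          ≈⟨ mon-++ (map toℕ (reverse is)) (toℕ i ∷ []) ⟩
        mon ζ (map toℕ (reverse is)) * (ζ (toℕ i) * 1#)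
          ≈⟨ *-cong (mon-reverse is) (trans (*-identityʳ _) (reverse-zs-‼ n i)) ⟩
        (ι (pow (+ length is)) * ∏ is x) * (ι β * x i)
          ≈⟨ solve 4 (λ p q b y → (p ⊗ q) ⊗ (b ⊗ y) ⊜ (b ⊗ p) ⊗ (y ⊗ q)) refl _ _ _ _ ⟩
        (ι β * ι (pow (+ length is))) * (x i * ∏ is x)
          ≈⟨ *-congʳ (trans (sym (ι-* _ _)) (I.ι-cong n (K.sym (pow-suc (+ length is))))) ⟩
        ι (pow (+ suc (length is))) * (x i * ∏ is x) ∎

      mon-column : ∀ (Ss : List (Subset n)) → mon ζ (map toℕ (concatMap (λ S → reverse (elements S)) Ss)) ≈
                   ι (pow (+ sum (map Subset.∣_∣ Ss))) * ∏ (concatMap elements Ss) x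
      mon-column [] = sym (trans (*-identityʳ _) (trans (I.ι-cong n pow-0) (I.ι-1 n)))
      mon-column (S ∷ Ss) = begin
        mon ζ (map toℕ (reverse (elements S) ++ concatMap (λ S → reverse (elements S)) Ss))
          ≈⟨ reflexive (≡.cong (mon ζ) (List.map-++ toℕ (reverse (elements S)) _)) ⟩
        mon ζ (map toℕ (reverse (elements S)) ++ map toℕ (concatMap (λ S → reverse (elements S)) Ss))
          ≈⟨ mon-++ (map toℕ (reverse (elements S))) _ ⟩
        mon ζ (map toℕ (reverse (elements S))) * mon ζ (map toℕ (concatMap (λ S → reverse (elements S)) Ss))
          ≈⟨ *-cong (mon-reverse (elements S)) (mon-column Ss) ⟩
        (ι (pow (+ length (elements S))) * ∏ (elements S) x) * (ι (pow (+ m)) * ∏ (concatMap elements Ss) x)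
          ≈⟨ *-congʳ (*-congʳ (reflexive (≡.cong (λ k → ι (pow (+ k))) size-S))) ⟩
        (ι (pow (+ Subset.∣ S ∣)) * ∏ (elements S) x) * (ι (pow (+ m)) * ∏ (concatMap elements Ss) x)
          ≈⟨ solve 4 (λ p q r s → (p ⊗ q) ⊗ (r ⊗ s) ⊜ (p ⊗ r) ⊗ (q ⊗ s)) refl _ _ _ _ ⟩
        (ι (pow (+ Subset.∣ S ∣)) * ι (pow (+ m))) * (∏ (elements S) x * ∏ (concatMap elements Ss) x)
          ≈⟨ *-cong (trans (sym (ι-* _ _)) (I.ι-cong n (K.sym (pow-+ Subset.∣ S ∣ m)))) (sym (∏-++ (elements S) _ x)) ⟩
        ι (pow (+ (Subset.∣ S ∣ ℕ.+ m))) * ∏ (elements S ++ concatMap elements Ss) x ∎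
        where
        m = sum (map Subset.∣_∣ Ss)
        size-S : length (elements S) ≡ Subset.∣ S ∣
        size-S = ≡.trans (≡.sym (List.length-map toℕ (elements S))) (entryList-length S)

      open Products (I.Rx n) n (I.zs n) (I.zs-length n) θ using (g; g-↭)

      scaled : ι (pow (+ ∣ θ ∣ₛ)) * G θ ≈ g (I.zs n)
      scaled = begin
        ι (pow (+ ∣ θ ∣ₛ)) * G θ
          ≈⟨ trans (*-congˡ (reflexive (G-∑ θ))) (∑-* (tableaux n θ) _ _) ⟩
        ∑ (tableaux n θ) (λ T → ι (pow (+ ∣ θ ∣ₛ)) * (ι (pow (size θ T ⊖ ∣ θ ∣ₛ)) * ∏ (entries θ T) x))
          ≈⟨ ∑-cong (tableaux n θ) (λ T → trans (sym (*-assoc _ _ _)) (trans (*-congʳ (trans (sym (ι-* _ _))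
               (I.ι-cong n (K.trans (K.*-congˡ (K.reflexive (≡.cong pow (≡.sym (ℤ.m-n≡m⊖n (size θ T) ∣ θ ∣ₛ))))) (pow-cancel ∣ θ ∣ₛ (+ size θ T))))))
               (sym (mon-column (toList T))))) ⟩
        ∑ (tableaux n θ) (λ T → mon ζ (map toℕ (columnWord θ T)))
          ≈⟨ TableauSums.∑-tableaux (I.Rx n) n θ (mon ζ) ⟩
        g (reverse (I.zs n))
          ≈⟨ g-↭ (↭-reverse (I.zs n)) ⟩
        g (I.zs n) ∎

    eval : Terms → Carrier
    eval = I.eval n (I.alternant n)

    negate : Terms → Terms
    negate = map (λ (a , ds) → K.- a , ds)

    collect-negate : ∀ ds L → collect ds (negate L) K.≈ K.- collect ds L
    collect-negate ds [] = K.sym (RingProperties.-0#≈0# K.ring)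
    collect-negate ds ((a , es) ∷ L) with es ≟ᵥ ds
    ... | yes _ = K.trans (K.+-congˡ (collect-negate ds L)) (RingProperties.-‿+-comm K.ring a (collect ds L))
    ... | no  _ = collect-negate ds L

    collect-++ : ∀ ds L M → collect ds (L ++ M) K.≈ collect ds L K.+ collect ds M
    collect-++ ds [] M = K.sym (K.+-identityˡ _)
    collect-++ ds ((a , es) ∷ L) M with es ≟ᵥ ds
    ... | yes _ = K.trans (K.+-congˡ (collect-++ ds L M)) (K.sym (K.+-assoc _ _ _))
    ... | no  _ = collect-++ ds L M

    ι-neg : ∀ a → ι (K.- a) ≈ - ι a
    ι-neg a = inverseˡ-unique (ι (K.- a)) (ι a) (trans (sym (I.ι-+ n (K.- a) a)) (trans (I.ι-cong n (K.-‿inverseˡ a)) (I.ι-0 n)))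

    eval-negate : ∀ L → eval (negate L) ≈ - eval L
    eval-negate [] = sym -0#≈0#
      where open RingProperties ring using (-0#≈0#)
    eval-negate ((a , ds) ∷ L) = trans (+-cong (trans (*-congʳ (ι-neg a)) (sym (-‿distribˡ-* _ _))) (eval-negate L)) (-‿+-comm _ _)
      where open RingProperties ring using (-‿distribˡ-*; -‿+-comm)

    eval-difference : ∀ L M → eval (L ++ negate M) ≈ eval L - eval M
    eval-difference L M = trans (Collect.evaluate-++ K (I.Rx n) (I.ι n) (I.ι-cong n) (I.ι-0 n) (I.ι-+ n) (I.alternant n) L (negate M)) (+-congˡ (eval-negate M))

    collect-difference : ∀ ds L M → collect ds (L ++ negate M) K.≈ collect ds L K.- collect ds M
    collect-difference ds L M = K.trans (collect-++ ds L (negate M)) (K.+-congˡ (collect-negate ds M))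

    eval-injective : ∀ L M → eval L ≈ eval M → ∀ ds → collect ds L K.≈ collect ds M
    eval-injective L M e ds = GroupProperties.x∙y⁻¹≈ε⇒x≈y K.+-group _ _ (K.trans (K.sym (collect-difference ds L M))
      (I.independent n (L ++ negate M) (trans (eval-difference L M) (x≈y⇒x∙y⁻¹≈ε e)) ds))

    eval-respects : ∀ L M → (∀ ds → collect ds L K.≈ collect ds M) → eval L ≈ eval M
    eval-respects L M e = x∙y⁻¹≈ε⇒x≈y _ _ (trans (sym (eval-difference L M))
      (I.eval-vanishes n (I.alternant n) (L ++ negate M) λ ds → K.trans (collect-difference ds L M) (GroupProperties.x≈y⇒x∙y⁻¹≈ε K.+-group (e ds))))

    module _ (f : Partition → K.Carrier) where

      terms : List Partition → Terms
      terms = map (λ σ → f σ , steps n σ)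

      collect-terms-∉ : ∀ S {ν} → All (λ σ → ℓ σ ≤ n) S → ℓ ν ≤ n → ν ∉ S → collect (steps n ν) (terms S) K.≈ K.0#
      collect-terms-∉ [] _ _ _ = K.refl
      collect-terms-∉ (σ ∷ S) {ν} (σ≤n ∷ S≤n) ν≤n ν∉ with steps n σ ≟ᵥ steps n ν
      ... | yes e = ⊥-elim (ν∉ (here (≡.sym (steps-injective σ≤n ν≤n e))))
      ... | no _  = collect-terms-∉ S S≤n ν≤n (ν∉ ∘ there)

      collect-terms-∈ : ∀ S {ν} → Unique S → All (λ σ → ℓ σ ≤ n) S → ν ∈ S → collect (steps n ν) (terms S) K.≈ f ν
      collect-terms-∈ (σ ∷ S) {ν} (fresh ∷ u) (σ≤n ∷ S≤n) ν∈ with steps n σ ≟ᵥ steps n ν | ν∈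
      ... | yes _ | here ≡.refl = K.trans (K.+-congˡ (collect-terms-∉ S S≤n σ≤n λ σ∈S → All.lookup fresh σ∈S ≡.refl)) (K.+-identityʳ _)
      ... | no ¬e | here ≡.refl = ⊥-elim (¬e ≡.refl)
      ... | yes e | there ν∈S = ⊥-elim (All.lookup fresh ν∈S (steps-injective σ≤n (All.lookup S≤n ν∈S) e))
      ... | no _  | there ν∈S = collect-terms-∈ S u S≤n ν∈S

      collect-terms-else : ∀ S {ds} → (∀ σ → σ ∈ S → steps n σ ≢ ds) → collect ds (terms S) K.≈ K.0#
      collect-terms-else [] _ = K.refl
      collect-terms-else (σ ∷ S) {ds} ne with steps n σ ≟ᵥ ds
      ... | yes e = ⊥-elim (ne σ (here ≡.refl) e)
      ... | no _  = collect-terms-else S λ τ τ∈S → ne τ (there τ∈S)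

    A : Partition → Carrier
    A = Values.A (I.Rx n) n (I.zs n)

    A-alternant : ∀ ρ → A ρ ≈ I.alternant n (steps n ρ)
    A-alternant ρ = Alt-cong n (I.zs n) λ ys p → trans (W-V (I.Rx n) (rowLength-anti ρ) ys 0 (λ _ _ → z≤n))
      (trans (*-identityˡ _) (reflexive (≡.cong (λ m → V (I.Rx n) (differences (rowLength ρ) 0 m) ys) (≡.trans (↭-length p) (I.zs-length n)))))

    A∅-cancellable : Cancellable (I.Rx n) (A ∅)
    A∅-cancellable = Cancellability.Cancellable-≈ (I.Rx n) (sym (trans (A-alternant ∅) (reflexive (≡.cong (I.alternant n) (steps-∅ n)))))
      (I.alternant-cancellable n)

    straight-alternant : ∀ ν → ℓ ν ≤ n → ι (pow (+ ∣ ν ∣ₚ)) * (G (straight ν) * A ∅) ≈ A ν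
    straight-alternant ν ν≤n = trans (sym (*-assoc _ _ _)) (trans (*-congʳ (trans
      (*-congʳ (reflexive (≡.cong (λ k → ι (pow (+ k))) (≡.sym (straight-size ν))))) (Monomials.scaled (straight ν))))
      (StraightProducts.straight-product (I.Rx n) n (I.zs n) (I.zs-length n) ν ν≤n))

    straight-zero : ∀ ν → n < ℓ ν → G (straight ν) ≈ 0#
    straight-zero ν n<ν = ι-cancelˡ ∣ straight ν ∣ₛ (trans (Monomials.scaled (straight ν))
      (trans (StraightProducts.straight-vanishes (I.Rx n) n (I.zs n) (I.zs-length n) ν n<ν) (sym (zeroʳ _))))

    module Expansion (θ : SkewDiagram) (μ : Partition) where

      end : Filling n θ → Maybe Partition
      end T = advance μ (map toℕ (columnWord θ T))

      multiplicity : Partition → ℕ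
      multiplicity = numberOfTableaux n θ μ

      counted : (σ : Partition) → Dec (ℓ σ ≤ n) → K.Carrier × Vec ℕ n
      counted σ (yes _) = K.1# , steps n σ
      counted σ (no  _) = K.0# , steps n σ

      -- Failed words and ends with more than n rows stay in the list with coefficient 0, so their
      -- index is immaterial and `ends` runs parallel to the tableaux.
      term : Maybe Partition → K.Carrier × Vec ℕ n
      term nothing  = K.0# , steps n ∅
      term (just σ) = counted σ (ℓ σ ℕ.≤? n)

      ends : Terms
      ends = map (term ∘ end) (tableaux n θ)

      B : K.Carrier
      B = pow (+ ∣ θ ∣ₛ) K.* pow (+ ∣ μ ∣ₚ)

      ιB-assoc : ∀ y → ι B * y ≈ ι (pow (+ ∣ θ ∣ₛ)) * (ι (pow (+ ∣ μ ∣ₚ)) * y)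
      ιB-assoc y = trans (*-congʳ (ι-* _ _)) (*-assoc _ _ _)

      ιB-cancelˡ : ∀ {y z} → ι B * y ≈ ι B * z → y ≈ z
      ιB-cancelˡ {y} {z} e = ι-cancelˡ ∣ μ ∣ₚ (ι-cancelˡ ∣ θ ∣ₛ (trans (sym (ιB-assoc y)) (trans e (ιB-assoc z))))

      word-bounded : ∀ T → All (_< n) (map toℕ (columnWord θ T))
      word-bounded T = All.map⁺ (All.universal Fin.toℕ<n (columnWord θ T))

      eval-map : ∀ Ts {h : Filling n θ → Carrier} → (∀ T → h T ≈ ι (proj₁ (term (end T))) * I.alternant n (proj₂ (term (end T)))) →
                 ∑ Ts h ≈ eval (map (term ∘ end) Ts)
      eval-map []       e = refl
      eval-map (T ∷ Ts) e = +-cong (e T) (eval-map Ts e)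

      ι0* : ∀ y → ι K.0# * y ≈ 0#
      ι0* y = trans (*-congʳ (I.ι-0 n)) (zeroˡ y)

      product-ends-≤ : ℓ μ ≤ n → ι B * ((G θ * G (straight μ)) * A ∅) ≈ eval ends
      product-ends-≤ μ≤n = begin
        ι B * ((G θ * G (straight μ)) * A ∅)
          ≈⟨ trans (ιB-assoc _) (solve 5 (λ p q x y z → p ⊗ (q ⊗ ((x ⊗ y) ⊗ z)) ⊜ (p ⊗ x) ⊗ (q ⊗ (y ⊗ z))) refl _ _ _ _ _) ⟩
        (ι (pow (+ ∣ θ ∣ₛ)) * G θ) * (ι (pow (+ ∣ μ ∣ₚ)) * (G (straight μ) * A ∅))
          ≈⟨ *-cong (Monomials.scaled θ) (straight-alternant μ μ≤n) ⟩
        Products.g (I.Rx n) n (I.zs n) (I.zs-length n) θ (I.zs n) * A μ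
          ≈⟨ Products.product (I.Rx n) n (I.zs n) (I.zs-length n) θ μ ⟩
        ∑ (tableaux n θ) (λ T → Values.value (I.Rx n) n (I.zs n) (end T))
          ≈⟨ eval-map (tableaux n θ) (λ T → each (end T) (λ σ → advance-ℓ μ (map toℕ (columnWord θ T)) μ≤n (word-bounded T))) ⟩
        eval ends ∎
        where
        each : ∀ m → (∀ σ → m ≡ just σ → ℓ σ ≤ n) → Values.value (I.Rx n) n (I.zs n) m ≈ ι (proj₁ (term m)) * I.alternant n (proj₂ (term m))
        each nothing  _ = sym (ι0* _)
        each (just σ) b = by (ℓ σ ℕ.≤? n)
          where
          by : (d : Dec (ℓ σ ≤ n)) → A σ ≈ ι (proj₁ (counted σ d)) * I.alternant n (proj₂ (counted σ d))
          by (yes _)  = trans (A-alternant σ) (sym (trans (*-congʳ (I.ι-1 n)) (*-identityˡ _)))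
          by (no σ≰n) = ⊥-elim (σ≰n (b σ ≡.refl))

      -- Both sides are 0: the polynomial of μ vanishes because its first column is too long, and a
      -- path never loses rows, so every end has more than n rows.
      product-ends-≰ : ¬ (ℓ μ ≤ n) → ι B * ((G θ * G (straight μ)) * A ∅) ≈ eval ends
      product-ends-≰ μ≰n = trans (trans (*-congˡ (trans (*-congʳ (trans (*-congˡ (straight-zero μ (≰⇒> μ≰n))) (zeroʳ _))) (zeroˡ _))) (zeroʳ _))
          (trans (sym (∑-0 (tableaux n θ))) (eval-map (tableaux n θ) λ T → each (end T) λ σ → advance-grows μ (map toℕ (columnWord θ T))))
        where
        ∑-0 : ∀ (xs : List (Filling n θ)) → ∑ xs (λ _ → 0#) ≈ 0#
        ∑-0 []       = refl
        ∑-0 (x ∷ xs) = trans (+-identityˡ _) (∑-0 xs)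
        each : ∀ m → (∀ σ → m ≡ just σ → ℓ μ ≤ ℓ σ) → 0# ≈ ι (proj₁ (term m)) * I.alternant n (proj₂ (term m))
        each nothing  _ = sym (ι0* _)
        each (just σ) b = by (ℓ σ ℕ.≤? n)
          where
          by : (d : Dec (ℓ σ ≤ n)) → 0# ≈ ι (proj₁ (counted σ d)) * I.alternant n (proj₂ (counted σ d))
          by (yes σ≤n) = ⊥-elim (μ≰n (≤-trans (b σ ≡.refl) σ≤n))
          by (no _)    = sym (ι0* _)

      product-ends : ι B * ((G θ * G (straight μ)) * A ∅) ≈ eval ends
      product-ends = by (ℓ μ ℕ.≤? n)
        where
        by : Dec (ℓ μ ≤ n) → ι B * ((G θ * G (straight μ)) * A ∅) ≈ eval ends
        by (yes μ≤n) = product-ends-≤ μ≤n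
        by (no μ≰n) = product-ends-≰ μ≰n

      collect-0 : ∀ ds es L → collect ds ((K.0# , es) ∷ L) K.≈ collect ds L
      collect-0 ds es L with es ≟ᵥ ds
      ... | yes _ = K.+-identityˡ _
      ... | no  _ = K.refl

      collect-1 : ∀ ds L → collect ds ((K.1# , ds) ∷ L) K.≈ K.1# K.+ collect ds L
      collect-1 ds L with ds ≟ᵥ ds
      ... | yes _ = K.refl
      ... | no ¬e = ⊥-elim (¬e ≡.refl)

      collect-≢ : ∀ {ds es} a L → es ≢ ds → collect ds ((a , es) ∷ L) K.≈ collect ds L
      collect-≢ {ds} {es} a L ne with es ≟ᵥ ds
      ... | yes e = ⊥-elim (ne e)
      ... | no _  = K.refl

      collect-skip : ∀ m ds L → (∀ σ → m ≡ just σ → ℓ σ ≤ n → steps n σ ≢ ds) → collect ds (term m ∷ L) K.≈ collect ds L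
      collect-skip nothing  ds L _  = collect-0 ds (steps n ∅) L
      collect-skip (just σ) ds L ne = by (ℓ σ ℕ.≤? n)
        where
        by : (d : Dec (ℓ σ ≤ n)) → collect ds (counted σ d ∷ L) K.≈ collect ds L
        by (yes σ≤n) = collect-≢ K.1# L (ne σ ≡.refl σ≤n)
        by (no _)    = collect-0 ds (steps n σ) L

      collect-hit : ∀ ν L → ℓ ν ≤ n → collect (steps n ν) (term (just ν) ∷ L) K.≈ K.1# K.+ collect (steps n ν) L
      collect-hit ν L ν≤n = by (ℓ ν ℕ.≤? n)
        where
        by : (d : Dec (ℓ ν ≤ n)) → collect (steps n ν) (counted ν d ∷ L) K.≈ K.1# K.+ collect (steps n ν) L
        by (yes _)  = collect-1 (steps n ν) L
        by (no ν≰n) = ⊥-elim (ν≰n ν≤n)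

      collect-ends : ∀ ν → ℓ ν ≤ n → collect (steps n ν) ends K.≈ fromℕ (multiplicity ν)
      collect-ends ν ν≤n = go (tableaux n θ)
        where
        go : ∀ Ts → collect (steps n ν) (map (term ∘ end) Ts) K.≈ fromℕ (length (filter (λ T → path? μ (map toℕ (columnWord θ T)) ν) Ts))
        go [] = K.refl
        go (T ∷ Ts) with path? μ (map toℕ (columnWord θ T)) ν
        ... | yes p = K.trans (K.reflexive (≡.cong (λ m → collect (steps n ν) (term m ∷ map (term ∘ end) Ts)) (Path⇒advance μ _ p)))
                (K.trans (collect-hit ν _ ν≤n) (K.+-congˡ (go Ts)))
        ... | no ¬p = K.trans (collect-skip (end T) (steps n ν) _ λ σ e σ≤n eq →
                ¬p (≡.subst (Path μ (map toℕ (columnWord θ T))) (steps-injective σ≤n ν≤n eq) (advance⇒Path μ _ e))) (go Ts)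

      exponent : Partition → ℤ
      exponent ν = + ∣ ν ∣ₚ ℤ.- + ∣ μ ∣ₚ ℤ.- + ∣ θ ∣ₛ

      B-exponent : ∀ ν → B K.* pow (exponent ν) K.≈ pow (+ ∣ ν ∣ₚ)
      B-exponent ν = K.trans (K.*-congʳ (K.*-comm _ _)) (K.trans (K.*-assoc _ _ _)
        (K.trans (K.*-congˡ (pow-cancel ∣ θ ∣ₛ _)) (pow-cancel ∣ μ ∣ₚ _)))

      coefficient : Partition → K.Carrier
      coefficient ν = pow (exponent ν) K.* fromℕ (multiplicity ν)

      -- Since β^|σ| G_σ A_∅ = A_σ, a combination of the G_σ becomes one of alternants. The
      -- hypothesis relates the two families of coefficients, so the lemma serves both given
      -- coefficients and tableau counts.
      scaled-sum : ∀ (f coef : Partition → K.Carrier) → (∀ σ → f σ K.* pow (+ ∣ σ ∣ₚ) K.≈ B K.* coef σ) → ∀ S → All (λ σ → ℓ σ ≤ n) S →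
                   eval (terms f S) ≈ ι B * (∑ S (λ ν → ι (coef ν) * G (straight ν)) * A ∅)
      scaled-sum f coef scale [] _ = sym (trans (*-congˡ (zeroˡ _)) (zeroʳ _))
      scaled-sum f coef scale (σ ∷ S) (σ≤n ∷ S≤n) = begin
        ι (f σ) * I.alternant n (steps n σ) + eval (terms f S)
          ≈⟨ +-cong (*-congˡ (trans (sym (A-alternant σ)) (sym (straight-alternant σ σ≤n)))) (scaled-sum f coef scale S S≤n) ⟩
        ι (f σ) * (ι (pow (+ ∣ σ ∣ₚ)) * (G (straight σ) * A ∅)) + ι B * (Σ′ * A ∅)
          ≈⟨ +-congʳ (trans (sym (*-assoc _ _ _)) (*-congʳ (trans (sym (ι-* _ _)) (trans (I.ι-cong n (scale σ)) (ι-* _ _))))) ⟩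
        (ι B * ι (coef σ)) * (G (straight σ) * A ∅) + ι B * (Σ′ * A ∅)
          ≈⟨ solve 5 (λ b c g a s → (b ⊗ c) ⊗ (g ⊗ a) ⊕ b ⊗ (s ⊗ a) ⊜ b ⊗ ((c ⊗ g ⊕ s) ⊗ a)) refl (ι B) (ι (coef σ)) (G (straight σ)) (A ∅) Σ′ ⟩
        ι B * ((ι (coef σ) * G (straight σ) + Σ′) * A ∅) ∎
        where
        Σ′ = ∑ S (λ ν → ι (coef ν) * G (straight ν))

      -- After multiplication by B and A_∅ the given expansion and `ends` are two combinations of
      -- alternants with the same value, so independence identifies the coefficients of A_ν.
      expansion-unique : ∀ (coef : Partition → K.Carrier) (support : List Partition) → Unique support → All (λ ν → ℓ ν ≤ n) support →
        (∀ ν → ℓ ν ≤ n → ν ∉ support → coef ν K.≈ K.0#) →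
        G θ * G (straight μ) ≈ ∑ support (λ ν → ι (coef ν) * G (straight ν)) →
        ∀ ν → ℓ ν ≤ n → coef ν K.≈ coefficient ν
      expansion-unique coef support unique bounded vanishes expands ν ν≤n = K.trans (K.sym (rescale ν))
        (K.*-congˡ (K.trans (K.sym collected) (K.trans (eval-injective L ends evaluated (steps n ν)) (collect-ends ν ν≤n))))
        where
        c′ : Partition → K.Carrier
        c′ σ = B K.* (coef σ K.* inverse ∣ σ ∣ₚ)
        L = terms c′ support
        c′-scale : ∀ σ → c′ σ K.* pow (+ ∣ σ ∣ₚ) K.≈ B K.* coef σ
        c′-scale σ = K.trans (K.*-assoc _ _ _) (K.*-congˡ (K.trans (K.*-assoc _ _ _)
          (K.trans (K.*-congˡ (K.trans (K.*-comm _ _) (inverseʳ ∣ σ ∣ₚ))) (K.*-identityʳ _))))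
        rescale : ∀ σ → pow (exponent σ) K.* c′ σ K.≈ coef σ
        rescale σ = K.trans (K.sym (K.*-assoc _ _ _)) (K.trans (K.*-congʳ (K.trans (K.*-comm _ _) (B-exponent σ)))
          (K.trans (K.*-comm _ _) (K.trans (K.*-assoc _ _ _) (K.trans (K.*-congˡ (K.trans (K.*-comm _ _) (inverseʳ ∣ σ ∣ₚ))) (K.*-identityʳ _)))))
        collected : collect (steps n ν) L K.≈ c′ ν
        collected = by (any? (ν ≟ₚ_) support)
          where
          by : Dec (ν ∈ support) → collect (steps n ν) L K.≈ c′ ν
          by (yes ν∈) = collect-terms-∈ c′ support unique bounded ν∈
          by (no ν∉) = K.trans (collect-terms-∉ c′ support bounded ν≤n ν∉)
                (K.sym (K.trans (K.*-congˡ (K.trans (K.*-congʳ (vanishes ν ν≤n ν∉)) (K.zeroˡ _))) (K.zeroʳ _)))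
        evaluated : eval L ≈ eval ends
        evaluated = begin
          eval L
            ≈⟨ scaled-sum c′ coef c′-scale support bounded ⟩
          ι B * (∑ support (λ ν → ι (coef ν) * G (straight ν)) * A ∅)
            ≈⟨ *-congˡ {ι B} (*-congʳ {A ∅} (sym expands)) ⟩
          ι B * ((G θ * G (straight μ)) * A ∅)
            ≈⟨ product-ends ⟩
          eval ends ∎

      reached : List (Filling n θ) → List Partition
      reached [] = []
      reached (T ∷ Ts) with end T
      ... | nothing = reached Ts
      ... | just σ with ℓ σ ℕ.≤? n
      ...   | yes _ = σ ∷ reached Ts
      ...   | no  _ = reached Ts

      reached-bounded : ∀ Ts → All (λ σ → ℓ σ ≤ n) (reached Ts)
      reached-bounded [] = []
      reached-bounded (T ∷ Ts) with end T
      ... | nothing = reached-bounded Ts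
      ... | just σ with ℓ σ ℕ.≤? n
      ...   | yes σ≤n = σ≤n ∷ reached-bounded Ts
      ...   | no  _ = reached-bounded Ts

      support : List Partition
      support = deduplicate _≟ₚ_ (reached (tableaux n θ))

      support-bounded : All (λ ν → ℓ ν ≤ n) support
      support-bounded = All.tabulate λ ν∈ → All.lookup (reached-bounded (tableaux n θ)) (∈-deduplicate⁻ _≟ₚ_ (reached (tableaux n θ)) ν∈)

      collect-unreached : ∀ Ts ds → (∀ σ → σ ∈ reached Ts → steps n σ ≢ ds) → collect ds (map (term ∘ end) Ts) K.≈ K.0#
      collect-unreached [] ds ne = K.refl
      collect-unreached (T ∷ Ts) ds ne with end T
      ... | nothing = K.trans (collect-skip nothing ds _ (λ _ ())) (collect-unreached Ts ds ne)
      ... | just σ with ℓ σ ℕ.≤? n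
      ...   | yes _ = K.trans (collect-≢ K.1# _ (ne σ (here ≡.refl))) (collect-unreached Ts ds λ τ τ∈ → ne τ (there τ∈))
      ...   | no  _ = K.trans (collect-0 ds (steps n σ) (map (term ∘ end) Ts)) (collect-unreached Ts ds ne)

      coefficient-vanishes : ∀ ν → ℓ ν ≤ n → ν ∉ support → coefficient ν K.≈ K.0#
      coefficient-vanishes ν ν≤n ν∉ = K.trans (K.*-congˡ (K.trans (K.sym (collect-ends ν ν≤n))
        (collect-unreached (tableaux n θ) (steps n ν) λ σ σ∈ e → ν∉ (∈-deduplicate⁺ _≟ₚ_
          (≡.subst (_∈ reached (tableaux n θ)) (steps-injective (All.lookup (reached-bounded (tableaux n θ)) σ∈) ν≤n e) σ∈))))) (K.zeroʳ _)

      -- Here equality of formal coefficients yields equality of values, and A_∅ and then B are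
      -- cancelled.
      expands : G θ * G (straight μ) ≈ ∑ support (λ ν → ι (coefficient ν) * G (straight ν))
      expands = cancelʳ A∅-cancellable (ιB-cancelˡ (begin
        ι B * ((G θ * G (straight μ)) * A ∅)
          ≈⟨ product-ends ⟩
        eval ends
          ≈⟨ sym (eval-respects L ends same) ⟩
        eval L
          ≈⟨ scaled-sum N coefficient scale support support-bounded ⟩
        ι B * (∑ support (λ ν → ι (coefficient ν) * G (straight ν)) * A ∅) ∎))
        where
        N : Partition → K.Carrier
        N ν = fromℕ (multiplicity ν)
        L = terms N support
        same : ∀ ds → collect ds L K.≈ collect ds ends
        same ds = by (any? (λ σ → steps n σ ≟ᵥ ds) support)
          where
          satisfied : ∀ {S} → Any (λ σ → steps n σ ≡ ds) S → ∃ λ σ → σ ∈ S × steps n σ ≡ ds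
          satisfied (here e)  = _ , here ≡.refl , e
          satisfied (there p) with satisfied p
          ... | σ , σ∈ , e = σ , there σ∈ , e
          hit : ∃ (λ σ → σ ∈ support × steps n σ ≡ ds) → collect ds L K.≈ collect ds ends
          hit (σ , σ∈ , ≡.refl) = K.trans (collect-terms-∈ N support (Unique.deduplicate-! _≟ₚ_ (reached (tableaux n θ))) support-bounded σ∈)
            (K.sym (collect-ends σ (All.lookup support-bounded σ∈)))
          by : Dec (Any (λ σ → steps n σ ≡ ds) support) → collect ds L K.≈ collect ds ends
          by (yes found) = hit (satisfied found)
          by (no ¬found) = K.trans (collect-terms-else N support λ σ σ∈ e → ¬found (lose σ∈ e))
            (K.sym (collect-unreached (tableaux n θ) ds λ σ σ∈ e → ¬found (lose (∈-deduplicate⁺ _≟ₚ_ σ∈) e)))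
        scale : ∀ σ → N σ K.* pow (+ ∣ σ ∣ₚ) K.≈ B K.* coefficient σ
        scale σ = K.trans (K.*-comm _ _) (K.trans (K.*-congʳ (K.sym (B-exponent σ))) (K.*-assoc _ _ _))

    module _ (θ : SkewDiagram) (μ : Partition) where
      private
        module E = Expansion θ μ
        G∑ : SkewDiagram → Carrier
        G∑ θ = ∑ (tableaux n θ) λ T → ι (pow (size θ T ⊖ ∣ θ ∣ₛ)) * ∏ (entries θ T) x

        unfold-product : G θ * G (straight μ) ≈ G∑ θ * G∑ (straight μ)
        unfold-product = *-cong (reflexive (G-∑ θ)) (reflexive (G-∑ (straight μ)))

        unfold-sum : ∀ (S : List Partition) (coef : Partition → K.Carrier) → ∑ S (λ ν → ι (coef ν) * G (straight ν)) ≈ ∑ S (λ ν → ι (coef ν) * G∑ (straight ν))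
        unfold-sum S coef = ∑-cong S λ ν → *-congˡ (reflexive (G-∑ (straight ν)))

      expands-∑ : G∑ θ * G∑ (straight μ) ≈ ∑ E.support (λ ν → ι (E.coefficient ν) * G∑ (straight ν))
      expands-∑ = trans (sym unfold-product) (trans E.expands (unfold-sum E.support E.coefficient))

      expansion-unique-∑ : ∀ (coef : Partition → K.Carrier) (support : List Partition) → Unique support → All (λ ν → ℓ ν ≤ n) support →
        (∀ ν → ℓ ν ≤ n → ν ∉ support → coef ν K.≈ K.0#) →
        G∑ θ * G∑ (straight μ) ≈ ∑ support (λ ν → ι (coef ν) * G∑ (straight ν)) →
        ∀ ν → ℓ ν ≤ n → coef ν K.≈ E.coefficient ν
      expansion-unique-∑ coef support unique bounded vanishes e =
        E.expansion-unique coef support unique bounded vanishes (trans unfold-product (trans e (sym (unfold-sum support coef))))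

-- Powers of β in F(β) and the theorem

module _ {c ℓ₁ ℓ₂} (F : HeytingField c ℓ₁ ℓ₂) where
  open RationalFunctions F
  private
    module K = CommutativeRing F⟨β⟩
    module F[β] = CommutativeRing F[β]

  β*β⁻¹ : β K.* β⁻¹ K.≈ K.1#
  β*β⁻¹ = cross (F[β].trans (F[β].*-identityʳ (X F[β].* F[β].1#)) (F[β].trans (F[β].*-comm X F[β].1#) (F[β].sym (F[β].*-identityˡ (F[β].1# F[β].* X)))))
    where X = Polynomials.X baseRing

  -- Together with β^0 = 1 this recurrence, over all integers, is all that the comparison of
  -- coefficients uses about powers of β; for negative exponents it rests on β β⁻¹ = 1.
  β^-suc : ∀ i → β^ (ℤ.suc i) K.≈ β K.* β^ i
  β^-suc (+ k)          = K.refl {β K.* β^ (+ k)}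
  β^-suc -[1+ zero ]    = K.sym {β K.* (β⁻¹ K.* K.1#)} {K.1#} (K.trans {β K.* (β⁻¹ K.* K.1#)} {β K.* β⁻¹} {K.1#} (K.*-congˡ {β} {β⁻¹ K.* K.1#} {β⁻¹} (K.*-identityʳ β⁻¹)) β*β⁻¹)
  β^-suc -[1+ suc k ]   = K.sym {β K.* (β⁻¹ K.* p)} {p} (K.trans {β K.* (β⁻¹ K.* p)} {(β K.* β⁻¹) K.* p} {p} (K.sym {(β K.* β⁻¹) K.* p} {β K.* (β⁻¹ K.* p)} (K.*-assoc β β⁻¹ p))
      (K.trans {(β K.* β⁻¹) K.* p} {K.1# K.* p} {p} (K.*-congʳ {p} {β K.* β⁻¹} {K.1#} β*β⁻¹) (K.*-identityˡ p)))
    where p = β^ -[1+ k ]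

open import Data.Integer.Base using (_-_)

theorem6p7 : ∀ {c ℓ₁ ℓ₂} (F : HeytingField c ℓ₁ ℓ₂) (n : ℕ) .{{_ : NonZero n}}
    (θ : SkewDiagram) (μ : Partition) →
    let open Grothendieck F n in
    (∃ λ coef → IsExpansion (G θ Kx.* G (straight μ)) coef) ×
    (∀ coef → IsExpansion (G θ Kx.* G (straight μ)) coef →
    ∀ (ν : Partition) → ℓ ν ≤ n →
    coef ν K.≈ β^ (+ ∣ ν ∣ₚ - + ∣ μ ∣ₚ - + ∣ θ ∣ₛ) K.* fromℕ (numberOfTableaux n θ μ ν))
theorem6p7 F n θ μ = (E.coefficient , record
    { support  = E.support
    ; unique   = Unique.deduplicate-! _≟ₚ_ (E.reached (tableaux n θ))
    ; bounded  = E.support-bounded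
    ; vanishes = E.coefficient-vanishes
    ; expands  = A.expands-∑ n θ μ
    }) , λ coef e → let open Grothendieck.IsExpansion e in
      A.expansion-unique-∑ n θ μ coef support unique bounded vanishes expands
  where
  open RationalFunctions F
  module A = Assembly F⟨β⟩ β β^_ (CommutativeRing.refl F⟨β⟩ {β^ (+ 0)}) (β^-suc F)
  module E = A.Expansion n θ μ
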